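{- The continuous fragment and the discrete fragment of differential game logic $\mathsf{dGL}$ are each provably expressive for $\mathsf{dGL}$: for every $\mathsf{dGL}$-formula $\varphi$ there are a formula $\rho_1$ of the continuous fragment and a formula $\rho_2$ of the discrete fragment such that $\vdash_{\mathsf{dGL}}\rho_1\leftrightarrow\varphi$ and $\vdash_{\mathsf{dGL}}\rho_2\leftrightarrow\varphi$.
   Context: Fix an infinite set $\mathcal X$ of object variables and an infinite set $\mathcal V$ of propositional variables; each $X\in\mathcal V$ has a fresh complement $\overline X$, $\overline{\overline X}=X$, $\overline{\mathcal V}=\mathcal V\cup\{\overline X:X\in\mathcal V\}$. $\mathcal L$ is the first-order signature of ordered fields (terms are polynomials; rational constants are definable and used freely); a literal is an atomic $\mathcal L$-formula over $\mathcal X$ or its negation. $\mathrm{Act}$ consists of $x:=*$ (nondeterministic assignment), $x:=\theta$ (deterministic assignment, $\theta$ an $\mathcal L$-term) and $x'=\theta\,\&\,\psi$ (continuous evolution: $x$ an $N$-tuple of variables, $\theta$ an $N$-tuple of $\mathcal L$-terms, $\psi$ a first-order $\mathcal L$-formula); $x'=\theta$ means $\psi$ is true. $\mathsf{dGL}$-formulas and games: $\varphi::=p\mid\neg\varphi\mid\varphi\lor\varphi\mid\langle\gamma\rangle\varphi$, $\gamma::=a\mid{?\varphi}\mid\gamma\cup\gamma\mid\gamma;\gamma\mid\gamma^*\mid\gamma^d$ with $p$ a literal and $a\in\mathrm{Act}$. Abbreviations: $\land,\to,\leftrightarrow$ as usual, $[\gamma]\varphi=\langle\gamma^d\rangle\varphi$,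 $\gamma_1\cap\gamma_2=(\gamma_1^d\cup\gamma_2^d)^d$, $\gamma^\times=((\gamma^d)^*)^d$, $\top,\bot$ truth and falsity. $\exists x$, $\forall x$ abbreviate $\langle x:=*\rangle$, $[x:=*]$. $\varphi_x^y$ exchanges $x$ and $y$ throughout. The continuous fragment of $\mathsf{dGL}$ consists of all formulas containing as atomic games only continuous evolutions; the discrete fragment of all formulas containing as atomic games only nondeterministic assignments. Provability $\vdash_{\mathsf{dGL}}$ (Hilbert style on $\mathsf{dGL}$-formulas). Axioms: propositional tautologies; first-order equality axioms; $\varphi[\theta/x]\to\langle x:=*\rangle\varphi$ (capture-avoiding substitution); $\langle x:=*\rangle\psi\to\psi$ ($x$ not free in $\psi$); $\langle x:=\theta\rangle\varphi\leftrightarrow\langle y:=*\rangle(y=\theta\land\varphi_x^y)$ ($y$ not in $\varphi,\theta$); $\langle?\psi\rangle\varphi\leftrightarrow(\psi\land\varphi)$; $\langle\gamma_1\cup\gamma_2\rangle\varphi\leftrightarrow(\langle\gamma_1\rangle\varphi\lor\langle\gamma_2\rangle\varphi)$; $\langle\gamma_1;\gamma_2\rangle\varphi\leftrightarrow\langle\gamma_1\rangle\langle\gamma_2\rangle\varphi$; $\langle\gamma^*\rangle\varphi\leftrightarrow(\varphi\lor\langle\gamma\rangle\langle\gamma^*\rangle\varphi)$; $\langle\gamma^d\rangle\varphi\leftrightarrow\neg\langle\gamma\rangle\neg\varphi$; all first-order $\mathcal L$-formulas valid in $\mathbb R$; all instances of axiom $\&$ ($t$ fresh): $\langle x'=\theta\,\&\,\psi\rangle\varphi\leftrightarrow\langle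 t:=0\rangle\langle x'=\theta,t'=1\rangle(\varphi\land[x'=-\theta,t'=-1](t\ge0\to\psi))$; and all formulas $\chi^\flat$ for instances $\chi$ of $\nabla$ (below). Rules: modus ponens; from $\psi\to\varphi$ infer $\langle\gamma\rangle\psi\to\langle\gamma\rangle\varphi$; from $(\psi\lor\langle\gamma\rangle\varphi)\to\varphi$ infer $\langle\gamma^*\rangle\psi\to\varphi$. $\mathsf{dL}\mu$-formulas: formulas without free propositional variables given by $\varphi::=p\mid X\mid\varphi\lor\varphi\mid\varphi\land\varphi\mid\langle a\rangle\varphi\mid[a]\varphi\mid\mu X.\psi\mid\nu X.\psi$, $X\in\overline{\mathcal V}$, $\psi$ not mentioning $\overline X$. Negation $\overline\varphi$: $\overline p$ is $\neg p$, it exchanges $X/\overline X$, $\lor/\land$, $\langle a\rangle/[a]$, and $\overline{\mu X.\varphi}=\nu\overline X.\overline\varphi$, $\overline{\nu X.\varphi}=\mu\overline X.\overline\varphi$; $\varphi\to\psi$ is $\overline\varphi\lor\psi$. Axiom scheme $\nabla$ (for $\mathsf{dL}\mu$-formulas $\varphi$; $y,z,u$ tuples of fresh variables, $t,M$ fresh): $\langle x'=\theta\rangle\varphi\leftrightarrow\exists y(\langle x:=y\rangle\varphi\land\exists t\ge0\,\exists M>0\,\nu X.\rho)$, where $\rho$ is the conjunction of $|x|\le M\land|y|\le M$; $\exists z(|z|\le M\land|y-x|\le t|\theta_x^z|)$; $\exists z(|z|\le M\land2|y-x-t\theta|\le t^2|\hat\theta_x^z|)$; $\exists u\langle t:=\tfrac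 t2\rangle(\langle y:=u\rangle X\land\langle x:=u\rangle X)$; with $\hat\theta=(\sum_i(\partial_i\theta_1)\theta_i,\dots,\sum_i(\partial_i\theta_N)\theta_i)$, formal partial derivatives $\partial_i$ in $x_i$, norms being expressed by first-order formulas. Translation $\flat$ (after renaming so that each propositional variable is bound at most once; $\kappa_X$ pairwise distinct numerals, $c$ a fresh object variable): $G(p)={?p};(?\bot)^d$; $G(X)=(c:=\kappa_X)$; $G(\varphi_1\lor\varphi_2)=G(\varphi_1)\cup G(\varphi_2)$; $G(\varphi_1\land\varphi_2)=G(\varphi_1)\cap G(\varphi_2)$; $G(\langle a\rangle\varphi)=a;G(\varphi)$; $G([a]\varphi)=a^d;G(\varphi)$; $G(\mu X.\varphi)=c:=\kappa_X;(?c=\kappa_X;G(\varphi))^*;?c\ne\kappa_X$; $G(\nu X.\varphi)=c:=\kappa_X;((?c=\kappa_X)^d;G(\varphi))^\times;(?c\ne\kappa_X)^d$; $\psi^\flat=\langle G(\psi)\rangle\top$. -}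

module Defs where

open import Data.Bool.Base as Bool using (Bool; true)
open import Data.Integer.Base using (+_)
open import Data.List.Base as List using (List; []; _∷_; _++_; filter)
open import Data.List.Membership.Propositional using (_∉_)
open import Data.List.Relation.Unary.All using (All)
import Data.List.Relation.Unary.Unique.Propositional as ListUnique
open import Data.Nat.Base as ℕ using (ℕ; suc)
open import Data.Nat.Properties using (_≟_)
open import Data.List.Membership.DecPropositional _≟_ using (_∈_; _∈?_; _∉?_)
open import Data.Product.Base using (Σ; _×_; _,_)
open import Data.Rational.Base as ℚ using (ℚ; 0ℚ; 1ℚ; ½)
open import Data.Vec.Base as Vec using (Vec; []; _∷_; toList)
import Data.Vec.Relation.Unary.All as VecAll
open import Data.Vec.Relation.Unary.Unique.Propositional using (Unique; _∷_)
open import Data.Vec.Relation.Unary.Unique.Propositional.Properties using (map⁺)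
open import Function.Definitions using (Injective)
open import Relation.Binary.PropositionalEquality
  using (_≡_; _≢_; refl; sym; trans)
open import Relation.Nullary using (¬_; yes; no; contradiction)

------------------------------------------------------------------------
-- Terms, literals and first-order formulas of ordered fields

Var : Set
Var = ℕ

infix  9 ⊖_
infixl 8 _⊗_
infixl 7 _⊕_ _⊝_
infix  6 _≐_ _≼_

-- s < r is the negative literal of r ≼ s.  Rational constants are definable
-- over the signature 0, 1, +, -, ·, ≤ and are taken as primitive.
data Term : Set where
  var     : Var → Term
  const   : ℚ → Term
  _⊕_ _⊗_ : Term → Term → Term
  ⊖_      : Term → Term

_⊝_ : Term → Term → Term
s ⊝ r = s ⊕ ⊖ r

data Atom : Set where
  _≐_ _≼_ : Term → Term → Atom

data Literal : Set where
  pos neg : Atom → Literal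

trueᴸ falseᴸ : Literal
trueᴸ  = pos (const 0ℚ ≐ const 0ℚ)
falseᴸ = neg (const 0ℚ ≐ const 0ℚ)

infix  9 _:=* _:=_
infix  8 _ᵈ _* _ˣ
infix  7 ⁇_
infixr 6 _⨾_
infixr 5 _∪_ _∩_
infixr 5 ~_ ⟨_⟩_ [_]_
infixr 4 _∧_ _∨_
infixr 3 _⇒_
infix  2 _⇔_

data FO : Set where
  lit    : Literal → FO
  ~_     : FO → FO
  _∨_    : FO → FO → FO
  all ex : Var → FO → FO

trueᶠᵒ : FO
trueᶠᵒ = lit trueᴸ

------------------------------------------------------------------------
-- dGL

-- The proof that the evolving variables are pairwise distinct is irrelevant,
-- so evolutions are determined by their variables, right-hand sides and domain.
data Act : Set where
  _:=*   : Var → Act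
  _:=_   : Var → Term → Act
  evolve : ∀ {n} (x : Vec Var (suc n)) .(d : Unique x)
           (θ : Vec Term (suc n)) (ψ : FO) → Act

data Game : Set
data Fml  : Set

data Game where
  act     : Act → Game
  ⁇_      : Fml → Game
  _∪_ _⨾_ : Game → Game → Game
  _* _ᵈ   : Game → Game

data Fml where
  lit  : Literal → Fml
  ~_   : Fml → Fml
  _∨_  : Fml → Fml → Fml
  ⟨_⟩_ : Game → Fml → Fml

_∧_ _⇒_ _⇔_ : Fml → Fml → Fml
φ ∧ ψ = ~ (~ φ ∨ ~ ψ)
φ ⇒ ψ = ~ φ ∨ ψ
φ ⇔ ψ = (φ ⇒ ψ) ∧ (ψ ⇒ φ)

[_]_ : Game → Fml → Fml
[ γ ] φ = ⟨ γ ᵈ ⟩ φ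

_∩_ : Game → Game → Game
γ ∩ δ = (γ ᵈ ∪ δ ᵈ) ᵈ

_ˣ : Game → Game
γ ˣ = ((γ ᵈ) *) ᵈ

⊤ᶠ ⊥ᶠ : Fml
⊤ᶠ = lit trueᴸ
⊥ᶠ = lit falseᴸ

-- First-order quantifiers are read as nondeterministic assignments.
⌜_⌝ : FO → Fml
⌜ lit p ⌝   = lit p
⌜ ~ F ⌝     = ~ ⌜ F ⌝
⌜ F ∨ G ⌝   = ⌜ F ⌝ ∨ ⌜ G ⌝
⌜ all x F ⌝ = [ act (x :=*) ] ⌜ F ⌝
⌜ ex x F ⌝  = ⟨ act (x :=*) ⟩ ⌜ F ⌝

------------------------------------------------------------------------
-- The continuous and the discrete fragment

mutual
  actsG : Game → List Act
  actsG (act a) = a ∷ []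
  actsG (⁇ φ)   = acts φ
  actsG (γ ∪ δ) = actsG γ ++ actsG δ
  actsG (γ ⨾ δ) = actsG γ ++ actsG δ
  actsG (γ *)   = actsG γ
  actsG (γ ᵈ)   = actsG γ

  acts : Fml → List Act
  acts (lit p)   = []
  acts (~ φ)     = acts φ
  acts (φ ∨ ψ)   = acts φ ++ acts ψ
  acts (⟨ γ ⟩ φ) = actsG γ ++ acts φ

data IsContinuous : Act → Set where
  evolve : ∀ {n} {x : Vec Var (suc n)} .{d : Unique x} {θ ψ} →
           IsContinuous (evolve x d θ ψ)

data IsDiscrete : Act → Set where
  _:=* : ∀ x → IsDiscrete (x :=*)

Continuous Discrete : Fml → Set
Continuous φ = All IsContinuous (acts φ)
Discrete   φ = All IsDiscrete (acts φ)

------------------------------------------------------------------------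
-- Variables

varsT : Term → List Var
varsT (var x)   = x ∷ []
varsT (const q) = []
varsT (s ⊕ r)   = varsT s ++ varsT r
varsT (s ⊗ r)   = varsT s ++ varsT r
varsT (⊖ s)     = varsT s

varsT* : ∀ {n} → Vec Term n → List Var
varsT* θ = List.concatMap varsT (toList θ)

varsA : Atom → List Var
varsA (s ≐ r) = varsT s ++ varsT r
varsA (s ≼ r) = varsT s ++ varsT r

varsL : Literal → List Var
varsL (pos a) = varsA a
varsL (neg a) = varsA a

varsFO : FO → List Var
varsFO (lit p)   = varsL p
varsFO (~ F)     = varsFO F
varsFO (F ∨ G)   = varsFO F ++ varsFO G
varsFO (all x F) = x ∷ varsFO F
varsFO (ex x F)  = x ∷ varsFO F

varsAct : Act → List Var
varsAct (x :=*)          = x ∷ []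
varsAct (x := θ)         = x ∷ varsT θ
varsAct (evolve x _ θ ψ) = toList x ++ varsT* θ ++ varsFO ψ

mutual
  varsG : Game → List Var
  varsG (act a) = varsAct a
  varsG (⁇ φ)   = vars φ
  varsG (γ ∪ δ) = varsG γ ++ varsG δ
  varsG (γ ⨾ δ) = varsG γ ++ varsG δ
  varsG (γ *)   = varsG γ
  varsG (γ ᵈ)   = varsG γ

  vars : Fml → List Var
  vars (lit p)   = varsL p
  vars (~ φ)     = vars φ
  vars (φ ∨ ψ)   = vars φ ++ vars ψ
  vars (⟨ γ ⟩ φ) = varsG γ ++ vars φ

_∖_ : List Var → List Var → List Var
xs ∖ ys = filter (_∉? ys) xs

boundAct : Act → List Var
boundAct (x :=*)          = x ∷ []
boundAct (x := θ)         = x ∷ []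
boundAct (evolve x _ θ ψ) = toList x

-- Variables written on some play of the game.
boundG : Game → List Var
boundG (act a) = boundAct a
boundG (⁇ φ)   = []
boundG (γ ∪ δ) = boundG γ ++ boundG δ
boundG (γ ⨾ δ) = boundG γ ++ boundG δ
boundG (γ *)   = boundG γ
boundG (γ ᵈ)   = boundG γ

-- Variables written on every play of the game.
mustBoundG : Game → List Var
mustBoundG (act a) = boundAct a
mustBoundG (⁇ φ)   = []
mustBoundG (γ ∪ δ) = filter (_∈? mustBoundG δ) (mustBoundG γ)
mustBoundG (γ ⨾ δ) = mustBoundG γ ++ mustBoundG δ
mustBoundG (γ *)   = []
mustBoundG (γ ᵈ)   = mustBoundG γ

freeFO : FO → List Var
freeFO (lit p)   = varsL p
freeFO (~ F)     = freeFO F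
freeFO (F ∨ G)   = freeFO F ++ freeFO G
freeFO (all x F) = freeFO F ∖ (x ∷ [])
freeFO (ex x F)  = freeFO F ∖ (x ∷ [])

-- An evolution depends on the initial values of the variables it changes.
freeAct : Act → List Var
freeAct (x :=*)          = []
freeAct (x := θ)         = varsT θ
freeAct (evolve x _ θ ψ) = toList x ++ varsT* θ ++ freeFO ψ

mutual
  freeG : Game → List Var
  freeG (act a) = freeAct a
  freeG (⁇ φ)   = free φ
  freeG (γ ∪ δ) = freeG γ ++ freeG δ
  freeG (γ ⨾ δ) = freeG γ ++ (freeG δ ∖ mustBoundG γ)
  freeG (γ *)   = freeG γ
  freeG (γ ᵈ)   = freeG γ

  free : Fml → List Var
  free (lit p)   = varsL p
  free (~ φ)     = free φ
  free (φ ∨ ψ)   = free φ ++ free ψ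
  free (⟨ γ ⟩ φ) = freeG γ ++ (free φ ∖ mustBoundG γ)

------------------------------------------------------------------------
-- Exchanging two variables throughout (free and bound occurrences)

module Exchange (x y : Var) where

  exV : Var → Var
  exV v with v ≟ x
  ... | yes _ = y
  ... | no _ with v ≟ y
  ...   | yes _ = x
  ...   | no _  = v

  exV-injective : ∀ {v w} → exV v ≡ exV w → v ≡ w
  exV-injective {v} {w} eq with v ≟ x | w ≟ x
  ... | yes p | yes q = trans p (sym q)
  ... | yes p | no q with w ≟ y
  ...   | yes r = trans p (trans (sym eq) (sym r))
  ...   | no r  = contradiction (sym eq) r
  exV-injective {v} {w} eq | no p | yes q with v ≟ y
  ...   | yes r = trans r (trans (sym eq) (sym q))
  ...   | no r  = contradiction eq r
  exV-injective {v} {w} eq | no p | no q with v ≟ y | w ≟ y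
  ...   | yes r | yes s = trans r (sym s)
  ...   | yes r | no s  = contradiction (sym eq) q
  ...   | no r  | yes s = contradiction eq p
  ...   | no r  | no s  = eq

  exT : Term → Term
  exT (var v)   = var (exV v)
  exT (const q) = const q
  exT (s ⊕ r)   = exT s ⊕ exT r
  exT (s ⊗ r)   = exT s ⊗ exT r
  exT (⊖ s)     = ⊖ exT s

  exA : Atom → Atom
  exA (s ≐ r) = exT s ≐ exT r
  exA (s ≼ r) = exT s ≼ exT r

  exL : Literal → Literal
  exL (pos a) = pos (exA a)
  exL (neg a) = neg (exA a)

  exFO : FO → FO
  exFO (lit p)   = lit (exL p)
  exFO (~ F)     = ~ exFO F
  exFO (F ∨ G)   = exFO F ∨ exFO G
  exFO (all v F) = all (exV v) (exFO F)
  exFO (ex v F)  = ex (exV v) (exFO F)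

  exAct : Act → Act
  exAct (v :=*)          = exV v :=*
  exAct (v := θ)         = exV v := exT θ
  exAct (evolve v d θ ψ) =
    evolve (Vec.map exV v) (map⁺ exV-injective d) (Vec.map exT θ) (exFO ψ)

  mutual
    exG : Game → Game
    exG (act a) = act (exAct a)
    exG (⁇ φ)   = ⁇ exF φ
    exG (γ ∪ δ) = exG γ ∪ exG δ
    exG (γ ⨾ δ) = exG γ ⨾ exG δ
    exG (γ *)   = (exG γ) *
    exG (γ ᵈ)   = (exG γ) ᵈ

    exF : Fml → Fml
    exF (lit p)   = lit (exL p)
    exF (~ φ)     = ~ exF φ
    exF (φ ∨ ψ)   = exF φ ∨ exF ψ
    exF (⟨ γ ⟩ φ) = ⟨ exG γ ⟩ exF φ

exchange : Var → Var → Fml → Fml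
exchange x y = Exchange.exF x y

exchangeT* : ∀ {n} → Vec Var n → Vec Var n → Term → Term
exchangeT* []       []       s = s
exchangeT* (x ∷ xs) (y ∷ ys) s = exchangeT* xs ys (Exchange.exT x y s)

------------------------------------------------------------------------
-- Capture-avoiding substitution

substT : Var → Term → Term → Term
substT x θ (var y) with y ≟ x
... | yes _ = θ
... | no _  = var y
substT x θ (const q) = const q
substT x θ (s ⊕ r)   = substT x θ s ⊕ substT x θ r
substT x θ (s ⊗ r)   = substT x θ s ⊗ substT x θ r
substT x θ (⊖ s)     = ⊖ substT x θ s

substA : Var → Term → Atom → Atom
substA x θ (s ≐ r) = substT x θ s ≐ substT x θ r
substA x θ (s ≼ r) = substT x θ s ≼ substT x θ r

substL : Var → Term → Literal → Literal
substL x θ (pos a) = pos (substA x θ a)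
substL x θ (neg a) = neg (substA x θ a)

-- Substitution is partial: in ⟨ γ ⟩ φ the variable x may be read and then
-- written by γ, in which case the result need not exist.  Hence it is given as
-- a relation: F [ θ / x ]ᶠᵒ F′ says that F′ is a result of substituting θ for x.
data _[_/_]ᶠᵒ_ : FO → Term → Var → FO → Set where
  nonfree : ∀ {F θ x} → x ∉ freeFO F → F [ θ / x ]ᶠᵒ F
  lit     : ∀ {p θ x} → lit p [ θ / x ]ᶠᵒ lit (substL x θ p)
  ~_      : ∀ {F F′ θ x} → F [ θ / x ]ᶠᵒ F′ → (~ F) [ θ / x ]ᶠᵒ (~ F′)
  _∨_     : ∀ {F F′ G G′ θ x} → F [ θ / x ]ᶠᵒ F′ → G [ θ / x ]ᶠᵒ G′ →
            (F ∨ G) [ θ / x ]ᶠᵒ (F′ ∨ G′)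
  all     : ∀ {F F′ θ x y} → y ∉ x ∷ varsT θ → F [ θ / x ]ᶠᵒ F′ →
            all y F [ θ / x ]ᶠᵒ all y F′
  ex      : ∀ {F F′ θ x y} → y ∉ x ∷ varsT θ → F [ θ / x ]ᶠᵒ F′ →
            ex y F [ θ / x ]ᶠᵒ ex y F′

-- No variable of xs can be captured by a game binding the variables ys.
_#_ : List Var → List Var → Set
xs # ys = All (_∉ ys) xs

mutual
  data _[_/_]ᴳ_ : Game → Term → Var → Game → Set where
    nonfree : ∀ {γ θ x} → x ∉ freeG γ → γ [ θ / x ]ᴳ γ
    assign  : ∀ {y η θ x} →
              act (y := η) [ θ / x ]ᴳ act (y := substT x θ η)
    evolve  : ∀ {n} {y : Vec Var (suc n)} .{d : Unique y} {η ψ ψ′ θ x} →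
              (x ∷ varsT θ) # toList y → ψ [ θ / x ]ᶠᵒ ψ′ →
              act (evolve y d η ψ) [ θ / x ]ᴳ
                act (evolve y d (Vec.map (substT x θ) η) ψ′)
    ⁇_      : ∀ {φ φ′ θ x} → φ [ θ / x ] φ′ → (⁇ φ) [ θ / x ]ᴳ (⁇ φ′)
    _∪_     : ∀ {γ γ′ δ δ′ θ x} → γ [ θ / x ]ᴳ γ′ → δ [ θ / x ]ᴳ δ′ →
              (γ ∪ δ) [ θ / x ]ᴳ (γ′ ∪ δ′)
    seq     : ∀ {γ γ′ δ δ′ θ x} → (x ∷ varsT θ) # boundG γ →
              γ [ θ / x ]ᴳ γ′ → δ [ θ / x ]ᴳ δ′ →
              (γ ⨾ δ) [ θ / x ]ᴳ (γ′ ⨾ δ′)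
    seq!    : ∀ {γ γ′ δ θ x} → x ∈ mustBoundG γ → γ [ θ / x ]ᴳ γ′ →
              (γ ⨾ δ) [ θ / x ]ᴳ (γ′ ⨾ δ)
    star    : ∀ {γ γ′ θ x} → (x ∷ varsT θ) # boundG γ → γ [ θ / x ]ᴳ γ′ →
              (γ *) [ θ / x ]ᴳ (γ′ *)
    dual    : ∀ {γ γ′ θ x} → γ [ θ / x ]ᴳ γ′ → (γ ᵈ) [ θ / x ]ᴳ (γ′ ᵈ)

  -- The rule rename covers formulas such as ⟨ (x := x + 1)* ⟩ p(x), in which x
  -- is both read and written: a variable y not occurring at all is substituted
  -- for x by renaming bound occurrences of x as well.
  data _[_/_]_ : Fml → Term → Var → Fml → Set where
    nonfree : ∀ {φ θ x} → x ∉ free φ → φ [ θ / x ] φ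
    lit     : ∀ {p θ x} → lit p [ θ / x ] lit (substL x θ p)
    ~_      : ∀ {φ φ′ θ x} → φ [ θ / x ] φ′ → (~ φ) [ θ / x ] (~ φ′)
    _∨_     : ∀ {φ φ′ ψ ψ′ θ x} → φ [ θ / x ] φ′ → ψ [ θ / x ] ψ′ →
              (φ ∨ ψ) [ θ / x ] (φ′ ∨ ψ′)
    dia     : ∀ {γ γ′ φ φ′ θ x} → (x ∷ varsT θ) # boundG γ →
              γ [ θ / x ]ᴳ γ′ → φ [ θ / x ] φ′ →
              (⟨ γ ⟩ φ) [ θ / x ] (⟨ γ′ ⟩ φ′)
    dia!    : ∀ {γ γ′ φ θ x} → x ∈ mustBoundG γ → γ [ θ / x ]ᴳ γ′ →
              (⟨ γ ⟩ φ) [ θ / x ] (⟨ γ′ ⟩ φ)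
    self    : ∀ {φ x} → φ [ var x / x ] φ
    rename  : ∀ {φ x y} → y ∉ vars φ → φ [ var y / x ] exchange x y φ

------------------------------------------------------------------------
-- Validity in ℝ

record ℝ : Set where
  field
    approx : ℕ → ℚ
    cauchy : ∀ ε → 0ℚ ℚ.< ε → Σ ℕ λ N → ∀ m n → N ℕ.≤ m → N ℕ.≤ n →
             ℚ.∣ approx m ℚ.- approx n ∣ ℚ.≤ ε

-- The field operations act pointwise on Cauchy sequences, so a term evaluates
-- to a sequence representing its value.
⟦_⟧ᵀ : Term → (Var → ℝ) → ℕ → ℚ
⟦ var x ⟧ᵀ   ω n = ℝ.approx (ω x) n
⟦ const q ⟧ᵀ ω n = q
⟦ s ⊕ r ⟧ᵀ   ω n = ⟦ s ⟧ᵀ ω n ℚ.+ ⟦ r ⟧ᵀ ω n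
⟦ s ⊗ r ⟧ᵀ   ω n = ⟦ s ⟧ᵀ ω n ℚ.* ⟦ r ⟧ᵀ ω n
⟦ ⊖ s ⟧ᵀ     ω n = ℚ.- ⟦ s ⟧ᵀ ω n

⟦_⟧ᴬ : Atom → (Var → ℝ) → Set
⟦ s ≐ r ⟧ᴬ ω = ∀ ε → 0ℚ ℚ.< ε → Σ ℕ λ N → ∀ n → N ℕ.≤ n →
               ℚ.∣ ⟦ s ⟧ᵀ ω n ℚ.- ⟦ r ⟧ᵀ ω n ∣ ℚ.≤ ε
⟦ s ≼ r ⟧ᴬ ω = ∀ ε → 0ℚ ℚ.< ε → Σ ℕ λ N → ∀ n → N ℕ.≤ n →
               ⟦ s ⟧ᵀ ω n ℚ.≤ ⟦ r ⟧ᵀ ω n ℚ.+ ε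

⟦_⟧ᴸ : Literal → (Var → ℝ) → Set
⟦ pos a ⟧ᴸ ω = ⟦ a ⟧ᴬ ω
⟦ neg a ⟧ᴸ ω = ¬ ⟦ a ⟧ᴬ ω

_[_↦_] : (Var → ℝ) → Var → ℝ → Var → ℝ
(ω [ x ↦ r ]) y with y ≟ x
... | yes _ = r
... | no _  = ω y

-- Truth is classical: disjunction and existence are read through their de
-- Morgan duals.  (Atoms are ¬¬-stable, since the sequences are Cauchy.)
⟦_⟧ : FO → (Var → ℝ) → Set
⟦ lit p ⟧   ω = ⟦ p ⟧ᴸ ω
⟦ ~ F ⟧     ω = ¬ ⟦ F ⟧ ω
⟦ F ∨ G ⟧   ω = ¬ (¬ ⟦ F ⟧ ω × ¬ ⟦ G ⟧ ω)
⟦ all x F ⟧ ω = ∀ r → ⟦ F ⟧ (ω [ x ↦ r ])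
⟦ ex x F ⟧  ω = ¬ (∀ r → ¬ ⟦ F ⟧ (ω [ x ↦ r ]))

Valid : FO → Set
Valid F = ∀ ω → ⟦ F ⟧ ω

------------------------------------------------------------------------
-- dLμ

-- 𝒱 is pos, and its complements are neg.
data PVar : Set where
  pos neg : ℕ → PVar

co : PVar → PVar
co (pos n) = neg n
co (neg n) = pos n

infixr 5 ⟨_⟩ᵐ_ [_]ᵐ_
infixr 4 _∧ᵐ_ _∨ᵐ_
infixr 3 _⇒ᵐ_
infix  2 _⇔ᵐ_

data Mu : Set where
  lit          : Literal → Mu
  pvar         : PVar → Mu
  _∨ᵐ_ _∧ᵐ_    : Mu → Mu → Mu
  ⟨_⟩ᵐ_ [_]ᵐ_  : Act → Mu → Mu
  μ ν          : PVar → Mu → Mu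

-- All propositional variables, free and bound.
pvars : Mu → List PVar
pvars (lit p)      = []
pvars (pvar X)     = X ∷ []
pvars (φ ∨ᵐ ψ)     = pvars φ ++ pvars ψ
pvars (φ ∧ᵐ ψ)     = pvars φ ++ pvars ψ
pvars (⟨ a ⟩ᵐ φ)   = pvars φ
pvars ([ a ]ᵐ φ)   = pvars φ
pvars (μ X φ)      = X ∷ pvars φ
pvars (ν X φ)      = X ∷ pvars φ

-- The binders, with multiplicity.
binders : Mu → List PVar
binders (lit p)    = []
binders (pvar X)   = []
binders (φ ∨ᵐ ψ)   = binders φ ++ binders ψ
binders (φ ∧ᵐ ψ)   = binders φ ++ binders ψ
binders (⟨ a ⟩ᵐ φ) = binders φ
binders ([ a ]ᵐ φ) = binders φ
binders (μ X φ)    = X ∷ binders φ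
binders (ν X φ)    = X ∷ binders φ

data _FreeIn_ (X : PVar) : Mu → Set where
  pvar : X FreeIn pvar X
  ∨ˡ   : ∀ {φ ψ} → X FreeIn φ → X FreeIn (φ ∨ᵐ ψ)
  ∨ʳ   : ∀ {φ ψ} → X FreeIn ψ → X FreeIn (φ ∨ᵐ ψ)
  ∧ˡ   : ∀ {φ ψ} → X FreeIn φ → X FreeIn (φ ∧ᵐ ψ)
  ∧ʳ   : ∀ {φ ψ} → X FreeIn ψ → X FreeIn (φ ∧ᵐ ψ)
  dia  : ∀ {a φ} → X FreeIn φ → X FreeIn (⟨ a ⟩ᵐ φ)
  box  : ∀ {a φ} → X FreeIn φ → X FreeIn ([ a ]ᵐ φ)
  μ    : ∀ {Y φ} → X ≢ Y → X FreeIn φ → X FreeIn (μ Y φ)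
  ν    : ∀ {Y φ} → X ≢ Y → X FreeIn φ → X FreeIn (ν Y φ)

data WellFormed : Mu → Set where
  lit  : ∀ {p} → WellFormed (lit p)
  pvar : ∀ {X} → WellFormed (pvar X)
  or   : ∀ {φ ψ} → WellFormed φ → WellFormed ψ → WellFormed (φ ∨ᵐ ψ)
  and  : ∀ {φ ψ} → WellFormed φ → WellFormed ψ → WellFormed (φ ∧ᵐ ψ)
  dia  : ∀ {a φ} → WellFormed φ → WellFormed (⟨ a ⟩ᵐ φ)
  box  : ∀ {a φ} → WellFormed φ → WellFormed ([ a ]ᵐ φ)
  μ    : ∀ {X φ} → co X ∉ pvars φ → WellFormed φ → WellFormed (μ X φ)
  ν    : ∀ {X φ} → co X ∉ pvars φ → WellFormed φ → WellFormed (ν X φ)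

record IsFormula (φ : Mu) : Set where
  field
    wellFormed : WellFormed φ
    closed     : ∀ X → ¬ X FreeIn φ

coL : Literal → Literal
coL (pos a) = neg a
coL (neg a) = pos a

∁ : Mu → Mu
∁ (lit p)      = lit (coL p)
∁ (pvar X)     = pvar (co X)
∁ (φ ∨ᵐ ψ)     = ∁ φ ∧ᵐ ∁ ψ
∁ (φ ∧ᵐ ψ)     = ∁ φ ∨ᵐ ∁ ψ
∁ (⟨ a ⟩ᵐ φ)   = [ a ]ᵐ ∁ φ
∁ ([ a ]ᵐ φ)   = ⟨ a ⟩ᵐ ∁ φ
∁ (μ X φ)      = ν (co X) (∁ φ)
∁ (ν X φ)      = μ (co X) (∁ φ)

_⇒ᵐ_ _⇔ᵐ_ : Mu → Mu → Mu
φ ⇒ᵐ ψ = ∁ φ ∨ᵐ ψ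
φ ⇔ᵐ ψ = (φ ⇒ᵐ ψ) ∧ᵐ (ψ ⇒ᵐ φ)

varsM : Mu → List Var
varsM (lit p)    = varsL p
varsM (pvar X)   = []
varsM (φ ∨ᵐ ψ)   = varsM φ ++ varsM ψ
varsM (φ ∧ᵐ ψ)   = varsM φ ++ varsM ψ
varsM (⟨ a ⟩ᵐ φ) = varsAct a ++ varsM φ
varsM ([ a ]ᵐ φ) = varsAct a ++ varsM φ
varsM (μ X φ)    = varsM φ
varsM (ν X φ)    = varsM φ

------------------------------------------------------------------------
-- The axiom scheme ∇

∂ : Var → Term → Term
∂ x (var y) with y ≟ x
... | yes _ = const 1ℚ
... | no _  = const 0ℚ
∂ x (const q) = const 0ℚ
∂ x (s ⊕ r)   = ∂ x s ⊕ ∂ x r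
∂ x (s ⊗ r)   = ∂ x s ⊗ r ⊕ s ⊗ ∂ x r
∂ x (⊖ s)     = ⊖ ∂ x s

∑ : ∀ {n} → Vec Term n → Term
∑ = Vec.foldr′ _⊕_ (const 0ℚ)

hat : ∀ {n} → Vec Var n → Vec Term n → Vec Term n
hat x θ = Vec.map (λ θⱼ → ∑ (Vec.zipWith (λ xᵢ θᵢ → ∂ xᵢ θⱼ ⊗ θᵢ) x θ)) θ

‖_‖² : ∀ {n} → Vec Term n → Term
‖ v ‖² = ∑ (Vec.map (λ s → s ⊗ s) v)

0≤_ : Term → Mu
0≤ s = lit (pos (const 0ℚ ≼ s))

-- |v| ≤ M for the Euclidean norm.
norm≤ : ∀ {n} → Vec Term n → Term → Mu
norm≤ v M = 0≤ M ∧ᵐ lit (pos (‖ v ‖² ≼ M ⊗ M))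

-- |v| ≤ r |w| for the Euclidean norm; for negative r this holds only when
-- v = w = 0.
norm≤· : ∀ {n} → Vec Term n → Term → Vec Term n → Mu
norm≤· v r w = lit (pos (‖ v ‖² ≼ r ⊗ r ⊗ ‖ w ‖²)) ∧ᵐ
               (0≤ r ∨ᵐ lit (pos (‖ w ‖² ≐ const 0ℚ)))

∃ᵐ : Var → Mu → Mu
∃ᵐ x φ = ⟨ x :=* ⟩ᵐ φ

∃ᵐ* : ∀ {n} → Vec Var n → Mu → Mu
∃ᵐ* x φ = Vec.foldr′ ∃ᵐ φ x

-- Componentwise assignment; ∇ uses it only for tuples x and y that are
-- disjoint, so the assignment is simultaneous.
⟨_≔*_⟩_ : ∀ {n} → Vec Var n → Vec Var n → Mu → Mu
⟨ x ≔* y ⟩ φ = Vec.foldr′ (λ a ψ → ⟨ a ⟩ᵐ ψ) φ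
  (Vec.zipWith (λ xᵢ yᵢ → xᵢ := var yᵢ) x y)

vars* : ∀ {n} → Vec Var n → Vec Term n
vars* = Vec.map var

_⊝*_ : ∀ {n} → Vec Term n → Vec Term n → Vec Term n
_⊝*_ = Vec.zipWith _⊝_

_·*_ : ∀ {n} → Term → Vec Term n → Vec Term n
r ·* v = Vec.map (r ⊗_) v

module ∇ {n} (x : Vec Var (suc n)) .(d : Unique x) (θ : Vec Term (suc n))
         (φ : Mu) (y z u : Vec Var (suc n)) (t M : Var) (X : PVar) where

  lhs : Mu
  lhs = ⟨ evolve x d θ trueᶠᵒ ⟩ᵐ φ

  y-x : Vec Term (suc n)
  y-x = vars* y ⊝* vars* x

  ρ : Mu
  ρ = (norm≤ (vars* x) (var M) ∧ᵐ norm≤ (vars* y) (var M))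
      ∧ᵐ ∃ᵐ* z (norm≤ (vars* z) (var M) ∧ᵐ
           norm≤· y-x (var t) (Vec.map (exchangeT* x z) θ))
      ∧ᵐ ∃ᵐ* z (norm≤ (vars* z) (var M) ∧ᵐ
           norm≤· (const (1ℚ ℚ.+ 1ℚ) ·* (y-x ⊝* (var t ·* θ)))
                  (var t ⊗ var t) (Vec.map (exchangeT* x z) (hat x θ)))
      ∧ᵐ ∃ᵐ* u (⟨ t := (const ½ ⊗ var t) ⟩ᵐ
           (⟨ y ≔* u ⟩ pvar X ∧ᵐ ⟨ x ≔* u ⟩ pvar X))

  rhs : Mu
  rhs = ∃ᵐ* y (⟨ x ≔* y ⟩ φ ∧ᵐ
          ∃ᵐ t (0≤ var t ∧ᵐ
            ∃ᵐ M (lit (neg (var M ≼ const 0ℚ)) ∧ᵐ ν X ρ)))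

data ∇-Instance : Mu → Set where
  instance∇ : ∀ {n} (x : Vec Var (suc n)) .(d : Unique x)
    (θ : Vec Term (suc n)) (φ : Mu) (y z u : Vec Var (suc n)) (t M : Var)
    (X : PVar) → let open ∇ x d θ φ y z u t M X; fresh = t ∷ M ∷ y Vec.++ z Vec.++ u in
    IsFormula φ → Unique fresh → VecAll.All (_∉ varsM lhs) fresh →
    ∇-Instance (lhs ⇔ᵐ rhs)

------------------------------------------------------------------------
-- The translation ♭ of dLμ into dGL

-- Renaming of bound propositional variables; Γ pairs up the enclosing binders.
data _∼[_]_ : PVar → List (PVar × PVar) → PVar → Set where
  nil   : ∀ {X} → X ∼[ [] ] X
  here  : ∀ {X Y Γ} → X ∼[ (X , Y) ∷ Γ ] Y
  there : ∀ {X Y X′ Y′ Γ} → X ≢ X′ → Y ≢ Y′ → X ∼[ Γ ] Y →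
          X ∼[ (X′ , Y′) ∷ Γ ] Y

data _⊢_≈_ (Γ : List (PVar × PVar)) : Mu → Mu → Set where
  lit  : ∀ {p} → Γ ⊢ lit p ≈ lit p
  pvar : ∀ {X Y} → X ∼[ Γ ] Y → Γ ⊢ pvar X ≈ pvar Y
  or   : ∀ {φ φ′ ψ ψ′} → Γ ⊢ φ ≈ φ′ → Γ ⊢ ψ ≈ ψ′ → Γ ⊢ φ ∨ᵐ ψ ≈ (φ′ ∨ᵐ ψ′)
  and  : ∀ {φ φ′ ψ ψ′} → Γ ⊢ φ ≈ φ′ → Γ ⊢ ψ ≈ ψ′ → Γ ⊢ φ ∧ᵐ ψ ≈ (φ′ ∧ᵐ ψ′)
  dia  : ∀ {a φ φ′} → Γ ⊢ φ ≈ φ′ → Γ ⊢ ⟨ a ⟩ᵐ φ ≈ (⟨ a ⟩ᵐ φ′)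
  box  : ∀ {a φ φ′} → Γ ⊢ φ ≈ φ′ → Γ ⊢ [ a ]ᵐ φ ≈ ([ a ]ᵐ φ′)
  μ    : ∀ {X Y φ φ′} → ((X , Y) ∷ Γ) ⊢ φ ≈ φ′ → Γ ⊢ μ X φ ≈ μ Y φ′
  ν    : ∀ {X Y φ φ′} → ((X , Y) ∷ Γ) ⊢ φ ≈ φ′ → Γ ⊢ ν X φ ≈ ν Y φ′

module Translate (κ : PVar → ℕ) (c : Var) where

  numeral : PVar → Term
  numeral X = const (+ κ X ℚ./ 1)

  set : PVar → Game
  set X = act (c := numeral X)

  is isn't : PVar → Fml
  is X    = lit (pos (var c ≐ numeral X))
  isn't X = lit (neg (var c ≐ numeral X))

  G : Mu → Game
  G (lit p)    = ⁇ lit p ⨾ (⁇ ⊥ᶠ) ᵈ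
  G (pvar X)   = set X
  G (φ ∨ᵐ ψ)   = G φ ∪ G ψ
  G (φ ∧ᵐ ψ)   = G φ ∩ G ψ
  G (⟨ a ⟩ᵐ φ) = act a ⨾ G φ
  G ([ a ]ᵐ φ) = act a ᵈ ⨾ G φ
  G (μ X φ)    = set X ⨾ (⁇ is X ⨾ G φ) * ⨾ ⁇ isn't X
  G (ν X φ)    = set X ⨾ ((⁇ is X) ᵈ ⨾ G φ) ˣ ⨾ (⁇ isn't X) ᵈ

-- The translation depends on the choice of a renaming, of numerals and of the
-- fresh variable c; every admissible choice is allowed.
data _♭_ : Mu → Fml → Set where
  translation : ∀ {φ φ′} (κ : PVar → ℕ) (c : Var) →
    [] ⊢ φ ≈ φ′ → WellFormed φ′ → ListUnique.Unique (binders φ′) →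
    Injective _≡_ _≡_ κ → c ∉ varsM φ′ →
    φ ♭ (⟨ Translate.G κ c φ′ ⟩ ⊤ᶠ)

------------------------------------------------------------------------
-- Provability

truth : (Fml → Bool) → Fml → Bool
truth v (lit p)   = v (lit p)
truth v (~ φ)     = Bool.not (truth v φ)
truth v (φ ∨ ψ)   = truth v φ Bool.∨ truth v ψ
truth v (⟨ γ ⟩ φ) = v (⟨ γ ⟩ φ)

Tautology : Fml → Set
Tautology φ = ∀ v → truth v φ ≡ true

infix 1 ⊢_

data ⊢_ : Fml → Set where
  taut     : ∀ {φ} → Tautology φ → ⊢ φ
  ≐-refl   : ∀ θ → ⊢ lit (pos (θ ≐ θ))
  ≐-subst  : ∀ {φ φ₁ φ₂ x} θ η → φ [ θ / x ] φ₁ → φ [ η / x ] φ₂ →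
             ⊢ lit (pos (θ ≐ η)) ⇒ φ₁ ⇒ φ₂
  ∃-intro  : ∀ {φ φ′ x} θ → φ [ θ / x ] φ′ → ⊢ φ′ ⇒ ⟨ act (x :=*) ⟩ φ
  ∃-vac    : ∀ {ψ} x → x ∉ free ψ → ⊢ ⟨ act (x :=*) ⟩ ψ ⇒ ψ
  assign   : ∀ {φ} x θ y → y ∉ vars φ → y ∉ varsT θ →
             ⊢ ⟨ act (x := θ) ⟩ φ ⇔
               ⟨ act (y :=*) ⟩ (lit (pos (var y ≐ θ)) ∧ exchange x y φ)
  test     : ∀ ψ φ → ⊢ ⟨ ⁇ ψ ⟩ φ ⇔ (ψ ∧ φ)
  choice   : ∀ γ δ φ → ⊢ ⟨ γ ∪ δ ⟩ φ ⇔ (⟨ γ ⟩ φ ∨ ⟨ δ ⟩ φ)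
  compose  : ∀ γ δ φ → ⊢ ⟨ γ ⨾ δ ⟩ φ ⇔ ⟨ γ ⟩ ⟨ δ ⟩ φ
  unfold   : ∀ γ φ → ⊢ ⟨ γ * ⟩ φ ⇔ (φ ∨ ⟨ γ ⟩ ⟨ γ * ⟩ φ)
  dual     : ∀ γ φ → ⊢ ⟨ γ ᵈ ⟩ φ ⇔ ~ ⟨ γ ⟩ ~ φ
  real     : ∀ {F} → Valid F → ⊢ ⌜ F ⌝
  domain   : ∀ {n} (x : Vec Var (suc n)) .(d : Unique x) θ ψ φ t →
             t ∉ vars (⟨ act (evolve x d θ ψ) ⟩ φ) →
             (t∉x : VecAll.All (t ≢_) x) →
             ⊢ ⟨ act (evolve x d θ ψ) ⟩ φ ⇔
               ⟨ act (t := const 0ℚ) ⟩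
               ⟨ act (evolve (t ∷ x) (t∉x ∷ d) (const 1ℚ ∷ θ) trueᶠᵒ) ⟩
               (φ ∧ [ act (evolve (t ∷ x) (t∉x ∷ d)
                             (⊖ const 1ℚ ∷ Vec.map ⊖_ θ) trueᶠᵒ) ]
                    (lit (pos (const 0ℚ ≼ var t)) ⇒ ⌜ ψ ⌝))
  nabla    : ∀ {χ φ} → ∇-Instance χ → χ ♭ φ → ⊢ φ
  mp       : ∀ {φ ψ} → ⊢ φ → ⊢ φ ⇒ ψ → ⊢ ψ
  mono     : ∀ {ψ φ} γ → ⊢ ψ ⇒ φ → ⊢ ⟨ γ ⟩ ψ ⇒ ⟨ γ ⟩ φ
  fixpoint : ∀ {ψ φ} γ → ⊢ (ψ ∨ ⟨ γ ⟩ φ) ⇒ φ → ⊢ ⟨ γ * ⟩ ψ ⇒ φ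

{-# OPTIONS --safe #-}

-- Atomic games can be replaced one at a time: if ⟨ a ⟩ φ ⇔ ⟨ g ⟩ φ is provable
-- for all φ in which the auxiliary variables of g are not free, then a may be
-- replaced by g inside any game, loops being compared through the fixpoint rule.
--
-- Discrete fragment.  Evolution domains disappear by the axiom domain.  The
-- axiom ∇ describes x′ = θ by a discrete game, but only for postconditions φ
-- that are translations of dLμ-formulas.  All formulas are: a game γ with
-- continuation χ unfolds into a modal formula, γ * becoming a fixpoint, and
-- translating back is provably the identity.  For this one shows that in a
-- translated loop only the values of the postcondition at c = κ X matter, so
-- that bound propositional variables can be renamed and formulas be dualised.
-- Finally x := θ is y :=* ; ?(y = θ) ; x :=* ; ?(x = y).
--
-- Continuous fragment.  It remains to replace x :=* by x′ = 1 ∪ x′ = −1.  By ∇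
-- this amounts to proving the greatest fixpoint νX.ρ for x′ = q, q = ±1, which
-- follows by coinduction from the invariant t q = y − x, t ≥ 0, |x|, |y| ≤ M.

module Submission where

open import Defs
open import Data.Bool.Base as Bool using (Bool; true; false; T)
open import Data.Bool.Properties using (T-≡; T-∧)
open import Data.Fin.Base using (Fin; zero; suc)
open import Data.Integer.Base using (+_)
import Data.Integer.Properties as ℤP
open import Data.List.Base as List using (List; []; _∷_; _++_; filter)
open import Data.List.Extrema.Nat using (max; xs≤max)
open import Data.List.Membership.Propositional using (_∉_)
open import Data.List.Membership.Propositional.Properties
  using (∈-++⁺ˡ; ∈-++⁺ʳ; ∈-++⁻; ∈-filter⁻; ∈-filter⁺; ∈-map⁻; ∈-map⁺)
open import Data.List.Relation.Unary.All as All using (All; []; _∷_)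
open import Data.List.Relation.Unary.Any using (here; there)
open import Data.List.Relation.Unary.Linked using ([-]; _∷_)
open import Data.List.Relation.Unary.Linked.Properties using (Linked⇒AllPairs)
import Data.List.Relation.Unary.Unique.Propositional as ListUnique
open import Data.List.Relation.Unary.AllPairs as AllPairs using ([]; _∷_)
open import Data.List.Properties using (map-++; map-id-local)
open import Data.List.Relation.Unary.All.Properties
  using (++⁺; ++⁻ˡ; ++⁻ʳ; filter⁺; all-filter; ¬Any⇒All¬; All¬⇒¬Any)
open import Data.Nat.Base as ℕ using (ℕ; zero; suc)
open import Data.Nat.Properties as ℕP using (_≟_)
open import Data.List.Membership.DecPropositional _≟_ using (_∈_; _∈?_; _∉?_)
open import Data.Product.Base using (_×_; _,_; proj₁; proj₂; ∃-syntax)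
open import Data.Rational.Base as ℚ using (ℚ; 0ℚ; 1ℚ; ½)
open import Data.Rational.Unnormalised.Base using (mkℚᵘ; *≡*)
import Data.Rational.Properties as ℚP
open import Data.Rational.Solver using (module +-*-Solver)
open +-*-Solver using (solve; con; _:+_; _:*_; :-_; _:-_) renaming (_:=_ to _:≡_)
open import Data.Sum.Base using (_⊎_; inj₁; inj₂; [_,_]′)
open import Data.Unit.Base using (⊤; tt)
open import Data.Vec.Base as Vec using (Vec; []; _∷_; toList)
import Data.Vec.Relation.Unary.All as VecAll
open import Data.Vec.Relation.Unary.All using ([]; _∷_)
open import Data.Vec.Relation.Unary.All.Properties using (toList⁺; toList⁻)
open import Data.Vec.Relation.Unary.Unique.Propositional using (Unique; []; _∷_)
open import Data.Vec.Properties using (toList-map)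
open import Function.Base using (_∘_; id; case_of_)
open import Function.Bundles using (Equivalence; mk⇔) renaming (_⇔_ to _⟷_)
open import Function.Definitions using (Injective)
open import Algebra.Properties.Group ℚP.+-0-group using (x∙y⁻¹≈ε⇒x≈y)
open import Level using (0ℓ)
open import Relation.Binary.Bundles using (Preorder)
open import Relation.Binary.PropositionalEquality
  using (_≡_; _≢_; refl; sym; trans; cong; cong₂; subst; subst₂; ≢-sym)
open import Relation.Nullary using (¬_; Dec; yes; no; contradiction)
open import Relation.Nullary.Decidable using (does; does-⇔; from-yes; from-no; map′)

-- Propositional reasoning

-- The axioms `assign`, `domain`, `nabla` and the rule `rename` want a variable not to occur at all.
-- Replacements can only promise that it is not free, since replaced games bind auxiliary variables;
-- `avoid` passes from the second condition to the first by exchanging variables. The game that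
-- replaces an action must moreover be fixed before the postcondition is known, so everything in ∇
-- except the postcondition is built in advance.
--
-- An instance of ∇ is a single game, made from a dLμ-biconditional with its binders renamed apart.
-- Using it as an equivalence means comparing loops that are controlled by different numerals in c.
-- Postconditions are therefore compared only after assignments c := κ X (`Agree`), a relation that
-- can be carried below a binder.
--
-- The speeds ±1 are their own inverses, so the duration of a motion is a polynomial in its
-- endpoints. A straight motion meets both error estimates of ∇ with equality, and its midpoint
-- splits it into two motions of the same kind.

infix  5 ¬′_
infixr 4 _∧′_ _∨′_
infixr 3 _⇒′_
infix  2 _⇔′_

data Prop (n : ℕ) : Set where
  atom : Fin n → Prop n
  ¬′_  : Prop n → Prop n
  _∨′_ : Prop n → Prop n → Prop n

-- The same abbreviations as on `Fml`, so that `inst` commutes with them by computation.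
_∧′_ _⇒′_ _⇔′_ : ∀ {n} → Prop n → Prop n → Prop n
P ∧′ Q = ¬′ (¬′ P ∨′ ¬′ Q)
P ⇒′ Q = ¬′ P ∨′ Q
P ⇔′ Q = (P ⇒′ Q) ∧′ (Q ⇒′ P)

a₀ : ∀ {n} → Prop (1 ℕ.+ n)
a₀ = atom zero

a₁ : ∀ {n} → Prop (2 ℕ.+ n)
a₁ = atom (suc zero)

a₂ : ∀ {n} → Prop (3 ℕ.+ n)
a₂ = atom (suc (suc zero))

a₃ : ∀ {n} → Prop (4 ℕ.+ n)
a₃ = atom (suc (suc (suc zero)))

a₄ : ∀ {n} → Prop (5 ℕ.+ n)
a₄ = atom (suc (suc (suc (suc zero))))

a₅ : ∀ {n} → Prop (6 ℕ.+ n)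
a₅ = atom (suc (suc (suc (suc (suc zero)))))

a₆ : ∀ {n} → Prop (7 ℕ.+ n)
a₆ = atom (suc (suc (suc (suc (suc (suc zero))))))

a₇ : ∀ {n} → Prop (8 ℕ.+ n)
a₇ = atom (suc (suc (suc (suc (suc (suc (suc zero)))))))

a₈ : ∀ {n} → Prop (9 ℕ.+ n)
a₈ = atom (suc (suc (suc (suc (suc (suc (suc (suc zero))))))))

inst : ∀ {n} → Prop n → Vec Fml n → Fml
inst (atom i) σ = Vec.lookup σ i
inst (¬′ P)   σ = ~ inst P σ
inst (P ∨′ Q) σ = inst P σ ∨ inst Q σ

eval : ∀ {n} → Prop n → Vec Bool n → Bool
eval (atom i) e = Vec.lookup e i
eval (¬′ P)   e = Bool.not (eval P e)
eval (P ∨′ Q) e = eval P e Bool.∨ eval Q e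

everywhere : ∀ n → (Vec Bool n → Bool) → Bool
everywhere zero    f = f []
everywhere (suc n) f =
  everywhere n (λ e → f (true ∷ e)) Bool.∧ everywhere n (λ e → f (false ∷ e))

everywhere-sound : ∀ {n} (f : Vec Bool n → Bool) → T (everywhere n f) → ∀ e → f e ≡ true
everywhere-sound f p []          = Equivalence.to T-≡ p
everywhere-sound f p (true ∷ e)  =
  everywhere-sound _ (proj₁ (Equivalence.to T-∧ p)) e
everywhere-sound f p (false ∷ e) =
  everywhere-sound _ (proj₂ (Equivalence.to (T-∧ {everywhere _ (f ∘ (true ∷_))}) p)) e

truth-lookup : ∀ {n} v (σ : Vec Fml n) i →
               truth v (Vec.lookup σ i) ≡ Vec.lookup (Vec.map (truth v) σ) i
truth-lookup v (φ ∷ σ) zero    = refl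
truth-lookup v (φ ∷ σ) (suc i) = truth-lookup v σ i

truth-inst : ∀ {n} v (P : Prop n) σ → truth v (inst P σ) ≡ eval P (Vec.map (truth v) σ)
truth-inst v (atom i) σ = truth-lookup v σ i
truth-inst v (¬′ P)   σ = cong Bool.not (truth-inst v P σ)
truth-inst v (P ∨′ Q) σ = cong₂ Bool._∨_ (truth-inst v P σ) (truth-inst v Q σ)

ForAll : ∀ n → (Vec Fml n → Set) → Set
ForAll zero    F = F []
ForAll (suc n) F = ∀ {φ} → ForAll n (λ σ → F (φ ∷ σ))

forAll : ∀ n {F : Vec Fml n → Set} → (∀ σ → F σ) → ForAll n F
forAll zero    f = f []
forAll (suc n) f = forAll n (λ σ → f (_ ∷ σ))

-- Reflection: for a concrete scheme the truth-table premise computes to the unit type and is filled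
-- in silently, and the formulas abstracted by `ForAll` are inferred from the use.
tauto : ∀ n (P : Prop n) {_ : T (everywhere n (eval P))} → ForAll n (λ σ → ⊢ inst P σ)
tauto n P {p} = forAll n λ σ → taut λ v →
  trans (truth-inst v P σ) (everywhere-sound (eval P) p (Vec.map (truth v) σ))

infixl 1 _·_

_·_ : ∀ {φ ψ} → ⊢ φ ⇒ ψ → ⊢ φ → ⊢ ψ
p · q = mp q p

⇒-trans : ∀ {φ ψ χ} → ⊢ φ ⇒ ψ → ⊢ ψ ⇒ χ → ⊢ φ ⇒ χ
⇒-trans p q = tauto 3 ((a₀ ⇒′ a₁) ⇒′ (a₁ ⇒′ a₂) ⇒′ (a₀ ⇒′ a₂)) · p · q

⇔-refl : ∀ {φ} → ⊢ φ ⇔ φ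
⇔-refl = tauto 1 (a₀ ⇔′ a₀)

⇔-sym : ∀ {φ ψ} → ⊢ φ ⇔ ψ → ⊢ ψ ⇔ φ
⇔-sym p = tauto 2 ((a₀ ⇔′ a₁) ⇒′ (a₁ ⇔′ a₀)) · p

⇔-trans : ∀ {φ ψ χ} → ⊢ φ ⇔ ψ → ⊢ ψ ⇔ χ → ⊢ φ ⇔ χ
⇔-trans p q = tauto 3 ((a₀ ⇔′ a₁) ⇒′ (a₁ ⇔′ a₂) ⇒′ (a₀ ⇔′ a₂)) · p · q

⇔-to : ∀ {φ ψ} → ⊢ φ ⇔ ψ → ⊢ φ ⇒ ψ
⇔-to p = tauto 2 ((a₀ ⇔′ a₁) ⇒′ (a₀ ⇒′ a₁)) · p

⇔-from : ∀ {φ ψ} → ⊢ φ ⇔ ψ → ⊢ ψ ⇒ φ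
⇔-from p = ⇔-to (⇔-sym p)

⇔-intro : ∀ {φ ψ} → ⊢ φ ⇒ ψ → ⊢ ψ ⇒ φ → ⊢ φ ⇔ ψ
⇔-intro p q = tauto 2 ((a₀ ⇒′ a₁) ⇒′ (a₁ ⇒′ a₀) ⇒′ (a₀ ⇔′ a₁)) · p · q

~-cong : ∀ {φ ψ} → ⊢ φ ⇔ ψ → ⊢ ~ φ ⇔ ~ ψ
~-cong p = tauto 2 ((a₀ ⇔′ a₁) ⇒′ (¬′ a₀ ⇔′ ¬′ a₁)) · p

∨-cong : ∀ {φ φ′ ψ ψ′} → ⊢ φ ⇔ φ′ → ⊢ ψ ⇔ ψ′ → ⊢ φ ∨ ψ ⇔ (φ′ ∨ ψ′)
∨-cong p q =
  tauto 4 ((a₀ ⇔′ a₁) ⇒′ (a₂ ⇔′ a₃) ⇒′ (a₀ ∨′ a₂ ⇔′ a₁ ∨′ a₃)) · p · q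

∧-cong : ∀ {φ φ′ ψ ψ′} → ⊢ φ ⇔ φ′ → ⊢ ψ ⇔ ψ′ → ⊢ φ ∧ ψ ⇔ (φ′ ∧ ψ′)
∧-cong p q =
  tauto 4 ((a₀ ⇔′ a₁) ⇒′ (a₂ ⇔′ a₃) ⇒′ (a₀ ∧′ a₂ ⇔′ a₁ ∧′ a₃)) · p · q

dia-cong : ∀ {φ ψ} γ → ⊢ φ ⇔ ψ → ⊢ ⟨ γ ⟩ φ ⇔ ⟨ γ ⟩ ψ
dia-cong γ p = ⇔-intro (mono γ (⇔-to p)) (mono γ (⇔-from p))

⊤-intro : ⊢ ⊤ᶠ
⊤-intro = ≐-refl (const 0ℚ)

fmlPreorder : Preorder 0ℓ 0ℓ 0ℓ
fmlPreorder = record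
  { Carrier    = Fml
  ; _≈_        = λ φ ψ → ⊢ φ ⇔ ψ
  ; _≲_        = λ φ ψ → ⊢ φ ⇒ ψ
  ; isPreorder = record
    { isEquivalence = record { refl = ⇔-refl ; sym = ⇔-sym ; trans = ⇔-trans }
    ; reflexive     = ⇔-to
    ; trans         = ⇒-trans
    }
  }

open import Relation.Binary.Reasoning.Preorder fmlPreorder

-- Variables

above : List Var → Var
above xs = suc (max 0 xs)

above-bounds : ∀ xs → All (ℕ._< above xs) xs
above-bounds xs = All.map ℕ.s≤s (xs≤max 0 xs)

above∉ : ∀ xs → above xs ∉ xs
above∉ xs p = ℕP.<-irrefl refl (All.lookup (above-bounds xs) p)

∉-++ˡ : ∀ {v : Var} xs {ys} → v ∉ xs ++ ys → v ∉ xs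
∉-++ˡ xs p q = p (∈-++⁺ˡ q)

∉-++ʳ : ∀ {v : Var} xs {ys} → v ∉ xs ++ ys → v ∉ ys
∉-++ʳ xs p q = p (∈-++⁺ʳ xs q)

∉-++ : ∀ {v : Var} xs {ys} → v ∉ xs → v ∉ ys → v ∉ xs ++ ys
∉-++ xs p q r = [ p , q ]′ (∈-++⁻ xs r)

∉-[] : ∀ {v w : Var} → v ≢ w → v ∉ w ∷ []
∉-[] p (here q) = p q

∉-∖ : ∀ {v} xs ys → v ∉ xs → v ∉ xs ∖ ys
∉-∖ xs ys p q = p (proj₁ (∈-filter⁻ _ {xs = xs} q))

∉-∖-removed : ∀ {v} xs ys → v ∈ ys → v ∉ xs ∖ ys
∉-∖-removed xs ys p q = proj₂ (∈-filter⁻ _ {xs = xs} q) p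

∉-dia : ∀ {v} γ φ → v ∉ freeG γ → v ∉ free φ → v ∉ free (⟨ γ ⟩ φ)
∉-dia γ φ p q = ∉-++ (freeG γ) p (∉-∖ (free φ) (mustBoundG γ) q)

∉-havoc : ∀ x φ → x ∉ free (⟨ act (x :=*) ⟩ φ)
∉-havoc x φ = ∉-∖-removed (free φ) _ (here refl)

module _ {P : Var → Set} where

  freeFO-⊆ : ∀ F → All P (varsFO F) → All P (freeFO F)
  freeFO-⊆ (lit p)   a       = a
  freeFO-⊆ (~ F)     a       = freeFO-⊆ F a
  freeFO-⊆ (F ∨ G)   a       =
    ++⁺ (freeFO-⊆ F (++⁻ˡ (varsFO F) a)) (freeFO-⊆ G (++⁻ʳ (varsFO F) a))
  freeFO-⊆ (all x F) (_ ∷ a) = filter⁺ _ (freeFO-⊆ F a)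
  freeFO-⊆ (ex x F)  (_ ∷ a) = filter⁺ _ (freeFO-⊆ F a)

  freeAct-⊆ : ∀ a → All P (varsAct a) → All P (freeAct a)
  freeAct-⊆ (x :=*)          a       = []
  freeAct-⊆ (x := θ)         (_ ∷ a) = a
  freeAct-⊆ (evolve x _ θ ψ) a       =
    ++⁺ (++⁻ˡ (toList x) a)
        (++⁺ (++⁻ˡ (varsT* θ) (++⁻ʳ (toList x) a))
             (freeFO-⊆ ψ (++⁻ʳ (varsT* θ) (++⁻ʳ (toList x) a))))

  mutual
    freeG-⊆ : ∀ γ → All P (varsG γ) → All P (freeG γ)
    freeG-⊆ (act a) p = freeAct-⊆ a p
    freeG-⊆ (⁇ φ)   p = free-⊆ φ p
    freeG-⊆ (γ ∪ δ) p = ++⁺ (freeG-⊆ γ (++⁻ˡ (varsG γ) p)) (freeG-⊆ δ (++⁻ʳ (varsG γ) p))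
    freeG-⊆ (γ ⨾ δ) p =
      ++⁺ (freeG-⊆ γ (++⁻ˡ (varsG γ) p)) (filter⁺ _ (freeG-⊆ δ (++⁻ʳ (varsG γ) p)))
    freeG-⊆ (γ *)   p = freeG-⊆ γ p
    freeG-⊆ (γ ᵈ)   p = freeG-⊆ γ p

    free-⊆ : ∀ φ → All P (vars φ) → All P (free φ)
    free-⊆ (lit p)   a = a
    free-⊆ (~ φ)     a = free-⊆ φ a
    free-⊆ (φ ∨ ψ)   a = ++⁺ (free-⊆ φ (++⁻ˡ (vars φ) a)) (free-⊆ ψ (++⁻ʳ (vars φ) a))
    free-⊆ (⟨ γ ⟩ φ) a =
      ++⁺ (freeG-⊆ γ (++⁻ˡ (varsG γ) a)) (filter⁺ _ (free-⊆ φ (++⁻ʳ (varsG γ) a)))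

∉⇒All : ∀ {v : Var} {xs} → v ∉ xs → All (v ≢_) xs
∉⇒All = ¬Any⇒All¬ _

All⇒∉ : ∀ {v : Var} {xs} → All (v ≢_) xs → v ∉ xs
All⇒∉ = All¬⇒¬Any

∉-free : ∀ {v} φ → v ∉ vars φ → v ∉ free φ
∉-free φ p = All⇒∉ (free-⊆ φ (∉⇒All p))

-- Exchange of variables

filter-map : {f : Var → Var} {P Q : Var → Set} (P? : ∀ v → Dec (P v)) (Q? : ∀ v → Dec (Q v)) →
             (∀ v → does (P? (f v)) ≡ does (Q? v)) →
             ∀ xs → filter P? (List.map f xs) ≡ List.map f (filter Q? xs)
filter-map         P? Q? eq []       = refl
filter-map {f = f} P? Q? eq (v ∷ xs) with does (P? (f v)) | does (Q? v) | eq v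
... | true  | _ | refl = cong (f v ∷_) (filter-map P? Q? eq xs)
... | false | _ | refl = filter-map P? Q? eq xs

module _ (x y : Var) where

  open Exchange x y
  exV-left : exV x ≡ y
  exV-left with x ≟ x
  ... | yes _ = refl
  ... | no x≢x = contradiction refl x≢x

  exV-right : exV y ≡ x
  exV-right with y ≟ x
  ... | yes y≡x = y≡x
  ... | no _ with y ≟ y
  ...   | yes _ = refl
  ...   | no y≢y = contradiction refl y≢y

  exV-other : ∀ {v} → v ≢ x → v ≢ y → exV v ≡ v
  exV-other {v} v≢x v≢y with v ≟ x
  ... | yes p = contradiction p v≢x
  ... | no _ with v ≟ y
  ...   | yes p = contradiction p v≢y
  ...   | no _  = refl

  private
    infixr 5 _⊕⊕_
    _⊕⊕_ : ∀ {xs xs′ ys ys′} → xs′ ≡ List.map exV xs → ys′ ≡ List.map exV ys →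
           xs′ ++ ys′ ≡ List.map exV (xs ++ ys)
    _⊕⊕_ {xs} {ys = ys} p q = trans (cong₂ _++_ p q) (sym (map-++ exV xs ys))

  varsT-exT : ∀ s → varsT (exT s) ≡ List.map exV (varsT s)
  varsT-exT (var v)   = refl
  varsT-exT (const q) = refl
  varsT-exT (s ⊕ r)   = varsT-exT s ⊕⊕ varsT-exT r
  varsT-exT (s ⊗ r)   = varsT-exT s ⊕⊕ varsT-exT r
  varsT-exT (⊖ s)     = varsT-exT s

  varsT*-exT : ∀ {n} (θ : Vec Term n) → varsT* (Vec.map exT θ) ≡ List.map exV (varsT* θ)
  varsT*-exT []      = refl
  varsT*-exT (s ∷ θ) = varsT-exT s ⊕⊕ varsT*-exT θ

  varsL-exL : ∀ p → varsL (exL p) ≡ List.map exV (varsL p)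
  varsL-exL (pos (s ≐ r)) = varsT-exT s ⊕⊕ varsT-exT r
  varsL-exL (pos (s ≼ r)) = varsT-exT s ⊕⊕ varsT-exT r
  varsL-exL (neg (s ≐ r)) = varsT-exT s ⊕⊕ varsT-exT r
  varsL-exL (neg (s ≼ r)) = varsT-exT s ⊕⊕ varsT-exT r

  varsFO-exFO : ∀ F → varsFO (exFO F) ≡ List.map exV (varsFO F)
  varsFO-exFO (lit p)   = varsL-exL p
  varsFO-exFO (~ F)     = varsFO-exFO F
  varsFO-exFO (F ∨ G)   = varsFO-exFO F ⊕⊕ varsFO-exFO G
  varsFO-exFO (all v F) = cong (_ ∷_) (varsFO-exFO F)
  varsFO-exFO (ex v F)  = cong (_ ∷_) (varsFO-exFO F)

  varsAct-exAct : ∀ a → varsAct (exAct a) ≡ List.map exV (varsAct a)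
  varsAct-exAct (v :=*)          = refl
  varsAct-exAct (v := θ)         = cong (_ ∷_) (varsT-exT θ)
  varsAct-exAct (evolve v d θ ψ) =
    toList-map exV v ⊕⊕ varsT*-exT θ ⊕⊕ varsFO-exFO ψ

  mutual
    varsG-exG : ∀ γ → varsG (exG γ) ≡ List.map exV (varsG γ)
    varsG-exG (act a) = varsAct-exAct a
    varsG-exG (⁇ φ)   = vars-exF φ
    varsG-exG (γ ∪ δ) = varsG-exG γ ⊕⊕ varsG-exG δ
    varsG-exG (γ ⨾ δ) = varsG-exG γ ⊕⊕ varsG-exG δ
    varsG-exG (γ *)   = varsG-exG γ
    varsG-exG (γ ᵈ)   = varsG-exG γ

    vars-exF : ∀ φ → vars (exF φ) ≡ List.map exV (vars φ)
    vars-exF (lit p)   = varsL-exL p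
    vars-exF (~ φ)     = vars-exF φ
    vars-exF (φ ∨ ψ)   = vars-exF φ ⊕⊕ vars-exF ψ
    vars-exF (⟨ γ ⟩ φ) = varsG-exG γ ⊕⊕ vars-exF φ

  ∈-map-exV : ∀ {v} xs → exV v ∈ List.map exV xs → v ∈ xs
  ∈-map-exV xs p with w , w∈ , eq ← ∈-map⁻ exV p = subst (_∈ xs) (sym (exV-injective eq)) w∈

  ∉-exchange : ∀ φ → y ∉ vars φ → x ∉ vars (exF φ)
  ∉-exchange φ y∉ x∈ =
    y∉ (∈-map-exV (vars φ) (subst₂ _∈_ (sym exV-right) (vars-exF φ) x∈))

  private
    ∈-exV : ∀ xs v → (exV v ∈ List.map exV xs) ⟷ (v ∈ xs)
    ∈-exV xs v = mk⇔ (∈-map-exV xs) (∈-map⁺ exV)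

    infix 6 _∖∖_
    _∖∖_ : ∀ {xs xs′ ys ys′} → xs′ ≡ List.map exV xs → ys′ ≡ List.map exV ys →
           xs′ ∖ ys′ ≡ List.map exV (xs ∖ ys)
    _∖∖_ {xs} {ys = ys} refl refl = filter-map (_∉? List.map exV ys) (_∉? ys)
      (λ v → cong Bool.not (does-⇔ (∈-exV ys v) (exV v ∈? List.map exV ys) (v ∈? ys))) xs

  freeFO-exFO : ∀ F → freeFO (exFO F) ≡ List.map exV (freeFO F)
  freeFO-exFO (lit p)   = varsL-exL p
  freeFO-exFO (~ F)     = freeFO-exFO F
  freeFO-exFO (F ∨ G)   = freeFO-exFO F ⊕⊕ freeFO-exFO G
  freeFO-exFO (all v F) = freeFO-exFO F ∖∖ refl
  freeFO-exFO (ex v F)  = freeFO-exFO F ∖∖ refl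

  freeAct-exAct : ∀ a → freeAct (exAct a) ≡ List.map exV (freeAct a)
  freeAct-exAct (v :=*)          = refl
  freeAct-exAct (v := θ)         = varsT-exT θ
  freeAct-exAct (evolve v d θ ψ) =
    toList-map exV v ⊕⊕ varsT*-exT θ ⊕⊕ freeFO-exFO ψ

  boundAct-exAct : ∀ a → boundAct (exAct a) ≡ List.map exV (boundAct a)
  boundAct-exAct (v :=*)          = refl
  boundAct-exAct (v := θ)         = refl
  boundAct-exAct (evolve v d θ ψ) = toList-map exV v

  mustBoundG-exG : ∀ γ → mustBoundG (exG γ) ≡ List.map exV (mustBoundG γ)
  mustBoundG-exG (act a) = boundAct-exAct a
  mustBoundG-exG (⁇ φ)   = refl
  mustBoundG-exG (γ ∪ δ) rewrite mustBoundG-exG γ | mustBoundG-exG δ =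
    filter-map (_∈? List.map exV (mustBoundG δ)) (_∈? mustBoundG δ)
      (λ v → does-⇔ (∈-exV (mustBoundG δ) v) (exV v ∈? _) (v ∈? _)) (mustBoundG γ)
  mustBoundG-exG (γ ⨾ δ) = mustBoundG-exG γ ⊕⊕ mustBoundG-exG δ
  mustBoundG-exG (γ *)   = refl
  mustBoundG-exG (γ ᵈ)   = mustBoundG-exG γ

  mutual
    freeG-exG : ∀ γ → freeG (exG γ) ≡ List.map exV (freeG γ)
    freeG-exG (act a) = freeAct-exAct a
    freeG-exG (⁇ φ)   = free-exF φ
    freeG-exG (γ ∪ δ) = freeG-exG γ ⊕⊕ freeG-exG δ
    freeG-exG (γ ⨾ δ) = freeG-exG γ ⊕⊕ freeG-exG δ ∖∖ mustBoundG-exG γ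
    freeG-exG (γ *)   = freeG-exG γ
    freeG-exG (γ ᵈ)   = freeG-exG γ

    free-exF : ∀ φ → free (exF φ) ≡ List.map exV (free φ)
    free-exF (lit p)   = varsL-exL p
    free-exF (~ φ)     = free-exF φ
    free-exF (φ ∨ ψ)   = free-exF φ ⊕⊕ free-exF ψ
    free-exF (⟨ γ ⟩ φ) = freeG-exG γ ⊕⊕ free-exF φ ∖∖ mustBoundG-exG γ

  -- Of the two exchanged variables `x` is not free and `y` does not occur, so the exchange fixes
  -- every entry of the list.
  free-exchange : ∀ φ → x ∉ free φ → y ∉ vars φ → free (exF φ) ≡ free φ
  free-exchange φ x∉ y∉ = trans (free-exF φ) (map-id-local (All.tabulate λ {v} v∈ →
    exV-other (λ { refl → x∉ v∈ }) (λ { refl → ∉-free φ y∉ v∈ })))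

  ∉-exchange-other : ∀ φ {v} → y ∉ vars φ → v ≢ y → v ∉ vars φ → v ∉ vars (exF φ)
  ∉-exchange-other φ {v} y∉ v≢y v∉ v∈
    with w , w∈ , eq ← ∈-map⁻ exV (subst (v ∈_) (vars-exF φ) v∈) = case w ≟ x of λ where
      (yes refl) → v≢y (trans eq (exV-left))
      (no w≢x)   → v∉ (subst (_∈ vars φ)
        (sym (trans eq (exV-other w≢x (λ { refl → y∉ w∈ })))) w∈)

-- Quantifiers, equality and assignments

∃-self : ∀ x φ → ⊢ φ ⇒ ⟨ act (x :=*) ⟩ φ
∃-self x φ = ∃-intro (var x) self

∃-elim : ∀ x {φ ψ} → x ∉ free ψ → ⊢ φ ⇒ ψ → ⊢ ⟨ act (x :=*) ⟩ φ ⇒ ψ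
∃-elim x x∉ p = ⇒-trans (mono _ p) (∃-vac x x∉)

∃-vacuous : ∀ x {φ} → x ∉ free φ → ⊢ ⟨ act (x :=*) ⟩ φ ⇔ φ
∃-vacuous x x∉ = ⇔-intro (∃-vac x x∉) (∃-self x _)

-- Substituting `y` for `x` and discarding the vacuous quantifier gives one implication; the same
-- argument for `~ φ`, contraposed, gives the other.
rename-free : ∀ x y φ → x ∉ free φ → y ∉ vars φ → ⊢ φ ⇔ exchange x y φ
rename-free x y φ x∉ y∉ = tauto 2 ((a₁ ⇒′ a₀) ⇒′ (¬′ a₁ ⇒′ ¬′ a₀) ⇒′ (a₀ ⇔′ a₁))
  · ⇒-trans (∃-intro (var y) (rename y∉)) (∃-vac x x∉)
  · ⇒-trans (∃-intro {φ = ~ φ} {x = x} (var y) (~ rename y∉)) (∃-vac x x∉)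

substT-same : ∀ x θ → substT x θ (var x) ≡ θ
substT-same x θ with x ≟ x
... | yes _  = refl
... | no x≢x = contradiction refl x≢x

substT-other : ∀ {x y} θ → y ≢ x → substT x θ (var y) ≡ var y
substT-other {x} {y} θ y≢x with y ≟ x
... | yes p = contradiction p y≢x
... | no _  = refl

substT-fresh : ∀ {x} θ s → x ∉ varsT s → substT x θ s ≡ s
substT-fresh θ (var y)   x∉ = substT-other θ λ { refl → x∉ (here refl) }
substT-fresh θ (const q) x∉ = refl
substT-fresh θ (s ⊕ r)   x∉ =
  cong₂ _⊕_ (substT-fresh θ s (∉-++ˡ (varsT s) x∉)) (substT-fresh θ r (∉-++ʳ (varsT s) x∉))
substT-fresh θ (s ⊗ r)   x∉ =
  cong₂ _⊗_ (substT-fresh θ s (∉-++ˡ (varsT s) x∉)) (substT-fresh θ r (∉-++ʳ (varsT s) x∉))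
substT-fresh θ (⊖ s)     x∉ = cong ⊖_ (substT-fresh θ s x∉)

infix 6 _≈ᶠ_ _≤ᶠ_

_≈ᶠ_ _≤ᶠ_ : Term → Term → Fml
s ≈ᶠ r = lit (pos (s ≐ r))
s ≤ᶠ r = lit (pos (s ≼ r))

≐-sym : ∀ s r → ⊢ s ≈ᶠ r ⇒ r ≈ᶠ s
≐-sym s r = tauto 3 ((a₀ ⇒′ a₁ ⇒′ a₂) ⇒′ a₁ ⇒′ a₀ ⇒′ a₂)
  · ≐-subst s r (at s) (at r) · ≐-refl s
  where
  w = above (varsT s)
  at : ∀ θ → (var w ≈ᶠ s) [ θ / w ] (θ ≈ᶠ s)
  at θ = subst₂ (λ t t′ → (var w ≈ᶠ s) [ θ / w ] (t ≈ᶠ t′))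
    (substT-same w θ) (substT-fresh θ s (above∉ (varsT s))) lit

≐-trans : ∀ s r t → ⊢ s ≈ᶠ r ⇒ r ≈ᶠ t ⇒ s ≈ᶠ t
≐-trans s r t = tauto 3 ((a₁ ⇒′ a₀ ⇒′ a₂) ⇒′ a₀ ⇒′ a₁ ⇒′ a₂) · ≐-subst r t (at r) (at t)
  where
  w = above (varsT s)
  at : ∀ θ → (s ≈ᶠ var w) [ θ / w ] (s ≈ᶠ θ)
  at θ = subst₂ (λ t t′ → (s ≈ᶠ var w) [ θ / w ] (t ≈ᶠ t′))
    (substT-fresh θ s (above∉ (varsT s))) (substT-same w θ) lit

∧-subst : ∀ {φ φ′ ψ ψ′ θ x} → φ [ θ / x ] φ′ → ψ [ θ / x ] ψ′ → (φ ∧ ψ) [ θ / x ] (φ′ ∧ ψ′)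
∧-subst p q = ~ (~ p ∨ ~ q)

∃≐ : ∀ y θ → y ∉ varsT θ → ⊢ ⟨ act (y :=*) ⟩ (var y ≈ᶠ θ)
∃≐ y θ y∉ = ∃-intro θ (subst₂ (λ t t′ → (var y ≈ᶠ θ) [ θ / y ] (t ≈ᶠ t′))
  (substT-same y θ) (substT-fresh θ θ y∉) lit) · ≐-refl θ

-- Lets a proof name the value of `θ` by a fresh `y`: such a value exists, and the conclusion does
-- not mention it.
≐-elim : ∀ y θ {φ} → y ∉ varsT θ → y ∉ free φ → ⊢ var y ≈ᶠ θ ⇒ φ → ⊢ φ
≐-elim y θ y∉θ y∉φ p = ∃-elim y y∉φ p · ∃≐ y θ y∉θ

∃-pick : ∀ y θ φ → y ∉ varsT θ → y ∉ free φ → ⊢ φ ⇒ ⟨ act (y :=*) ⟩ (var y ≈ᶠ θ ∧ φ)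
∃-pick y θ φ y∉θ y∉φ = ≐-elim y θ y∉θ (∉-++ (free φ) y∉φ (∉-havoc y (var y ≈ᶠ θ ∧ φ)))
  (tauto 3 ((a₀ ∧′ a₁ ⇒′ a₂) ⇒′ a₀ ⇒′ a₁ ⇒′ a₂) · ∃-self y _)

-- The axiom `assign` only provides some witness. All witnesses equal `θ`, so by `≐-subst` any
-- variable with that value can take its place.
assign-at : ∀ x θ y φ → y ∉ vars φ → y ∉ varsT θ →
            ⊢ var y ≈ᶠ θ ⇒ (⟨ act (x := θ) ⟩ φ ⇔ exchange x y φ)
assign-at x θ y φ y∉φ y∉θ =
  tauto 3 ((a₀ ∧′ a₂ ⇒′ a₁) ⇒′ (a₁ ⇒′ a₀ ⇒′ a₂) ⇒′ a₀ ⇒′ (a₁ ⇔′ a₂))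
  · ⇒-trans (∃-self y _) (⇔-from (assign x θ y y∉φ y∉θ))
  -- A second witness `z` is used because `y` may be free in the conclusion and could not be
  -- eliminated.
  · ⇒-trans (⇔-to (assign x θ z z∉φ z∉θ)) (∃-elim z z∉ψ
      (tauto 6 ((a₀ ⇒′ a₁) ⇒′ (a₂ ⇒′ a₁ ⇒′ a₃) ⇒′ (a₃ ⇒′ a₄ ⇒′ a₅) ⇒′ a₂ ∧′ a₄ ⇒′ a₀ ⇒′ a₅)
        · ≐-sym (var y) θ · ≐-trans (var z) θ (var y)
        · ≐-subst (var z) (var y) (rename z∉φ) (rename y∉φ)))
  where
  used = vars φ ++ varsT θ ++ free (var y ≈ᶠ θ ⇒ exchange x y φ)
  z = above used
  z∉φ = ∉-++ˡ (vars φ) (above∉ used)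
  z∉θ = ∉-++ˡ (varsT θ) (∉-++ʳ (vars φ) (above∉ used))
  z∉ψ = ∉-++ʳ (varsT θ) (∉-++ʳ (vars φ) (above∉ used))

module _ (x : Var) (θ : Term) where

  -- An assignment has exactly one outcome: once `y` names it, both sides become `~ exchange x y φ`.
  assign-~ : ∀ φ → ⊢ ⟨ act (x := θ) ⟩ (~ φ) ⇔ ~ ⟨ act (x := θ) ⟩ φ
  assign-~ φ = ≐-elim y θ y∉θ y∉ψ
    (tauto 4 ((a₀ ⇒′ (a₁ ⇔′ a₂)) ⇒′ (a₀ ⇒′ (a₃ ⇔′ ¬′ a₂)) ⇒′ a₀ ⇒′ (a₃ ⇔′ ¬′ a₁))
      · assign-at x θ y φ y∉φ y∉θ · assign-at x θ y (~ φ) y∉φ y∉θ)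
    where
    used = vars φ ++ varsT θ ++ free (⟨ act (x := θ) ⟩ (~ φ) ⇔ ~ ⟨ act (x := θ) ⟩ φ)
    y = above used
    y∉φ = ∉-++ˡ (vars φ) (above∉ used)
    y∉θ = ∉-++ˡ (varsT θ) (∉-++ʳ (vars φ) (above∉ used))
    y∉ψ = ∉-++ʳ (varsT θ) (∉-++ʳ (vars φ) (above∉ used))

  -- Any result of the substitution relation will do, since `≐-subst` equates it with the renamed
  -- formula as soon as `y` names the value of `θ`.
  assign-subst : ∀ {φ φ′} → φ [ θ / x ] φ′ → ⊢ ⟨ act (x := θ) ⟩ φ ⇔ φ′
  assign-subst {φ} {φ′} s = ≐-elim y θ y∉θ y∉ψ
    (tauto 5 ((a₀ ⇒′ (a₁ ⇔′ a₂)) ⇒′ (a₀ ⇒′ a₂ ⇒′ a₃) ⇒′ (a₀ ⇒′ a₄) ⇒′ (a₄ ⇒′ a₃ ⇒′ a₂) ⇒′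
              a₀ ⇒′ (a₁ ⇔′ a₃))
      · assign-at x θ y φ y∉φ y∉θ · ≐-subst (var y) θ (rename y∉φ) s
      · ≐-sym (var y) θ · ≐-subst θ (var y) s (rename y∉φ))
    where
    used = vars φ ++ varsT θ ++ free (⟨ act (x := θ) ⟩ φ ⇔ φ′)
    y = above used
    y∉φ = ∉-++ˡ (vars φ) (above∉ used)
    y∉θ = ∉-++ˡ (varsT θ) (∉-++ʳ (vars φ) (above∉ used))
    y∉ψ = ∉-++ʳ (varsT θ) (∉-++ʳ (vars φ) (above∉ used))

  assign-∃ : ∀ φ → ⊢ ⟨ act (x := θ) ⟩ φ ⇒ ⟨ act (x :=*) ⟩ φ
  assign-∃ φ = ⇒-trans (mono _ (∃-self x φ)) (⇔-to (assign-subst (nonfree (∉-havoc x φ))))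

assign-guard : ∀ x q φ → ⊢ ⟨ act (x := const q) ⟩ φ ⇒ ⟨ act (x := const q) ⟩ (var x ≈ᶠ const q ∧ φ)
assign-guard x q φ = ≐-elim y (const q) (λ ()) y∉ψ
  (tauto 4 ((a₀ ⇒′ (a₁ ⇔′ a₂)) ⇒′ (a₀ ⇒′ (a₃ ⇔′ (a₀ ∧′ a₂))) ⇒′ a₀ ⇒′ a₁ ⇒′ a₃)
    · assign-at x (const q) y φ y∉φ (λ ())
    -- Exchanging inside the guard produces `exV x`, equal to `y` only propositionally; the guard
    -- then coincides with the hypothesis.
    · subst (λ v → ⊢ var y ≈ᶠ const q ⇒ (⟨ act (x := const q) ⟩ (var x ≈ᶠ const q ∧ φ) ⇔
                                          (var v ≈ᶠ const q ∧ exchange x y φ)))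
        (exV-left x y) (assign-at x (const q) y (var x ≈ᶠ const q ∧ φ) y∉φ′ (λ ())))
  where
  used = (x ∷ vars φ) ++
         free (⟨ act (x := const q) ⟩ φ ⇒ ⟨ act (x := const q) ⟩ (var x ≈ᶠ const q ∧ φ))
  y = above used
  y∉φ′ = ∉-++ˡ (x ∷ vars φ) (above∉ used)
  y∉φ = ∉-++ʳ (x ∷ []) y∉φ′
  y∉ψ = ∉-++ʳ (x ∷ vars φ) (above∉ used)

assign-local : ∀ x q {φ ψ} → ⊢ var x ≈ᶠ const q ⇒ (φ ⇔ ψ) →
               ⊢ ⟨ act (x := const q) ⟩ φ ⇔ ⟨ act (x := const q) ⟩ ψ
assign-local x q {φ} {ψ} p = ⇔-intro
  (⇒-trans (assign-guard x q φ)
    (mono _ (tauto 3 ((a₀ ⇒′ (a₁ ⇔′ a₂)) ⇒′ a₀ ∧′ a₁ ⇒′ a₂) · p)))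
  (⇒-trans (assign-guard x q ψ)
    (mono _ (tauto 3 ((a₀ ⇒′ (a₁ ⇔′ a₂)) ⇒′ a₀ ∧′ a₂ ⇒′ a₁) · p)))

avoid : ∀ φ vs → All (_∉ free φ) vs →
        ∃[ φ′ ] (⊢ φ ⇔ φ′) × free φ′ ≡ free φ × All (_∉ vars φ′) vs
avoid φ []       []        = φ , ⇔-refl , refl , []
avoid φ (v ∷ vs) (v∉ ∷ vs∉) with φ′ , φ⇔φ′ , eq , vs∉′ ← avoid φ vs vs∉ =
  exchange v w φ′ ,
  ⇔-trans φ⇔φ′ (rename-free v w φ′ v∉′ w∉φ′) ,
  trans (free-exchange v w φ′ v∉′ w∉φ′) eq ,
  ∉-exchange v w φ′ w∉φ′ ∷ All.tabulate (λ {u} u∈ →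
    ∉-exchange-other v w φ′ w∉φ′ (λ { refl → ∉-++ʳ (vars φ′) (above∉ (vars φ′ ++ vs)) u∈ })
      (All.lookup vs∉′ u∈))
  where
  -- Chosen outside `vs` as well, so that a variable already removed does not come back.
  w = above (vars φ′ ++ vs)
  w∉φ′ = ∉-++ˡ (vars φ′) (above∉ (vars φ′ ++ vs))
  v∉′ = subst (v ∉_) (sym eq) v∉

-- Games

∩-dia : ∀ γ δ φ → ⊢ ⟨ γ ∩ δ ⟩ φ ⇔ (⟨ γ ⟩ φ ∧ ⟨ δ ⟩ φ)
∩-dia γ δ φ = begin-equality
  ⟨ γ ∩ δ ⟩ φ                                ≈⟨ dual (γ ᵈ ∪ δ ᵈ) φ ⟩
  ~ ⟨ γ ᵈ ∪ δ ᵈ ⟩ ~ φ                        ≈⟨ ~-cong (choice (γ ᵈ) (δ ᵈ) (~ φ)) ⟩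
  ~ (⟨ γ ᵈ ⟩ (~ φ) ∨ ⟨ δ ᵈ ⟩ (~ φ))
    ≈⟨ tauto 4 ((a₀ ⇔′ ¬′ a₁) ⇒′ (a₂ ⇔′ ¬′ a₃) ⇒′ (¬′ (a₀ ∨′ a₂) ⇔′ a₁ ∧′ a₃))
       · ᵈ-~ γ · ᵈ-~ δ ⟩
  ⟨ γ ⟩ φ ∧ ⟨ δ ⟩ φ                          ∎
  where
  ᵈ-~ : ∀ γ → ⊢ ⟨ γ ᵈ ⟩ (~ φ) ⇔ ~ ⟨ γ ⟩ φ
  ᵈ-~ γ = ⇔-trans (dual γ (~ φ)) (~-cong (dia-cong γ (tauto 1 (¬′ ¬′ a₀ ⇔′ a₀))))

~ᵈ : ∀ γ φ → ⊢ ~ ⟨ γ ᵈ ⟩ (~ φ) ⇔ ⟨ γ ⟩ φ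
~ᵈ γ φ = ⇔-trans (~-cong (dual γ (~ φ)))
  (⇔-trans (tauto 1 (¬′ ¬′ a₀ ⇔′ a₀)) (dia-cong γ (tauto 1 (¬′ ¬′ a₀ ⇔′ a₀))))

test-dual : ∀ φ ψ → ⊢ ⟨ (⁇ φ) ᵈ ⟩ ψ ⇔ (φ ⇒ ψ)
test-dual φ ψ = ⇔-trans (dual (⁇ φ) ψ)
  (tauto 3 ((a₂ ⇔′ a₀ ∧′ ¬′ a₁) ⇒′ (¬′ a₂ ⇔′ (a₀ ⇒′ a₁))) · test φ (~ ψ))

star-mono : ∀ γ δ → (∀ φ → ⊢ ⟨ γ ⟩ φ ⇒ ⟨ δ ⟩ φ) → ∀ φ → ⊢ ⟨ γ * ⟩ φ ⇒ ⟨ δ * ⟩ φ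
star-mono γ δ p φ = fixpoint γ
  (tauto 4 ((a₀ ⇒′ a₁) ⇒′ (a₃ ⇔′ (a₂ ∨′ a₁)) ⇒′ a₂ ∨′ a₀ ⇒′ a₃) · p (⟨ δ * ⟩ φ) · unfold δ φ)

star-cong : ∀ γ δ → (∀ φ → ⊢ ⟨ γ ⟩ φ ⇔ ⟨ δ ⟩ φ) → ∀ φ → ⊢ ⟨ γ * ⟩ φ ⇔ ⟨ δ * ⟩ φ
star-cong γ δ p φ =
  ⇔-intro (star-mono γ δ (⇔-to ∘ p) φ) (star-mono δ γ (⇔-from ∘ p) φ)

-- Literals

-- For propositional reasoning `neg a` and `~ pos a` are unrelated; the link comes from validity in
-- the reals.
neg-lit : ∀ a → ⊢ lit (neg a) ⇔ ~ lit (pos a)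
neg-lit a = ⇔-intro
  (real {F = ~ lit (neg a) ∨ ~ lit (pos a)} λ ω (p , q) → p q)
  (real {F = ~ ~ lit (pos a) ∨ lit (neg a)} λ ω (p , q) → p q)

coL-lit : ∀ p → ⊢ lit (coL p) ⇔ ~ lit p
coL-lit (pos a) = neg-lit a
coL-lit (neg a) =
  tauto 2 ((a₀ ⇔′ ¬′ a₁) ⇒′ (a₁ ⇔′ ¬′ a₀)) · neg-lit a

½*-< : ∀ {p} → 0ℚ ℚ.< p → ½ ℚ.* p ℚ.< p
½*-< {p} 0<p = subst (½ ℚ.* p ℚ.<_) (ℚP.*-identityˡ p)
  (ℚP.*-monoˡ-<-pos p {{ℚ.positive 0<p}} (from-yes (½ ℚP.<? 1ℚ)))

0<½* : ∀ {p} → 0ℚ ℚ.< p → 0ℚ ℚ.< ½ ℚ.* p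
0<½* = ℚP.*-monoʳ-<-pos ½

const-apart : ∀ {p q} → p ≢ q → ⊢ ~ (const p ≈ᶠ const q)
const-apart {p} {q} p≢q = real {F = ~ lit (pos (const p ≐ const q))} λ ω h →
  -- Constant sequences at distance `d` > 0 never come within d/2 of each other.
  let N , le = h (½ ℚ.* d) (0<½* 0<d) in ℚP.<-irrefl refl (ℚP.<-≤-trans (½*-< 0<d) (le N ℕP.≤-refl))
  where
  d = ℚ.∣ p ℚ.- q ∣
  0<d : 0ℚ ℚ.< d
  0<d = ℚP.≰⇒> λ d≤0 → p≢q (x∙y⁻¹≈ε⇒x≈y p q
    (ℚP.∣p∣≡0⇒p≡0 (p ℚ.- q) (ℚP.≤-antisym d≤0 (ℚP.0≤∣p∣ (p ℚ.- q)))))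

numeral-injective : ∀ {m n} → (+ m ℚ./ 1) ≡ (+ n ℚ./ 1) → m ≡ n
numeral-injective {m} {n} eq with ℚP./-injective-≃ (mkℚᵘ (+ m) 0) (mkℚᵘ (+ n) 0) eq
... | *≡* p = ℤP.+-injective (trans (sym (ℤP.*-identityʳ (+ m))) (trans p (ℤP.*-identityʳ (+ n))))

-- The game translation

module Semantics (κ : PVar → ℕ) (κ-injective : Injective _≡_ _≡_ κ) (c : Var) where

  open Translate κ c

  -- Taken up to provable equivalence: in `⟨ G φ ⟩ ψ` the variable `c` can be syntactically free
  -- through `ψ`, although `ψ` is reached only after `c` has been set.
  Independent : Fml → Set
  Independent φ = ∃[ φ′ ] (⊢ φ ⇔ φ′) × c ∉ free φ′

  independent-resp : ∀ {φ ψ} → ⊢ φ ⇔ ψ → Independent ψ → Independent φ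
  independent-resp p (ψ′ , q , c∉) = ψ′ , ⇔-trans p q , c∉

  independent-~ : ∀ {φ} → Independent φ → Independent (~ φ)
  independent-~ (φ′ , p , c∉) = ~ φ′ , ~-cong p , c∉

  independent-∨ : ∀ {φ ψ} → Independent φ → Independent ψ → Independent (φ ∨ ψ)
  independent-∨ (φ′ , p , c∉φ) (ψ′ , q , c∉ψ) = (φ′ ∨ ψ′) , ∨-cong p q , ∉-++ (free φ′) c∉φ c∉ψ

  independent-∧ : ∀ {φ ψ} → Independent φ → Independent ψ → Independent (φ ∧ ψ)
  independent-∧ p q = independent-~ (independent-∨ (independent-~ p) (independent-~ q))

  independent-dia : ∀ {φ} γ → c ∉ freeG γ → Independent φ → Independent (⟨ γ ⟩ φ)
  independent-dia γ c∉γ (φ′ , p , c∉φ) = ⟨ γ ⟩ φ′ , dia-cong γ p , ∉-dia γ φ′ c∉γ c∉φ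

  independent-set : ∀ X φ → Independent (⟨ set X ⟩ φ)
  independent-set X φ = ⟨ set X ⟩ φ , ⇔-refl , ∉-∖-removed (free φ) _ (here refl)

  set-independent : ∀ X {φ} → Independent φ → ⊢ ⟨ set X ⟩ φ ⇔ φ
  set-independent X (φ′ , p , c∉) =
    ⇔-trans (dia-cong (set X) p) (⇔-trans (assign-subst c (numeral X) (nonfree c∉)) (⇔-sym p))

  is-apart : ∀ {X Y} → Y ≢ X → ⊢ is Y ⇒ ~ is X
  is-apart {X} {Y} Y≢X =
    tauto 4 ((a₀ ⇒′ a₁) ⇒′ (a₁ ⇒′ a₂ ⇒′ a₃) ⇒′ ¬′ a₃ ⇒′ a₀ ⇒′ ¬′ a₂)
    · ≐-sym (var c) (numeral Y) · ≐-trans (numeral Y) (var c) (numeral X)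
    · const-apart (λ eq → Y≢X (κ-injective (numeral-injective eq)))

  -- The rounds of a loop for the variable X end as soon as c ≠ κ X.
  rounds loop : PVar → Game → Game
  rounds X g = (⁇ is X ⨾ g) *
  loop X g   = set X ⨾ rounds X g ⨾ ⁇ isn't X

  exit : PVar → Game → Fml → Fml
  exit X g ψ = ⟨ rounds X g ⟩ ⟨ ⁇ isn't X ⟩ ψ

  loop-dia : ∀ X g ψ → ⊢ ⟨ loop X g ⟩ ψ ⇔ ⟨ set X ⟩ exit X g ψ
  loop-dia X g ψ = ⇔-trans (compose _ _ ψ) (dia-cong (set X) (compose _ _ ψ))

  -- The state between two rounds: the loop stops in `ψ` when c ≠ κ X, and otherwise goes on with
  -- `φ` to be met.
  invariant : PVar → Fml → Fml → Fml
  invariant X ψ φ = (~ is X ∧ ψ) ∨ (is X ∧ φ)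

  -- The premise is an equivalence so that it covers both `invariant` itself and `exit`, which has
  -- this form after one unfolding.
  set-same : ∀ X {φ χ ψ} → ⊢ φ ⇔ invariant X ψ χ → ⊢ ⟨ set X ⟩ φ ⇔ ⟨ set X ⟩ χ
  set-same X p = assign-local c _
    (tauto 4 ((a₀ ⇔′ (¬′ a₁ ∧′ a₂) ∨′ (a₁ ∧′ a₃)) ⇒′ a₁ ⇒′ (a₀ ⇔′ a₃)) · p)

  set-other : ∀ X {φ χ ψ} → ⊢ φ ⇔ invariant X ψ χ →
              ∀ {Y} → Y ≢ X → ⊢ ⟨ set Y ⟩ φ ⇔ ⟨ set Y ⟩ ψ
  set-other X p Y≢X = assign-local c _
    (tauto 5 ((a₀ ⇔′ (¬′ a₁ ∧′ a₂) ∨′ (a₁ ∧′ a₃)) ⇒′ (a₄ ⇒′ ¬′ a₁) ⇒′ a₄ ⇒′ (a₀ ⇔′ a₂))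
      · p · is-apart Y≢X)

  isn't-dia : ∀ X ψ → ⊢ ⟨ ⁇ isn't X ⟩ ψ ⇔ (~ is X ∧ ψ)
  isn't-dia X ψ = ⇔-trans (test (isn't X) ψ) (∧-cong (neg-lit _) ⇔-refl)

  guarded-dia : ∀ X g ψ → ⊢ ⟨ ⁇ is X ⨾ g ⟩ ψ ⇔ (is X ∧ ⟨ g ⟩ ψ)
  guarded-dia X g ψ = ⇔-trans (compose _ g ψ) (test (is X) _)

  exit-unfold : ∀ X g ψ → ⊢ exit X g ψ ⇔ invariant X ψ (⟨ g ⟩ exit X g ψ)
  exit-unfold X g ψ =
    ⇔-trans (unfold _ _) (∨-cong (isn't-dia X ψ) (guarded-dia X g (exit X g ψ)))

  -- Where c ≠ κ X the loop has already stopped in `ψ`, so the rule `fixpoint` leaves only the part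
  -- with c = κ X to be preserved.
  exit-least : ∀ X g ψ {φ} → ⊢ ⟨ g ⟩ invariant X ψ φ ⇒ φ → ⊢ exit X g ψ ⇒ invariant X ψ φ
  exit-least X g ψ p = fixpoint _
    (tauto 6 ((a₀ ⇔′ ¬′ a₁ ∧′ a₂) ⇒′ (a₃ ⇔′ a₁ ∧′ a₄) ⇒′ (a₄ ⇒′ a₅) ⇒′
              a₀ ∨′ a₃ ⇒′ (¬′ a₁ ∧′ a₂) ∨′ (a₁ ∧′ a₅))
      · isn't-dia X ψ · guarded-dia X g _ · p)

  -- Induction for the encoded least fixpoint: the initial assignment selects the half `φ` of the
  -- invariant, and independence of `c` then removes the assignment.
  set-exit-least : ∀ X g ψ {φ} → Independent φ → ⊢ ⟨ g ⟩ invariant X ψ φ ⇒ φ →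
                   ⊢ ⟨ set X ⟩ exit X g ψ ⇒ φ
  set-exit-least X g ψ {φ} ind p = begin
    ⟨ set X ⟩ exit X g ψ        ≲⟨ mono _ (exit-least X g ψ p) ⟩
    ⟨ set X ⟩ invariant X ψ φ   ≈⟨ set-same X ⇔-refl ⟩
    ⟨ set X ⟩ φ                 ≈⟨ set-independent X ind ⟩
    φ                           ∎

  set-exit : ∀ X g ψ → Independent (⟨ g ⟩ exit X g ψ) →
             ⊢ ⟨ set X ⟩ exit X g ψ ⇔ ⟨ g ⟩ exit X g ψ
  set-exit X g ψ ind = ⇔-trans (set-same X (exit-unfold X g ψ)) (set-independent X ind)

  -- G φ hands over control to the binder of X in the states with c = κ X, so
  -- only the values of the postcondition in such states matter.
  Agree : PVar → PVar → Fml → Fml → Set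
  Agree X X′ ψ ψ′ = ⊢ ⟨ set X ⟩ ψ ⇔ ⟨ set X′ ⟩ ψ′

  AgreeOff : PVar → Fml → Fml → Set
  AgreeOff X ψ ψ′ = ∀ {Y} → Y ≢ X → Agree Y Y ψ ψ′

  AlwaysIndependent : Game → Set
  AlwaysIndependent g = ∀ ψ → Independent (⟨ g ⟩ ψ)

  -- The value of the second loop is a prefixed point of the body of the first. The hypothesis is
  -- applied to the invariant of the first loop and the exit of the second: they agree at the bound
  -- variables, and elsewhere they are the given postconditions.
  loop-mono : ∀ X g ψ X′ g′ ψ′ → AlwaysIndependent g′ →
    (∀ φ φ′ → Agree X X′ φ φ′ → AgreeOff X φ ψ → AgreeOff X′ φ′ ψ′ → ⊢ ⟨ g ⟩ φ ⇒ ⟨ g′ ⟩ φ′) →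
    ⊢ ⟨ loop X g ⟩ ψ ⇒ ⟨ loop X′ g′ ⟩ ψ′
  loop-mono X g ψ X′ g′ ψ′ ind h = begin
    ⟨ loop X g ⟩ ψ            ≈⟨ loop-dia X g ψ ⟩
    ⟨ set X ⟩ exit X g ψ      ≲⟨ set-exit-least X g ψ (independent-set X′ _) step ⟩
    ⟨ set X′ ⟩ exit X′ g′ ψ′  ≈⟨ loop-dia X′ g′ ψ′ ⟨
    ⟨ loop X′ g′ ⟩ ψ′         ∎
    where
    step = begin
      ⟨ g ⟩ invariant X ψ (⟨ set X′ ⟩ exit X′ g′ ψ′)
        ≲⟨ h _ _ (⇔-trans (set-same X ⇔-refl) (set-independent X (independent-set X′ _)))
             (set-other X ⇔-refl) (set-other X′ (exit-unfold X′ g′ ψ′)) ⟩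
      ⟨ g′ ⟩ exit X′ g′ ψ′
        ≈⟨ set-exit X′ g′ ψ′ (ind _) ⟨
      ⟨ set X′ ⟩ exit X′ g′ ψ′
        ∎

  loop-cong : ∀ X g ψ X′ g′ ψ′ → AlwaysIndependent g → AlwaysIndependent g′ →
    (∀ φ φ′ → Agree X X′ φ φ′ → AgreeOff X φ ψ → AgreeOff X′ φ′ ψ′ → ⊢ ⟨ g ⟩ φ ⇔ ⟨ g′ ⟩ φ′) →
    ⊢ ⟨ loop X g ⟩ ψ ⇔ ⟨ loop X′ g′ ⟩ ψ′
  loop-cong X g ψ X′ g′ ψ′ ind ind′ h = ⇔-intro
    (loop-mono X g ψ X′ g′ ψ′ ind′ λ φ φ′ p q r → ⇔-to (h φ φ′ p q r))
    (loop-mono X′ g′ ψ′ X g ψ ind λ φ′ φ p q r → ⇔-from (h φ φ′ (⇔-sym p) r q))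

  coloop : PVar → Game → Game
  coloop X g = set X ⨾ ((⁇ is X) ᵈ ⨾ g) ˣ ⨾ (⁇ isn't X) ᵈ

  -- Reduces ν to μ with dual body and complemented postcondition; the negation passes through the
  -- initial assignment by `assign-~`.
  coloop-dia : ∀ X g ψ → ⊢ ⟨ coloop X g ⟩ ψ ⇔ ~ ⟨ loop X (g ᵈ) ⟩ (~ ψ)
  coloop-dia X g ψ = begin-equality
    ⟨ coloop X g ⟩ ψ
      ≈⟨ compose _ _ ψ ⟩
    ⟨ set X ⟩ ⟨ ((⁇ is X) ᵈ ⨾ g) ˣ ⨾ (⁇ isn't X) ᵈ ⟩ ψ
      ≈⟨ dia-cong _ (compose _ _ ψ) ⟩
    ⟨ set X ⟩ ⟨ ((⁇ is X) ᵈ ⨾ g) ˣ ⟩ ⟨ (⁇ isn't X) ᵈ ⟩ ψ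
      ≈⟨ dia-cong _ (dual _ _) ⟩
    ⟨ set X ⟩ (~ ⟨ (((⁇ is X) ᵈ ⨾ g) ᵈ) * ⟩ (~ ⟨ (⁇ isn't X) ᵈ ⟩ ψ))
      ≈⟨ dia-cong _ (~-cong (⇔-trans (star-cong _ (⁇ is X ⨾ g ᵈ) body _)
           (dia-cong _ (⇔-trans (~-cong (dual _ ψ)) (tauto 1 (¬′ ¬′ a₀ ⇔′ a₀)))))) ⟩
    ⟨ set X ⟩ (~ exit X (g ᵈ) (~ ψ))
      ≈⟨ assign-~ c _ _ ⟩
    ~ ⟨ set X ⟩ exit X (g ᵈ) (~ ψ)
      ≈⟨ ~-cong (loop-dia X (g ᵈ) (~ ψ)) ⟨
    ~ ⟨ loop X (g ᵈ) ⟩ (~ ψ)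
      ∎
    where
    body : ∀ φ → ⊢ ⟨ ((⁇ is X) ᵈ ⨾ g) ᵈ ⟩ φ ⇔ ⟨ ⁇ is X ⨾ g ᵈ ⟩ φ
    body φ = begin-equality
      ⟨ ((⁇ is X) ᵈ ⨾ g) ᵈ ⟩ φ      ≈⟨ dual _ φ ⟩
      ~ ⟨ (⁇ is X) ᵈ ⨾ g ⟩ (~ φ)    ≈⟨ ~-cong (compose _ g (~ φ)) ⟩
      ~ ⟨ (⁇ is X) ᵈ ⟩ ⟨ g ⟩ (~ φ)
        ≈⟨ tauto 4 ((a₀ ⇔′ (a₁ ⇒′ a₂)) ⇒′ (a₃ ⇔′ ¬′ a₂) ⇒′ (¬′ a₀ ⇔′ a₁ ∧′ a₃))
           · test-dual (is X) (⟨ g ⟩ (~ φ)) · dual g φ ⟩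
      is X ∧ ⟨ g ᵈ ⟩ φ              ≈⟨ guarded-dia X (g ᵈ) φ ⟨
      ⟨ ⁇ is X ⨾ g ᵈ ⟩ φ            ∎

  -- After a successful test the opponent faces `⁇ ⊥ᶠ` and loses, so `ψ` is never evaluated.
  G-lit : ∀ p ψ → ⊢ ⟨ G (lit p) ⟩ ψ ⇔ lit p
  G-lit p ψ = ⇔-trans (compose _ _ ψ) (⇔-trans (test (lit p) _)
    (tauto 5 ((a₁ ⇔′ (a₂ ⇒′ a₃)) ⇒′ (a₂ ⇔′ ¬′ a₄) ⇒′ a₄ ⇒′ (a₀ ∧′ a₁ ⇔′ a₀))
      · test-dual ⊥ᶠ ψ · neg-lit _ · ⊤-intro))

  G-dia : ∀ a φ ψ → ⊢ ⟨ G (⟨ a ⟩ᵐ φ) ⟩ ψ ⇔ ⟨ act a ⟩ ⟨ G φ ⟩ ψ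
  G-dia a φ ψ = compose _ _ ψ

  G-box : ∀ a φ ψ → ⊢ ⟨ G ([ a ]ᵐ φ) ⟩ ψ ⇔ ~ ⟨ act a ⟩ (~ ⟨ G φ ⟩ ψ)
  G-box a φ ψ = ⇔-trans (compose _ _ ψ) (dual _ _)

  dual-independent : ∀ g → AlwaysIndependent g → AlwaysIndependent (g ᵈ)
  dual-independent g ind ψ = independent-resp (dual g ψ) (independent-~ (ind (~ ψ)))

  -- Literals ignore the postcondition, while variables and fixpoints begin by overwriting `c`; the
  -- remaining constructors preserve independence.
  G-independent : ∀ φ → c ∉ varsM φ → AlwaysIndependent (G φ)
  G-independent (lit p)    c∉ ψ = lit p , G-lit p ψ , c∉
  G-independent (pvar X)   c∉ ψ = independent-set X ψ
  G-independent (φ ∨ᵐ χ)   c∉ ψ = independent-resp (choice _ _ ψ)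
    (independent-∨ (G-independent φ (∉-++ˡ (varsM φ) c∉) ψ) (G-independent χ (∉-++ʳ (varsM φ) c∉) ψ))
  G-independent (φ ∧ᵐ χ)   c∉ ψ = independent-resp (∩-dia _ _ ψ)
    (independent-∧ (G-independent φ (∉-++ˡ (varsM φ) c∉) ψ) (G-independent χ (∉-++ʳ (varsM φ) c∉) ψ))
  G-independent (⟨ a ⟩ᵐ φ) c∉ ψ = independent-resp (G-dia a φ ψ)
    (independent-dia (act a) (All⇒∉ (freeAct-⊆ a (∉⇒All (∉-++ˡ (varsAct a) c∉))))
      (G-independent φ (∉-++ʳ (varsAct a) c∉) ψ))
  G-independent ([ a ]ᵐ φ) c∉ ψ = independent-resp (G-box a φ ψ)
    (independent-~ (independent-dia (act a) (All⇒∉ (freeAct-⊆ a (∉⇒All (∉-++ˡ (varsAct a) c∉))))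
      (independent-~ (G-independent φ (∉-++ʳ (varsAct a) c∉) ψ))))
  G-independent (μ X φ)    c∉ ψ = independent-resp (compose _ _ ψ) (independent-set X _)
  G-independent (ν X φ)    c∉ ψ = independent-resp (compose _ _ ψ) (independent-set X _)

-- Renaming and complementation of propositional variables

_≟ᵖ_ : (X Y : PVar) → Dec (X ≡ Y)
pos m ≟ᵖ pos n = map′ (cong pos) (λ { refl → refl }) (m ≟ n)
neg m ≟ᵖ neg n = map′ (cong neg) (λ { refl → refl }) (m ≟ n)
pos m ≟ᵖ neg n = no λ ()
neg m ≟ᵖ pos n = no λ ()

co-involutive : ∀ X → co (co X) ≡ X
co-involutive (pos n) = refl
co-involutive (neg n) = refl

co-≢ : ∀ {X Y} → X ≢ Y → co X ≢ co Y
co-≢ {X} {Y} X≢Y eq =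
  X≢Y (trans (sym (co-involutive X)) (trans (cong co eq) (co-involutive Y)))

varsM-∁ : ∀ φ → varsM (∁ φ) ≡ varsM φ
varsM-∁ (lit (pos a)) = refl
varsM-∁ (lit (neg a)) = refl
varsM-∁ (pvar X)      = refl
varsM-∁ (φ ∨ᵐ ψ)      = cong₂ _++_ (varsM-∁ φ) (varsM-∁ ψ)
varsM-∁ (φ ∧ᵐ ψ)      = cong₂ _++_ (varsM-∁ φ) (varsM-∁ ψ)
varsM-∁ (⟨ a ⟩ᵐ φ)    = cong (varsAct a ++_) (varsM-∁ φ)
varsM-∁ ([ a ]ᵐ φ)    = cong (varsAct a ++_) (varsM-∁ φ)
varsM-∁ (μ X φ)       = varsM-∁ φ
varsM-∁ (ν X φ)       = varsM-∁ φ

∼-refl : ∀ {X Γ} → All (λ (Y , Z) → Y ≡ Z) Γ → X ∼[ Γ ] X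
∼-refl                   []         = nil
∼-refl {X} {(Y , _) ∷ _} (refl ∷ p) with X ≟ᵖ Y
... | yes refl = here
... | no X≢Y   = there X≢Y X≢Y (∼-refl p)

≈-refl : ∀ {Γ} φ → All (λ (Y , Z) → Y ≡ Z) Γ → Γ ⊢ φ ≈ φ
≈-refl (lit p)    d = lit
≈-refl (pvar X)   d = pvar (∼-refl d)
≈-refl (φ ∨ᵐ ψ)   d = or (≈-refl φ d) (≈-refl ψ d)
≈-refl (φ ∧ᵐ ψ)   d = and (≈-refl φ d) (≈-refl ψ d)
≈-refl (⟨ a ⟩ᵐ φ) d = dia (≈-refl φ d)
≈-refl ([ a ]ᵐ φ) d = box (≈-refl φ d)
≈-refl (μ X φ)    d = μ (≈-refl φ (refl ∷ d))
≈-refl (ν X φ)    d = ν (≈-refl φ (refl ∷ d))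

module Invariance (κ : PVar → ℕ) (κ-injective : Injective _≡_ _≡_ κ) (c : Var) where

  open Translate κ c
  open Semantics κ κ-injective c

  agree-~ : ∀ {X Y φ ψ} → Agree X Y φ ψ → Agree X Y (~ φ) (~ ψ)
  agree-~ p = ⇔-trans (assign-~ c _ _) (⇔-trans (~-cong p) (⇔-sym (assign-~ c _ _)))

  agree-~~ : ∀ X ψ → Agree X X (~ ~ ψ) ψ
  agree-~~ X ψ = dia-cong (set X) (tauto 1 (¬′ ¬′ a₀ ⇔′ a₀))

  -- Two postconditions are needed for the induction: below a binder they become the different
  -- intermediate conditions of the two loops.
  rename-sound : ∀ {Γ φ φ′} → Γ ⊢ φ ≈ φ′ → c ∉ varsM φ → c ∉ varsM φ′ → ∀ ψ ψ′ →
    (∀ {X X′} → X ∼[ Γ ] X′ → X FreeIn φ → Agree X X′ ψ ψ′) → ⊢ ⟨ G φ ⟩ ψ ⇔ ⟨ G φ′ ⟩ ψ′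
  rename-sound (lit {p})  c∉ c∉′ ψ ψ′ h = ⇔-trans (G-lit p ψ) (⇔-sym (G-lit p ψ′))
  rename-sound (pvar r)   c∉ c∉′ ψ ψ′ h = h r pvar
  rename-sound (or {φ} {φ′} p q) c∉ c∉′ ψ ψ′ h =
    ⇔-trans (choice _ _ ψ) (⇔-trans (∨-cong
      (rename-sound p (∉-++ˡ (varsM φ) c∉) (∉-++ˡ (varsM φ′) c∉′) ψ ψ′ (λ r f → h r (∨ˡ f)))
      (rename-sound q (∉-++ʳ (varsM φ) c∉) (∉-++ʳ (varsM φ′) c∉′) ψ ψ′ (λ r f → h r (∨ʳ f))))
    (⇔-sym (choice _ _ ψ′)))
  rename-sound (and {φ} {φ′} p q) c∉ c∉′ ψ ψ′ h =
    ⇔-trans (∩-dia _ _ ψ) (⇔-trans (∧-cong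
      (rename-sound p (∉-++ˡ (varsM φ) c∉) (∉-++ˡ (varsM φ′) c∉′) ψ ψ′ (λ r f → h r (∧ˡ f)))
      (rename-sound q (∉-++ʳ (varsM φ) c∉) (∉-++ʳ (varsM φ′) c∉′) ψ ψ′ (λ r f → h r (∧ʳ f))))
    (⇔-sym (∩-dia _ _ ψ′)))
  rename-sound (dia {a} p) c∉ c∉′ ψ ψ′ h =
    ⇔-trans (compose _ _ ψ) (⇔-trans (dia-cong _
      (rename-sound p (∉-++ʳ (varsAct a) c∉) (∉-++ʳ (varsAct a) c∉′) ψ ψ′ (λ r f → h r (dia f))))
    (⇔-sym (compose _ _ ψ′)))
  rename-sound (box {a} p) c∉ c∉′ ψ ψ′ h =
    ⇔-trans (compose _ _ ψ) (⇔-trans (dia-cong _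
      (rename-sound p (∉-++ʳ (varsAct a) c∉) (∉-++ʳ (varsAct a) c∉′) ψ ψ′ (λ r f → h r (box f))))
    (⇔-sym (compose _ _ ψ′)))
  rename-sound (μ {X} {X′} {φ} {φ′} p) c∉ c∉′ ψ ψ′ h =
    loop-cong X (G φ) ψ X′ (G φ′) ψ′ (G-independent φ c∉) (G-independent φ′ c∉′)
      λ χ χ′ at off off′ → rename-sound p c∉ c∉′ χ χ′ λ where
        here            f → at
        -- Variables bound further out still see the original postconditions, because the new ones
        -- differ from them only at `X` and `X′`.
        (there ≢X ≢X′ r) f → ⇔-trans (off ≢X) (⇔-trans (h r (μ ≢X f)) (⇔-sym (off′ ≢X′)))
  rename-sound (ν {X} {X′} {φ} {φ′} p) c∉ c∉′ ψ ψ′ h =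
    ⇔-trans (coloop-dia X (G φ) ψ) (⇔-trans (~-cong
      (loop-cong X (G φ ᵈ) (~ ψ) X′ (G φ′ ᵈ) (~ ψ′)
        (dual-independent _ (G-independent φ c∉)) (dual-independent _ (G-independent φ′ c∉′))
        λ χ χ′ at off off′ → ⇔-trans (dual _ χ) (⇔-trans (~-cong
          (rename-sound p c∉ c∉′ (~ χ) (~ χ′) λ where
            here                         f → agree-~ at
            (there {X = Y} {Y = Y′} ≢X ≢X′ r) f →
              ⇔-trans (agree-~ (off ≢X)) (⇔-trans (agree-~ (agree-~ (h r (ν ≢X f))))
                (⇔-sym (agree-~ (off′ ≢X′))))))
          (⇔-sym (dual _ χ′)))))
    (⇔-sym (coloop-dia X′ (G φ′) ψ′)))

  -- The complement uses another numeral for each variable, hence the comparison of `co X` with `X`.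
  -- For closed `φ` the hypothesis is vacuous.
  dual-sound : ∀ φ → c ∉ varsM φ → ∀ ψ ψ′ →
    (∀ {X} → X FreeIn φ → Agree (co X) X ψ′ (~ ψ)) → ⊢ ⟨ G (∁ φ) ⟩ ψ′ ⇔ ~ ⟨ G φ ⟩ ψ
  dual-sound (lit p) c∉ ψ ψ′ h =
    ⇔-trans (G-lit (coL p) ψ′) (⇔-trans (coL-lit p) (~-cong (⇔-sym (G-lit p ψ))))
  dual-sound (pvar X) c∉ ψ ψ′ h = ⇔-trans (h pvar) (assign-~ c _ ψ)
  dual-sound (φ ∨ᵐ χ) c∉ ψ ψ′ h = ⇔-trans (∩-dia _ _ ψ′)
    (tauto 5 ((a₀ ⇔′ ¬′ a₁) ⇒′ (a₂ ⇔′ ¬′ a₃) ⇒′ (a₄ ⇔′ a₁ ∨′ a₃) ⇒′ (a₀ ∧′ a₂ ⇔′ ¬′ a₄))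
      · dual-sound φ (∉-++ˡ (varsM φ) c∉) ψ ψ′ (h ∘ ∨ˡ)
      · dual-sound χ (∉-++ʳ (varsM φ) c∉) ψ ψ′ (h ∘ ∨ʳ) · choice _ _ ψ)
  dual-sound (φ ∧ᵐ χ) c∉ ψ ψ′ h = ⇔-trans (choice _ _ ψ′)
    (tauto 5 ((a₀ ⇔′ ¬′ a₁) ⇒′ (a₂ ⇔′ ¬′ a₃) ⇒′ (a₄ ⇔′ a₁ ∧′ a₃) ⇒′ (a₀ ∨′ a₂ ⇔′ ¬′ a₄))
      · dual-sound φ (∉-++ˡ (varsM φ) c∉) ψ ψ′ (h ∘ ∧ˡ)
      · dual-sound χ (∉-++ʳ (varsM φ) c∉) ψ ψ′ (h ∘ ∧ʳ) · ∩-dia _ _ ψ)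
  dual-sound (⟨ a ⟩ᵐ φ) c∉ ψ ψ′ h = begin-equality
    ⟨ act a ᵈ ⨾ G (∁ φ) ⟩ ψ′        ≈⟨ compose _ _ ψ′ ⟩
    ⟨ act a ᵈ ⟩ ⟨ G (∁ φ) ⟩ ψ′
      ≈⟨ dia-cong _ (dual-sound φ (∉-++ʳ (varsAct a) c∉) ψ ψ′ (h ∘ dia)) ⟩
    ⟨ act a ᵈ ⟩ (~ ⟨ G φ ⟩ ψ)       ≈⟨ tauto 1 (¬′ ¬′ a₀ ⇔′ a₀) ⟨
    ~ ~ ⟨ act a ᵈ ⟩ (~ ⟨ G φ ⟩ ψ)   ≈⟨ ~-cong (~ᵈ (act a) _) ⟩
    ~ ⟨ act a ⟩ ⟨ G φ ⟩ ψ           ≈⟨ ~-cong (compose _ _ ψ) ⟨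
    ~ ⟨ act a ⨾ G φ ⟩ ψ             ∎
  dual-sound ([ a ]ᵐ φ) c∉ ψ ψ′ h = begin-equality
    ⟨ act a ⨾ G (∁ φ) ⟩ ψ′          ≈⟨ compose _ _ ψ′ ⟩
    ⟨ act a ⟩ ⟨ G (∁ φ) ⟩ ψ′
      ≈⟨ dia-cong _ (dual-sound φ (∉-++ʳ (varsAct a) c∉) ψ ψ′ (h ∘ box)) ⟩
    ⟨ act a ⟩ (~ ⟨ G φ ⟩ ψ)         ≈⟨ tauto 1 (¬′ ¬′ a₀ ⇔′ a₀) ⟨
    ~ ~ ⟨ act a ⟩ (~ ⟨ G φ ⟩ ψ)     ≈⟨ ~-cong (G-box a φ ψ) ⟨
    ~ ⟨ act a ᵈ ⨾ G φ ⟩ ψ           ∎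
  dual-sound (μ X φ) c∉ ψ ψ′ h =
    ⇔-trans (coloop-dia (co X) (G (∁ φ)) ψ′) (~-cong
      (loop-cong (co X) (G (∁ φ) ᵈ) (~ ψ′) X (G φ) ψ
        (dual-independent _ (G-independent (∁ φ) (subst (c ∉_) (sym (varsM-∁ φ)) c∉)))
        (G-independent φ c∉)
        λ χ′ χ at off′ off → ⇔-trans (dual _ χ′) (⇔-trans (~-cong
          (dual-sound φ c∉ χ (~ χ′) λ {Y} f → case Y ≟ᵖ X of λ where
            (yes refl) → agree-~ at
            (no Y≢X)   → ⇔-trans (agree-~ (off′ (co-≢ Y≢X))) (⇔-trans (agree-~~ _ ψ′)
              (⇔-trans (h (μ Y≢X f)) (⇔-sym (agree-~ (off Y≢X)))))))
          (tauto 1 (¬′ ¬′ a₀ ⇔′ a₀)))))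
  dual-sound (ν X φ) c∉ ψ ψ′ h =
    ⇔-trans (loop-cong (co X) (G (∁ φ)) ψ′ X (G φ ᵈ) (~ ψ)
        (G-independent (∁ φ) (subst (c ∉_) (sym (varsM-∁ φ)) c∉))
        (dual-independent _ (G-independent φ c∉))
        λ χ′ χ at off′ off → ⇔-trans
          (dual-sound φ c∉ (~ χ) χ′ λ {Y} f → case Y ≟ᵖ X of λ where
            (yes refl) → ⇔-trans at (⇔-sym (agree-~~ X χ))
            (no Y≢X)   → ⇔-trans (off′ (co-≢ Y≢X)) (⇔-trans (h (ν Y≢X f))
              (⇔-trans (⇔-sym (off Y≢X)) (⇔-sym (agree-~~ _ χ)))))
          (⇔-sym (dual _ χ)))
      (⇔-trans (tauto 1 (a₀ ⇔′ ¬′ ¬′ a₀)) (~-cong (⇔-sym (coloop-dia X (G φ) ψ))))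

  -- Decodes a loop into `γ *`: each side is a prefixed point of the operator of the other. The
  -- abstract continuation `k` covers both polarities, being `⟨ G χ ⟩ φ` for a loop and
  -- `~ ⟨ G χ ⟩ (~ φ)` for a dual loop.
  loop-star : ∀ X g ψ γ (k : Fml → Fml) → c ∉ freeG γ →
    (∀ φ → ⊢ ⟨ g ⟩ φ ⇔ (k φ ∨ ⟨ γ ⟩ ⟨ set X ⟩ φ)) →
    (∀ φ → AgreeOff X φ ψ → ⊢ k φ ⇔ k ψ) → Independent (k ψ) →
    ⊢ ⟨ loop X g ⟩ ψ ⇔ ⟨ γ * ⟩ k ψ
  loop-star X g ψ γ k c∉ g⇔ k-cong ind = ⇔-trans (loop-dia X g ψ) (⇔-intro
    (set-exit-least X g ψ ind* (tauto 6
      ((a₀ ⇔′ a₁ ∨′ a₂) ⇒′ (a₁ ⇔′ a₃) ⇒′ (a₂ ⇔′ a₄) ⇒′ (a₅ ⇔′ a₃ ∨′ a₄) ⇒′ a₀ ⇒′ a₅)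
      · g⇔ _ · k-cong _ (set-other X ⇔-refl)
      · dia-cong γ (⇔-trans (set-same X ⇔-refl) (set-independent X ind*)) · unfold γ (k ψ)))
    (fixpoint γ (tauto 5
      ((a₀ ⇔′ a₄) ⇒′ (a₀ ⇔′ a₁ ∨′ a₂) ⇒′ (a₁ ⇔′ a₃) ⇒′ a₃ ∨′ a₂ ⇒′ a₄)
      · ⇔-sym (set-exit X g ψ ind-exit) · g⇔ _ · k-exit)))
    where
    ind* = independent-dia (γ *) c∉ ind
    k-exit = k-cong (exit X g ψ) (set-other X (exit-unfold X g ψ))
    ind-exit = independent-resp (g⇔ _)
      (independent-∨ (independent-resp k-exit ind) (independent-dia γ c∉ (independent-set X _)))

-- The modal translation of games

play : Bool → Game → Game
play true  γ = γ
play false γ = γ ᵈ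

signed : Bool → Fml → Fml
signed true  φ = φ
signed false φ = ~ φ

literalᵇ : Bool → Literal → Mu
literalᵇ true  p = lit p
literalᵇ false p = lit (coL p)

actᵇ : Bool → Act → Mu → Mu
actᵇ true  a χ = ⟨ a ⟩ᵐ χ
actᵇ false a χ = [ a ]ᵐ χ

orᵇ : Bool → Mu → Mu → Mu
orᵇ true  χ ξ = χ ∨ᵐ ξ
orᵇ false χ ξ = χ ∧ᵐ ξ

fixᵇ : Bool → ℕ → Mu → Mu
fixᵇ true  n χ = μ (pos n) χ
fixᵇ false n χ = ν (pos n) χ

-- transG b n γ χ expresses ⟨ play b γ ⟩ χ, where the free propositional
-- variables of χ are numbered below n.  Carrying the Boolean instead of taking
-- complements keeps all propositional variables positive.
mutual
  transG : Bool → ℕ → Game → Mu → Mu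
  transG b n (act a) χ = actᵇ b a χ
  -- A test is a conjunction and its dual the implication ¬φ ∨ χ: the connective flips against `b`,
  -- while the sign of `φ` follows `b`.
  transG b n (⁇ φ)   χ = orᵇ (Bool.not b) (translate b φ) χ
  transG b n (γ ∪ δ) χ = orᵇ b (transG b n γ χ) (transG b n δ χ)
  transG b n (γ ⨾ δ) χ = transG b n γ (transG b n δ χ)
  -- Variables act as de Bruijn levels: `pos n` is not free in `χ` and captures nothing there.
  transG b n (γ *)   χ = fixᵇ b n (orᵇ b χ (transG b (suc n) γ (pvar (pos n))))
  transG b n (γ ᵈ)   χ = transG (Bool.not b) n γ χ

  translate : Bool → Fml → Mu
  translate b (lit p)   = literalᵇ b p
  translate b (~ φ)     = translate (Bool.not b) φ
  translate b (φ ∨ ψ)   = orᵇ b (translate b φ) (translate b ψ)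
  translate b (⟨ γ ⟩ φ) = transG b 0 γ (translate b φ)

-- Scoping, positivity and object variables of the modal translation

Scoped : ℕ → Mu → Set
Scoped n χ = ∀ {X} → X FreeIn χ → ∃[ m ] m ℕ.< n × X ≡ pos m

scoped-weaken : ∀ {m n χ} → m ℕ.≤ n → Scoped m χ → Scoped n χ
scoped-weaken m≤n s f with k , k<m , eq ← s f = k , ℕP.<-≤-trans k<m m≤n , eq

orᵇ-scoped : ∀ b {n χ ξ} → Scoped n χ → Scoped n ξ → Scoped n (orᵇ b χ ξ)
orᵇ-scoped true  s t (∨ˡ f) = s f
orᵇ-scoped true  s t (∨ʳ f) = t f
orᵇ-scoped false s t (∧ˡ f) = s f
orᵇ-scoped false s t (∧ʳ f) = t f

strengthen : ∀ {X n} → X ≢ pos n → ∃[ m ] m ℕ.< suc n × X ≡ pos m → ∃[ m ] m ℕ.< n × X ≡ pos m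
strengthen X≢ (m , m<1+n , refl) =
  m , ℕP.≤∧≢⇒< (ℕ.s≤s⁻¹ m<1+n) (λ { refl → X≢ refl }) , refl

fixᵇ-scoped : ∀ b {n χ} → Scoped (suc n) χ → Scoped n (fixᵇ b n χ)
fixᵇ-scoped true  s (μ X≢ f) = strengthen X≢ (s f)
fixᵇ-scoped false s (ν X≢ f) = strengthen X≢ (s f)

pvar-scoped : ∀ n → Scoped (suc n) (pvar (pos n))
pvar-scoped n pvar = n , ℕP.≤-refl , refl

mutual
  transG-scoped : ∀ b n γ χ → Scoped n χ → Scoped n (transG b n γ χ)
  transG-scoped true  n (act a) χ s (dia f) = s f
  transG-scoped false n (act a) χ s (box f) = s f
  transG-scoped b n (⁇ φ)   χ s =
    orᵇ-scoped (Bool.not b) (scoped-weaken ℕ.z≤n (translate-scoped b φ)) s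
  transG-scoped b n (γ ∪ δ) χ s = orᵇ-scoped b (transG-scoped b n γ χ s) (transG-scoped b n δ χ s)
  transG-scoped b n (γ ⨾ δ) χ s = transG-scoped b n γ _ (transG-scoped b n δ χ s)
  transG-scoped b n (γ *)   χ s = fixᵇ-scoped b (orᵇ-scoped b (scoped-weaken (ℕP.n≤1+n n) s)
    (transG-scoped b (suc n) γ _ (pvar-scoped n)))
  transG-scoped b n (γ ᵈ)   χ s = transG-scoped (Bool.not b) n γ χ s

  translate-scoped : ∀ b φ → Scoped 0 (translate b φ)
  translate-scoped true  (lit p)   ()
  translate-scoped false (lit p)   ()
  translate-scoped b     (~ φ)     = translate-scoped (Bool.not b) φ
  translate-scoped b     (φ ∨ ψ)   = orᵇ-scoped b (translate-scoped b φ) (translate-scoped b ψ)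
  translate-scoped b     (⟨ γ ⟩ φ) = transG-scoped b 0 γ _ (translate-scoped b φ)

data Positive : PVar → Set where
  pos : ∀ n → Positive (pos n)

AllPositive : Mu → Set
AllPositive χ = All Positive (pvars χ)

positive-wellFormed : ∀ χ → AllPositive χ → WellFormed χ
positive-wellFormed (lit p)    a = lit
positive-wellFormed (pvar X)   a = pvar
positive-wellFormed (χ ∨ᵐ ξ)   a =
  or (positive-wellFormed χ (++⁻ˡ (pvars χ) a)) (positive-wellFormed ξ (++⁻ʳ (pvars χ) a))
positive-wellFormed (χ ∧ᵐ ξ)   a =
  and (positive-wellFormed χ (++⁻ˡ (pvars χ) a)) (positive-wellFormed ξ (++⁻ʳ (pvars χ) a))
positive-wellFormed (⟨ _ ⟩ᵐ χ) a = dia (positive-wellFormed χ a)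
positive-wellFormed ([ _ ]ᵐ χ) a = box (positive-wellFormed χ a)
positive-wellFormed (μ (pos n) χ) (pos n ∷ a) =
  μ (λ p → case All.lookup a p of λ ()) (positive-wellFormed χ a)
positive-wellFormed (ν (pos n) χ) (pos n ∷ a) =
  ν (λ p → case All.lookup a p of λ ()) (positive-wellFormed χ a)

orᵇ-positive : ∀ b χ ξ → AllPositive χ → AllPositive ξ → AllPositive (orᵇ b χ ξ)
orᵇ-positive true  χ ξ = ++⁺
orᵇ-positive false χ ξ = ++⁺

fixᵇ-positive : ∀ b n χ → AllPositive χ → AllPositive (fixᵇ b n χ)
fixᵇ-positive true  n χ a = pos n ∷ a
fixᵇ-positive false n χ a = pos n ∷ a

mutual
  transG-positive : ∀ b n γ χ → AllPositive χ → AllPositive (transG b n γ χ)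
  transG-positive true  n (act a) χ p = p
  transG-positive false n (act a) χ p = p
  transG-positive b n (⁇ φ)   χ p = orᵇ-positive (Bool.not b) _ χ (translate-positive b φ) p
  transG-positive b n (γ ∪ δ) χ p =
    orᵇ-positive b _ _ (transG-positive b n γ χ p) (transG-positive b n δ χ p)
  transG-positive b n (γ ⨾ δ) χ p = transG-positive b n γ _ (transG-positive b n δ χ p)
  transG-positive b n (γ *)   χ p = fixᵇ-positive b n (orᵇ b χ _)
    (orᵇ-positive b χ _ p (transG-positive b (suc n) γ _ (pos n ∷ [])))
  transG-positive b n (γ ᵈ)   χ p = transG-positive (Bool.not b) n γ χ p

  translate-positive : ∀ b φ → AllPositive (translate b φ)
  translate-positive true  (lit p)   = []
  translate-positive false (lit p)   = []
  translate-positive b     (~ φ)     = translate-positive (Bool.not b) φ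
  translate-positive b     (φ ∨ ψ)   =
    orᵇ-positive b _ _ (translate-positive b φ) (translate-positive b ψ)
  translate-positive b     (⟨ γ ⟩ φ) = transG-positive b 0 γ _ (translate-positive b φ)

translate-isFormula : ∀ b φ → IsFormula (translate b φ)
translate-isFormula b φ = record
  { wellFormed = positive-wellFormed _ (translate-positive b φ)
  ; closed     = λ X f → case translate-scoped b φ f of λ { (_ , () , _) }
  }

module _ {P : Var → Set} where

  orᵇ-vars : ∀ b χ ξ → All P (varsM χ) → All P (varsM ξ) → All P (varsM (orᵇ b χ ξ))
  orᵇ-vars true  χ ξ = ++⁺
  orᵇ-vars false χ ξ = ++⁺

  fixᵇ-vars : ∀ b n χ → All P (varsM χ) → All P (varsM (fixᵇ b n χ))
  fixᵇ-vars true  n χ p = p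
  fixᵇ-vars false n χ p = p

  mutual
    transG-vars : ∀ b n γ χ → All P (varsG γ) → All P (varsM χ) → All P (varsM (transG b n γ χ))
    transG-vars true  n (act a) χ p q = ++⁺ p q
    transG-vars false n (act a) χ p q = ++⁺ p q
    transG-vars b n (⁇ φ)   χ p q = orᵇ-vars (Bool.not b) _ χ (translate-vars b φ p) q
    transG-vars b n (γ ∪ δ) χ p q = orᵇ-vars b _ _
      (transG-vars b n γ χ (++⁻ˡ (varsG γ) p) q) (transG-vars b n δ χ (++⁻ʳ (varsG γ) p) q)
    transG-vars b n (γ ⨾ δ) χ p q = transG-vars b n γ _ (++⁻ˡ (varsG γ) p)
      (transG-vars b n δ χ (++⁻ʳ (varsG γ) p) q)
    transG-vars b n (γ *)   χ p q = fixᵇ-vars b n (orᵇ b χ _)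
      (orᵇ-vars b χ _ q (transG-vars b (suc n) γ _ p []))
    transG-vars b n (γ ᵈ)   χ p q = transG-vars (Bool.not b) n γ χ p q

    translate-vars : ∀ b φ → All P (vars φ) → All P (varsM (translate b φ))
    translate-vars true  (lit p)   a = a
    translate-vars false (lit (pos _)) a = a
    translate-vars false (lit (neg _)) a = a
    translate-vars b     (~ φ)     a = translate-vars (Bool.not b) φ a
    translate-vars b     (φ ∨ ψ)   a = orᵇ-vars b _ _
      (translate-vars b φ (++⁻ˡ (vars φ) a)) (translate-vars b ψ (++⁻ʳ (vars φ) a))
    translate-vars b     (⟨ γ ⟩ φ) a = transG-vars b 0 γ _ (++⁻ˡ (varsG γ) a)
      (translate-vars b φ (++⁻ʳ (varsG γ) a))

translate-∉ : ∀ {v} b φ → v ∉ vars φ → v ∉ varsM (translate b φ)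
translate-∉ b φ p = All⇒∉ (translate-vars b φ (∉⇒All p))

module Translation (κ : PVar → ℕ) (κ-injective : Injective _≡_ _≡_ κ) (c : Var) where

  open Translate κ c
  open Semantics κ κ-injective c
  open Invariance κ κ-injective c

  -- Invariance under the identity renaming: control returns from `χ` only at numerals of its free
  -- variables, all below level `n`.
  G-local : ∀ n χ {φ ψ} → c ∉ varsM χ → Scoped n χ → AgreeOff (pos n) φ ψ →
            ⊢ ⟨ G χ ⟩ φ ⇔ ⟨ G χ ⟩ ψ
  G-local n χ c∉ s off = rename-sound (≈-refl χ []) c∉ c∉ _ _ λ { nil f → off (apart (s f)) }
    where
    apart : ∀ {X} → ∃[ m ] m ℕ.< n × X ≡ pos m → X ≢ pos n
    apart (m , m<n , refl) refl = ℕP.<-irrefl refl m<n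

  mutual
    -- The postcondition is arbitrary because the free variables of `χ` return control to it. In the
    -- loop cases `Scoped` ensures that `χ` does not see the new variable `pos n`.
    transG-sound : ∀ b n γ χ → c ∉ varsG γ → c ∉ varsM χ → Scoped n χ → ∀ ψ →
                   ⊢ ⟨ G (transG b n γ χ) ⟩ ψ ⇔ ⟨ play b γ ⟩ ⟨ G χ ⟩ ψ
    transG-sound true  n (act a) χ c∉γ c∉χ s ψ = compose _ _ ψ
    transG-sound false n (act a) χ c∉γ c∉χ s ψ = compose _ _ ψ
    transG-sound true  n (⁇ φ)   χ c∉γ c∉χ s ψ = ⇔-trans (∩-dia _ _ ψ)
      (⇔-trans (∧-cong (translate-sound true φ c∉γ ψ) ⇔-refl) (⇔-sym (test φ _)))
    transG-sound false n (⁇ φ)   χ c∉γ c∉χ s ψ = ⇔-trans (choice _ _ ψ)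
      (⇔-trans (∨-cong (translate-sound false φ c∉γ ψ) ⇔-refl) (⇔-sym (test-dual φ _)))
    transG-sound true  n (γ ∪ δ) χ c∉γ c∉χ s ψ = ⇔-trans (choice _ _ ψ) (⇔-trans
      (∨-cong (transG-sound true n γ χ (∉-++ˡ (varsG γ) c∉γ) c∉χ s ψ)
              (transG-sound true n δ χ (∉-++ʳ (varsG γ) c∉γ) c∉χ s ψ))
      (⇔-sym (choice γ δ _)))
    transG-sound false n (γ ∪ δ) χ c∉γ c∉χ s ψ = ⇔-trans (∩-dia _ _ ψ)
      (tauto 8 ((a₀ ⇔′ a₁) ⇒′ (a₂ ⇔′ a₃) ⇒′ (a₁ ⇔′ ¬′ a₄) ⇒′ (a₃ ⇔′ ¬′ a₅) ⇒′
                (a₆ ⇔′ a₄ ∨′ a₅) ⇒′ (a₇ ⇔′ ¬′ a₆) ⇒′ (a₀ ∧′ a₂ ⇔′ a₇))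
        · transG-sound false n γ χ (∉-++ˡ (varsG γ) c∉γ) c∉χ s ψ
        · transG-sound false n δ χ (∉-++ʳ (varsG γ) c∉γ) c∉χ s ψ
        · dual γ _ · dual δ _ · choice γ δ _ · dual (γ ∪ δ) _)
    transG-sound true  n (γ ⨾ δ) χ c∉γ c∉χ s ψ = ⇔-trans
      (transG-sound⨾ true n γ δ χ c∉γ c∉χ s ψ) (⇔-sym (compose γ δ _))
    transG-sound false n (γ ⨾ δ) χ c∉γ c∉χ s ψ = begin-equality
      ⟨ G (transG false n (γ ⨾ δ) χ) ⟩ ψ
        ≈⟨ transG-sound⨾ false n γ δ χ c∉γ c∉χ s ψ ⟩
      ⟨ γ ᵈ ⟩ ⟨ δ ᵈ ⟩ ⟨ G χ ⟩ ψ
        ≈⟨ dual γ _ ⟩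
      ~ ⟨ γ ⟩ (~ ⟨ δ ᵈ ⟩ ⟨ G χ ⟩ ψ)
        ≈⟨ ~-cong (dia-cong γ (⇔-trans (~-cong (dual δ _)) (tauto 1 (¬′ ¬′ a₀ ⇔′ a₀)))) ⟩
      ~ ⟨ γ ⟩ ⟨ δ ⟩ (~ ⟨ G χ ⟩ ψ)
        ≈⟨ ~-cong (compose γ δ _) ⟨
      ~ ⟨ γ ⨾ δ ⟩ (~ ⟨ G χ ⟩ ψ)
        ≈⟨ dual (γ ⨾ δ) _ ⟨
      ⟨ (γ ⨾ δ) ᵈ ⟩ ⟨ G χ ⟩ ψ
        ∎
    transG-sound true  n (γ *)   χ c∉γ c∉χ s ψ = loop-star (pos n) _ ψ γ (λ φ → ⟨ G χ ⟩ φ) c∉free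
      (λ φ → ⇔-trans (choice _ _ φ) (∨-cong ⇔-refl
        (transG-sound true (suc n) γ (pvar (pos n)) c∉γ (λ ()) (pvar-scoped n) φ)))
      (λ φ → G-local n χ c∉χ s) (G-independent χ c∉χ ψ)
      where c∉free = All⇒∉ (freeG-⊆ γ (∉⇒All c∉γ))
    transG-sound false n (γ *)   χ c∉γ c∉χ s ψ = begin-equality
      ⟨ coloop (pos n) g ⟩ ψ
        ≈⟨ coloop-dia (pos n) g ψ ⟩
      ~ ⟨ loop (pos n) (g ᵈ) ⟩ (~ ψ)
        -- Dualising `g` turns its conjunction into the disjunction that `loop-star` expects, at the
        -- price of negations around the continuation.
        ≈⟨ ~-cong (loop-star (pos n) (g ᵈ) (~ ψ) γ (λ φ → ~ ⟨ G χ ⟩ (~ φ)) c∉free body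
             (λ φ off → ~-cong (G-local n χ c∉χ s (λ Y≢ → agree-~ (off Y≢))))
             (independent-~ (G-independent χ c∉χ (~ ~ ψ)))) ⟩
      ~ ⟨ γ * ⟩ (~ ⟨ G χ ⟩ (~ ~ ψ))
        ≈⟨ ~-cong (dia-cong _ (~-cong (dia-cong _ (tauto 1 (¬′ ¬′ a₀ ⇔′ a₀))))) ⟩
      ~ ⟨ γ * ⟩ (~ ⟨ G χ ⟩ ψ)
        ≈⟨ dual (γ *) _ ⟨
      ⟨ (γ *) ᵈ ⟩ ⟨ G χ ⟩ ψ
        ∎
      where
      c∉free = All⇒∉ (freeG-⊆ γ (∉⇒All c∉γ))
      ξ = transG false (suc n) γ (pvar (pos n))
      g = G χ ∩ G ξ
      body : ∀ φ → ⊢ ⟨ g ᵈ ⟩ φ ⇔ (~ ⟨ G χ ⟩ (~ φ) ∨ ⟨ γ ⟩ ⟨ set (pos n) ⟩ φ)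
      body φ = tauto 7 ((a₀ ⇔′ ¬′ a₁) ⇒′ (a₁ ⇔′ a₂ ∧′ a₃) ⇒′ (a₃ ⇔′ a₄) ⇒′ (a₄ ⇔′ a₅) ⇒′
                        (¬′ a₅ ⇔′ a₆) ⇒′ (a₀ ⇔′ ¬′ a₂ ∨′ a₆))
        · dual g φ · ∩-dia _ _ (~ φ)
        · transG-sound false (suc n) γ (pvar (pos n)) c∉γ (λ ()) (pvar-scoped n) (~ φ)
        · dia-cong (γ ᵈ) (assign-~ c _ φ) · ~ᵈ γ _
    transG-sound true  n (γ ᵈ)   χ c∉γ c∉χ s ψ = transG-sound false n γ χ c∉γ c∉χ s ψ
    transG-sound false n (γ ᵈ)   χ c∉γ c∉χ s ψ = ⇔-trans (transG-sound true n γ χ c∉γ c∉χ s ψ)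
      (⇔-sym (⇔-trans (dual (γ ᵈ) _) (~ᵈ γ _)))

    transG-sound⨾ : ∀ b n γ δ χ → c ∉ varsG (γ ⨾ δ) → c ∉ varsM χ → Scoped n χ → ∀ ψ →
                    ⊢ ⟨ G (transG b n (γ ⨾ δ) χ) ⟩ ψ ⇔ ⟨ play b γ ⟩ ⟨ play b δ ⟩ ⟨ G χ ⟩ ψ
    transG-sound⨾ b n γ δ χ c∉γδ c∉χ s ψ = ⇔-trans
      (transG-sound b n γ (transG b n δ χ) (∉-++ˡ (varsG γ) c∉γδ)
        (All⇒∉ (transG-vars b n δ χ (∉⇒All (∉-++ʳ (varsG γ) c∉γδ)) (∉⇒All c∉χ)))
        (transG-scoped b n δ χ s) ψ)
      (dia-cong (play b γ) (transG-sound b n δ χ (∉-++ʳ (varsG γ) c∉γδ) c∉χ s ψ))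

    translate-sound : ∀ b φ → c ∉ vars φ → ∀ ψ → ⊢ ⟨ G (translate b φ) ⟩ ψ ⇔ signed b φ
    translate-sound true  (lit p)   c∉ ψ = G-lit p ψ
    translate-sound false (lit p)   c∉ ψ = ⇔-trans (G-lit (coL p) ψ) (coL-lit p)
    translate-sound true  (~ φ)     c∉ ψ = translate-sound false φ c∉ ψ
    translate-sound false (~ φ)     c∉ ψ =
      ⇔-trans (translate-sound true φ c∉ ψ) (tauto 1 (a₀ ⇔′ ¬′ ¬′ a₀))
    translate-sound true  (φ ∨ χ)   c∉ ψ = ⇔-trans (choice _ _ ψ) (∨-cong
      (translate-sound true φ (∉-++ˡ (vars φ) c∉) ψ) (translate-sound true χ (∉-++ʳ (vars φ) c∉) ψ))
    translate-sound false (φ ∨ χ)   c∉ ψ = ⇔-trans (∩-dia _ _ ψ)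
      (tauto 4 ((a₀ ⇔′ ¬′ a₁) ⇒′ (a₂ ⇔′ ¬′ a₃) ⇒′ (a₀ ∧′ a₂ ⇔′ ¬′ (a₁ ∨′ a₃)))
        · translate-sound false φ (∉-++ˡ (vars φ) c∉) ψ
        · translate-sound false χ (∉-++ʳ (vars φ) c∉) ψ)
    translate-sound true  (⟨ γ ⟩ φ) c∉ ψ = ⇔-trans
      (transG-sound true 0 γ _ (∉-++ˡ (varsG γ) c∉)
        (translate-∉ true φ (∉-++ʳ (varsG γ) c∉)) (translate-scoped true φ) ψ)
      (dia-cong γ (translate-sound true φ (∉-++ʳ (varsG γ) c∉) ψ))
    translate-sound false (⟨ γ ⟩ φ) c∉ ψ = ⇔-trans
      (transG-sound false 0 γ _ (∉-++ˡ (varsG γ) c∉)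
        (translate-∉ false φ (∉-++ʳ (varsG γ) c∉)) (translate-scoped false φ) ψ)
      (⇔-trans (dia-cong (γ ᵈ) (translate-sound false φ (∉-++ʳ (varsG γ) c∉) ψ))
      (⇔-trans (dual γ _) (~-cong (dia-cong γ (tauto 1 (¬′ ¬′ a₀ ⇔′ a₀))))))

-- Renaming apart of bound propositional variables

_[_≔_] : (PVar → PVar) → PVar → PVar → PVar → PVar
(r [ X ≔ Y ]) Z with Z ≟ᵖ X
... | yes _ = Y
... | no _  = r Z

width : Mu → ℕ
width (lit p)    = 0
width (pvar X)   = 0
width (φ ∨ᵐ ψ)   = width φ ℕ.+ width ψ
width (φ ∧ᵐ ψ)   = width φ ℕ.+ width ψ
width (⟨ a ⟩ᵐ φ) = width φ
width ([ a ]ᵐ φ) = width φ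
width (μ X φ)    = suc (width φ)
width (ν X φ)    = suc (width φ)

-- Binders receive consecutive names in the order of `binders`; the left operand reserves `width φ`
-- of them. This is how repeated levels of the modal translation, as in disjoint subformulas, become
-- distinct.
apart : (PVar → PVar) → ℕ → Mu → Mu
apart r n (lit p)    = lit p
apart r n (pvar X)   = pvar (r X)
apart r n (φ ∨ᵐ ψ)   = apart r n φ ∨ᵐ apart r (n ℕ.+ width φ) ψ
apart r n (φ ∧ᵐ ψ)   = apart r n φ ∧ᵐ apart r (n ℕ.+ width φ) ψ
apart r n (⟨ a ⟩ᵐ φ) = ⟨ a ⟩ᵐ apart r n φ
apart r n ([ a ]ᵐ φ) = [ a ]ᵐ apart r n φ
apart r n (μ X φ)    = μ (pos n) (apart (r [ X ≔ pos n ]) (suc n) φ)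
apart r n (ν X φ)    = ν (pos n) (apart (r [ X ≔ pos n ]) (suc n) φ)

names : ℕ → ℕ → List PVar
names n zero    = []
names n (suc k) = pos n ∷ names (suc n) k

names-++ : ∀ n j k → names n j ++ names (n ℕ.+ j) k ≡ names n (j ℕ.+ k)
names-++ n zero    k = cong (λ m → names m k) (ℕP.+-identityʳ n)
names-++ n (suc j) k = cong (pos n ∷_)
  (trans (cong (λ m → names (suc n) j ++ names m k) (ℕP.+-suc n j)) (names-++ (suc n) j k))

names-≢ : ∀ {m n} k → m ℕ.< n → All (pos m ≢_) (names n k)
names-≢ zero    m<n = []
names-≢ (suc k) m<n = (λ { refl → ℕP.<-irrefl refl m<n }) ∷ names-≢ k (ℕP.m<n⇒m<1+n m<n)

names-unique : ∀ n k → ListUnique.Unique (names n k)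
names-unique n zero    = []
names-unique n (suc k) = names-≢ k ℕP.≤-refl ∷ names-unique (suc n) k

binders-apart : ∀ r n φ → binders (apart r n φ) ≡ names n (width φ)
binders-apart r n (lit p)    = refl
binders-apart r n (pvar X)   = refl
binders-apart r n (φ ∨ᵐ ψ)   =
  trans (cong₂ _++_ (binders-apart r n φ) (binders-apart r _ ψ)) (names-++ n (width φ) (width ψ))
binders-apart r n (φ ∧ᵐ ψ)   =
  trans (cong₂ _++_ (binders-apart r n φ) (binders-apart r _ ψ)) (names-++ n (width φ) (width ψ))
binders-apart r n (⟨ a ⟩ᵐ φ) = binders-apart r n φ
binders-apart r n ([ a ]ᵐ φ) = binders-apart r n φ
binders-apart r n (μ X φ)    = cong (pos n ∷_) (binders-apart _ (suc n) φ)
binders-apart r n (ν X φ)    = cong (pos n ∷_) (binders-apart _ (suc n) φ)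

varsM-apart : ∀ r n φ → varsM (apart r n φ) ≡ varsM φ
varsM-apart r n (lit p)    = refl
varsM-apart r n (pvar X)   = refl
varsM-apart r n (φ ∨ᵐ ψ)   = cong₂ _++_ (varsM-apart r n φ) (varsM-apart r _ ψ)
varsM-apart r n (φ ∧ᵐ ψ)   = cong₂ _++_ (varsM-apart r n φ) (varsM-apart r _ ψ)
varsM-apart r n (⟨ a ⟩ᵐ φ) = cong (varsAct a ++_) (varsM-apart r n φ)
varsM-apart r n ([ a ]ᵐ φ) = cong (varsAct a ++_) (varsM-apart r n φ)
varsM-apart r n (μ X φ)    = varsM-apart _ (suc n) φ
varsM-apart r n (ν X φ)    = varsM-apart _ (suc n) φ

-- Free variables are sent to names handed out earlier, so that a new binder `pos n` cannot capture
-- them.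
Renames : List (PVar × PVar) → (PVar → PVar) → ℕ → Mu → Set
Renames Γ r n φ = ∀ {X} → X FreeIn φ → X ∼[ Γ ] r X × ∃[ m ] m ℕ.< n × r X ≡ pos m

renames-weaken : ∀ {Γ r m n φ} → m ℕ.≤ n → Renames Γ r m φ → Renames Γ r n φ
renames-weaken m≤n h f with p , k , k<m , eq ← h f = p , k , ℕP.<-≤-trans k<m m≤n , eq

renames-bind : ∀ {Γ r n φ} X → (∀ {Y} → Y ≢ X → Y FreeIn φ → Y ∼[ Γ ] r Y × ∃[ m ] m ℕ.< n × r Y ≡ pos m) →
               Renames ((X , pos n) ∷ Γ) (r [ X ≔ pos n ]) (suc n) φ
renames-bind {n = n} X h {Y} f with Y ≟ᵖ X
... | yes refl = here , n , ℕP.≤-refl , refl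
... | no Y≢X with p , m , m<n , eq ← h Y≢X f =
  there Y≢X (λ eq′ → case trans (sym eq) eq′ of λ { refl → ℕP.<-irrefl refl m<n }) p ,
  m , ℕP.m<n⇒m<1+n m<n , eq

apart-≈ : ∀ {Γ} r n φ → Renames Γ r n φ → Γ ⊢ φ ≈ apart r n φ
apart-≈ r n (lit p)    h = lit
apart-≈ r n (pvar X)   h = pvar (proj₁ (h pvar))
apart-≈ r n (φ ∨ᵐ ψ)   h = or (apart-≈ r n φ (h ∘ ∨ˡ))
  (apart-≈ r _ ψ (renames-weaken (ℕP.m≤m+n n (width φ)) (h ∘ ∨ʳ)))
apart-≈ r n (φ ∧ᵐ ψ)   h = and (apart-≈ r n φ (h ∘ ∧ˡ))
  (apart-≈ r _ ψ (renames-weaken (ℕP.m≤m+n n (width φ)) (h ∘ ∧ʳ)))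
apart-≈ r n (⟨ a ⟩ᵐ φ) h = dia (apart-≈ r n φ (h ∘ dia))
apart-≈ r n ([ a ]ᵐ φ) h = box (apart-≈ r n φ (h ∘ box))
apart-≈ r n (μ X φ)    h = μ (apart-≈ _ (suc n) φ (renames-bind X λ ≢X f → h (μ ≢X f)))
apart-≈ r n (ν X φ)    h = ν (apart-≈ _ (suc n) φ (renames-bind X λ ≢X f → h (ν ≢X f)))

apart-positive : ∀ {Γ} r n φ → Renames Γ r n φ → AllPositive (apart r n φ)
apart-positive r n (lit p)    h = []
apart-positive r n (pvar X)   h with _ , m , _ , eq ← h pvar = subst Positive (sym eq) (pos m) ∷ []
apart-positive r n (φ ∨ᵐ ψ)   h = ++⁺ (apart-positive r n φ (h ∘ ∨ˡ))
  (apart-positive r _ ψ (renames-weaken (ℕP.m≤m+n n (width φ)) (h ∘ ∨ʳ)))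
apart-positive r n (φ ∧ᵐ ψ)   h = ++⁺ (apart-positive r n φ (h ∘ ∧ˡ))
  (apart-positive r _ ψ (renames-weaken (ℕP.m≤m+n n (width φ)) (h ∘ ∧ʳ)))
apart-positive r n (⟨ a ⟩ᵐ φ) h = apart-positive r n φ (h ∘ dia)
apart-positive r n ([ a ]ᵐ φ) h = apart-positive r n φ (h ∘ box)
apart-positive r n (μ X φ)    h =
  pos n ∷ apart-positive _ (suc n) φ (renames-bind X λ ≢X f → h (μ ≢X f))
apart-positive r n (ν X φ)    h =
  pos n ∷ apart-positive _ (suc n) φ (renames-bind X λ ≢X f → h (ν ≢X f))

∁-free : ∀ φ {X} → X FreeIn ∁ φ → co X FreeIn φ
∁-free (lit p)    ()
∁-free (pvar X)   pvar      = subst (_FreeIn pvar X) (sym (co-involutive X)) pvar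
∁-free (φ ∨ᵐ ψ)   (∧ˡ f)    = ∨ˡ (∁-free φ f)
∁-free (φ ∨ᵐ ψ)   (∧ʳ f)    = ∨ʳ (∁-free ψ f)
∁-free (φ ∧ᵐ ψ)   (∨ˡ f)    = ∧ˡ (∁-free φ f)
∁-free (φ ∧ᵐ ψ)   (∨ʳ f)    = ∧ʳ (∁-free ψ f)
∁-free (⟨ a ⟩ᵐ φ) (box f)   = dia (∁-free φ f)
∁-free ([ a ]ᵐ φ) (dia f)   = box (∁-free φ f)
∁-free (μ X φ)    (ν X≢ f)  = μ (λ { refl → X≢ (sym (co-involutive _)) }) (∁-free φ f)
∁-free (ν X φ)    (μ X≢ f)  = ν (λ { refl → X≢ (sym (co-involutive _)) }) (∁-free φ f)

Closed : Mu → Set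
Closed φ = ∀ X → ¬ X FreeIn φ

⇔ᵐ-closed : ∀ {φ ψ} → Closed φ → Closed ψ → Closed (φ ⇔ᵐ ψ)
⇔ᵐ-closed {φ} {ψ} p q X (∧ˡ (∨ˡ f)) = p (co X) (∁-free φ f)
⇔ᵐ-closed {φ} {ψ} p q X (∧ˡ (∨ʳ f)) = q X f
⇔ᵐ-closed {φ} {ψ} p q X (∧ʳ (∨ˡ f)) = q (co X) (∁-free ψ f)
⇔ᵐ-closed {φ} {ψ} p q X (∧ʳ (∨ʳ f)) = p X f

-- The axiom ∇

free-∃ᵐ* : ∀ {n X} (y : Vec Var n) {φ} → X FreeIn ∃ᵐ* y φ → X FreeIn φ
free-∃ᵐ* []      f       = f
free-∃ᵐ* (_ ∷ y) (dia f) = free-∃ᵐ* y f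

free-≔* : ∀ {n X} (x y : Vec Var n) {φ} → X FreeIn (⟨ x ≔* y ⟩ φ) → X FreeIn φ
free-≔* []      []      f       = f
free-≔* (_ ∷ x) (_ ∷ y) (dia f) = free-≔* x y f

norm≤-closed : ∀ {n} (v : Vec Term n) s → Closed (norm≤ v s)
norm≤-closed v s X (∧ˡ ())
norm≤-closed v s X (∧ʳ ())

norm≤·-closed : ∀ {n} (v : Vec Term n) s w → Closed (norm≤· v s w)
norm≤·-closed v s w X (∧ˡ ())
norm≤·-closed v s w X (∧ʳ (∨ˡ ()))
norm≤·-closed v s w X (∧ʳ (∨ʳ ()))

module _ {n} (x : Vec Var (suc n)) .(d : Unique x) (θ : Vec Term (suc n))
         (φ : Mu) (y z u : Vec Var (suc n)) (t M : Var) (X : PVar) where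

  open ∇ x d θ φ y z u t M X

  ρ-free : ∀ {Y} → Y FreeIn ρ → Y ≡ X
  ρ-free (∧ˡ (∧ˡ f)) = contradiction f (norm≤-closed (vars* x) (var M) _)
  ρ-free (∧ˡ (∧ʳ f)) = contradiction f (norm≤-closed (vars* y) (var M) _)
  ρ-free (∧ʳ (∧ˡ f)) with free-∃ᵐ* z f
  ... | ∧ˡ g = contradiction g (norm≤-closed (vars* z) (var M) _)
  ... | ∧ʳ g = contradiction g (norm≤·-closed y-x (var t) (Vec.map (exchangeT* x z) θ) _)
  ρ-free (∧ʳ (∧ʳ (∧ˡ f))) with free-∃ᵐ* z f
  ... | ∧ˡ g = contradiction g (norm≤-closed (vars* z) (var M) _)
  ... | ∧ʳ g = contradiction g (norm≤·-closed
    (const (1ℚ ℚ.+ 1ℚ) ·* (y-x ⊝* (var t ·* θ))) (var t ⊗ var t)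
    (Vec.map (exchangeT* x z) (hat x θ)) _)
  ρ-free (∧ʳ (∧ʳ (∧ʳ f))) with free-∃ᵐ* u f
  ... | dia (∧ˡ g) = case free-≔* y u g of λ { pvar → refl }
  ... | dia (∧ʳ g) = case free-≔* x u g of λ { pvar → refl }

  rhs-closed : Closed φ → Closed rhs
  rhs-closed p Y f with free-∃ᵐ* y f
  ... | ∧ˡ g = p Y (free-≔* x y g)
  ... | ∧ʳ (dia (∧ˡ ()))
  ... | ∧ʳ (dia (∧ʳ (dia (∧ˡ ()))))
  ... | ∧ʳ (dia (∧ʳ (dia (∧ʳ (ν Y≢X g))))) = Y≢X (ρ-free g)

module _ {P : Var → Set} where

  ∃ᵐ*-vars : ∀ {n} (y : Vec Var n) {φ ψ} → (All P (varsM φ) → All P (varsM ψ)) →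
             All P (varsM (∃ᵐ* y φ)) → All P (varsM (∃ᵐ* y ψ))
  ∃ᵐ*-vars []      f p       = f p
  ∃ᵐ*-vars (_ ∷ y) f (p ∷ q) = p ∷ ∃ᵐ*-vars y f q

  ≔*-vars : ∀ {n} (x y : Vec Var n) {φ ψ} → (All P (varsM φ) → All P (varsM ψ)) →
            All P (varsM (⟨ x ≔* y ⟩ φ)) → All P (varsM (⟨ x ≔* y ⟩ ψ))
  ≔*-vars []      []      f p           = f p
  ≔*-vars (_ ∷ x) (_ ∷ y) f (p ∷ q ∷ r) = p ∷ q ∷ ≔*-vars x y f r

  -- Since `ρ` does not mention the postcondition, freshness of `c` can be established for a trivial
  -- one and transferred; `c` has to be chosen before the postcondition is known.
  rhs-vars : ∀ {n} (x : Vec Var (suc n)) .(d : Unique x) θ (y z u : Vec Var (suc n)) t M X {φ ψ} →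
             (All P (varsM φ) → All P (varsM ψ)) →
             All P (varsM (∇.rhs x d θ φ y z u t M X)) → All P (varsM (∇.rhs x d θ ψ y z u t M X))
  rhs-vars x d θ y z u t M X {φ} f = ∃ᵐ*-vars y λ p →
    ++⁺ (≔*-vars x y f (++⁻ˡ (varsM (⟨ x ≔* y ⟩ φ)) p)) (++⁻ʳ (varsM (⟨ x ≔* y ⟩ φ)) p)

κ₀ : PVar → ℕ
κ₀ (pos n) = 2 ℕ.* n
κ₀ (neg n) = suc (2 ℕ.* n)

κ₀-injective : Injective _≡_ _≡_ κ₀
κ₀-injective {pos m} {pos n} eq = cong pos (ℕP.*-cancelˡ-≡ m n 2 eq)
κ₀-injective {neg m} {neg n} eq = cong neg (ℕP.*-cancelˡ-≡ m n 2 (ℕP.suc-injective eq))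
κ₀-injective {pos m} {neg n} eq = contradiction eq (ℕP.even≢odd m n)
κ₀-injective {neg m} {pos n} eq = contradiction (sym eq) (ℕP.even≢odd n m)

∉-⇔ᵐ : ∀ {c} φ ψ → c ∉ varsM φ → c ∉ varsM ψ → c ∉ varsM (φ ⇔ᵐ ψ)
∉-⇔ᵐ {c} φ ψ p q = ∉-++ (varsM (φ ⇒ᵐ ψ))
  (∉-++ (varsM (∁ φ)) (subst (c ∉_) (sym (varsM-∁ φ)) p) q)
  (∉-++ (varsM (∁ ψ)) (subst (c ∉_) (sym (varsM-∁ ψ)) q) p)

-- The axiom speaks about the biconditional with binders renamed apart. `rename-sound` undoes the
-- renaming, and `dual-sound` turns the translated complements inside `⇔ᵐ` into negations.
nabla-⇔ : ∀ {n} (x : Vec Var (suc n)) .(d : Unique x) θ φ (y z u : Vec Var (suc n)) t M X c →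
  let open ∇ x d θ φ y z u t M X ; open Translate κ₀ c ; fresh = t ∷ M ∷ y Vec.++ z Vec.++ u in
  IsFormula φ → Unique fresh → VecAll.All (_∉ varsM lhs) fresh →
  c ∉ varsM lhs → c ∉ varsM rhs → ⊢ ⟨ G lhs ⟩ ⊤ᶠ ⇔ ⟨ G rhs ⟩ ⊤ᶠ
nabla-⇔ x d θ φ y z u t M X c isF uniq fr c∉lhs c∉rhs =
  tauto 5 ((a₀ ⇔′ a₁ ∧′ a₂) ⇒′ (a₁ ⇔′ ¬′ a₃ ∨′ a₄) ⇒′ (a₂ ⇔′ ¬′ a₄ ∨′ a₃) ⇒′ a₀ ⇒′ (a₃ ⇔′ a₄))
  · ∩-dia _ _ ⊤ᶠ
  · ⇔-trans (choice _ _ ⊤ᶠ) (∨-cong (dual-sound lhs c∉lhs ⊤ᶠ ⊤ᶠ (λ f → contradiction f (lhs-closed _))) ⇔-refl)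
  · ⇔-trans (choice _ _ ⊤ᶠ) (∨-cong (dual-sound rhs c∉rhs ⊤ᶠ ⊤ᶠ (λ f → contradiction f (rhs-closed′ _))) ⇔-refl)
  · (⇔-from (rename-sound χ≈χ′ c∉χ c∉χ′ ⊤ᶠ ⊤ᶠ (λ { nil f → ⇔-refl }))
     · nabla (instance∇ x d θ φ y z u t M X isF uniq fr)
         (translation κ₀ c χ≈χ′ (positive-wellFormed _ (apart-positive _ 0 χ renames))
           (subst ListUnique.Unique (sym (binders-apart _ 0 χ)) (names-unique 0 (width χ)))
           κ₀-injective c∉χ′))
  where
  open ∇ x d θ φ y z u t M X
  open Translate κ₀ c
  open Semantics κ₀ κ₀-injective c
  open Invariance κ₀ κ₀-injective c
  lhs-closed : Closed lhs
  lhs-closed X (dia f) = IsFormula.closed isF X f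
  rhs-closed′ : Closed rhs
  rhs-closed′ = rhs-closed x d θ φ y z u t M X (IsFormula.closed isF)
  χ = lhs ⇔ᵐ rhs
  renames : Renames [] id 0 χ
  renames f = contradiction f (⇔ᵐ-closed lhs-closed rhs-closed′ _)
  χ≈χ′ : [] ⊢ χ ≈ apart id 0 χ
  χ≈χ′ = apart-≈ id 0 χ renames
  c∉χ = ∉-⇔ᵐ lhs rhs c∉lhs c∉rhs
  c∉χ′ = subst (c ∉_) (sym (varsM-apart id 0 χ)) c∉χ

-- Tuples of fresh variables

consecutive : ℕ → ∀ k → Vec Var k
consecutive n zero    = []
consecutive n (suc k) = n ∷ consecutive (suc n) k

consecutive-≥ : ∀ {m n} k → m ℕ.≤ n → VecAll.All (m ℕ.≤_) (consecutive n k)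
consecutive-≥ zero    m≤n = []
consecutive-≥ (suc k) m≤n = m≤n ∷ consecutive-≥ k (ℕP.m≤n⇒m≤1+n m≤n)

consecutive-unique : ∀ n k → Unique (consecutive n k)
consecutive-unique n zero    = []
consecutive-unique n (suc k) =
  VecAll.map (λ { n<n refl → ℕP.<-irrefl refl n<n }) (consecutive-≥ k ℕP.≤-refl) ∷
  consecutive-unique (suc n) k

consecutive-++ : ∀ n j k → consecutive n j Vec.++ consecutive (n ℕ.+ j) k ≡ consecutive n (j ℕ.+ k)
consecutive-++ n zero    k = cong (λ m → consecutive m k) (ℕP.+-identityʳ n)
consecutive-++ n (suc j) k = cong (n ∷_)
  (trans (cong (λ m → consecutive (suc n) j Vec.++ consecutive m k) (ℕP.+-suc n j))
         (consecutive-++ (suc n) j k))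

-- Evolutions as discrete games

choose : ∀ {n} → Vec Var n → Game → Game
choose y g = Vec.foldr′ (λ v h → act (v :=*) ⨾ h) g y

copy : ∀ {n} → Vec Var n → Vec Var n → Game
copy x y = Vec.foldr′ (λ a h → act a ⨾ h) (⁇ ⊤ᶠ) (Vec.zipWith (λ xᵢ yᵢ → xᵢ := var yᵢ) x y)

choose-cong : ∀ {n} (y : Vec Var n) {g h φ ψ} → ⊢ ⟨ g ⟩ φ ⇔ ⟨ h ⟩ ψ →
              ⊢ ⟨ choose y g ⟩ φ ⇔ ⟨ choose y h ⟩ ψ
choose-cong []      p = p
choose-cong (v ∷ y) p = ⇔-trans (compose _ _ _)
  (⇔-trans (dia-cong _ (choose-cong y p)) (⇔-sym (compose _ _ _)))

module _ (κ : PVar → ℕ) (c : Var) where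

  open Translate κ c

  G-∃ᵐ* : ∀ {n} (y : Vec Var n) φ → G (∃ᵐ* y φ) ≡ choose y (G φ)
  G-∃ᵐ* []      φ = refl
  G-∃ᵐ* (v ∷ y) φ = cong (act (v :=*) ⨾_) (G-∃ᵐ* y φ)

  G-≔* : ∀ {n} (x y : Vec Var n) χ {φ ψ} → ⊢ ⟨ G χ ⟩ ψ ⇔ φ →
         ⊢ ⟨ G (⟨ x ≔* y ⟩ χ) ⟩ ψ ⇔ ⟨ copy x y ⟩ φ
  G-≔* []      []      χ p = ⇔-trans p (⇔-sym (⇔-trans (test ⊤ᶠ _)
    (tauto 2 (a₀ ⇒′ (a₀ ∧′ a₁ ⇔′ a₁)) · ⊤-intro)))
  G-≔* (v ∷ x) (w ∷ y) χ p = ⇔-trans (compose _ _ _)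
    (⇔-trans (dia-cong _ (G-≔* x y χ p)) (⇔-sym (compose _ _ _)))

module Evolution {n} (x : Vec Var (suc n)) .(d : Unique x) (θ : Vec Term (suc n))
                 (y z u : Vec Var (suc n)) (t M c : Var) where

  new : Vec Var _
  new = t ∷ M ∷ y Vec.++ z Vec.++ u

  module Axiom (χ : Mu) = ∇ x d θ χ y z u t M (pos 0)

  -- The conjunct that all right-hand sides of ∇ share. The postcondition inserted to form `ρ`
  -- disappears by computation.
  reach : Mu
  reach = ∃ᵐ t (0≤ var t ∧ᵐ ∃ᵐ M (lit (neg (var M ≼ const 0ℚ)) ∧ᵐ ν (pos 0) (Axiom.ρ (lit trueᴸ))))

  open Translate κ₀ c

  flow : Fml
  flow = ⟨ G reach ⟩ ⊤ᶠ

  -- Guess an endpoint, test that the flow leads there, and move there. The test precedes the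
  -- copying because it refers to the old values of `x`.
  flowGame : Game
  flowGame = choose y (⁇ flow ⨾ copy x y)

  evolution : Act
  evolution = evolve x d θ trueᶠᵒ

  flowGame-sound : Unique new → VecAll.All (_∉ varsAct evolution) new →
               c ∉ varsM (Axiom.lhs (lit trueᴸ)) → c ∉ varsM (Axiom.rhs (lit trueᴸ)) →
               ∀ φ → All (_∉ free φ) (c ∷ toList new) → ⊢ ⟨ act evolution ⟩ φ ⇔ ⟨ flowGame ⟩ φ
  flowGame-sound uniq new∉a c∉l c∉r φ ∉φ with avoid φ (c ∷ toList new) ∉φ
  ... | φ′ , φ⇔φ′ , _ , c∉ ∷ new∉ = begin-equality
    ⟨ act evolution ⟩ φ             ≈⟨ dia-cong _ φ⇔φ′ ⟩
    ⟨ act evolution ⟩ φ′            ≈⟨ dia-cong _ (translate-sound true φ′ c∉ ⊤ᶠ) ⟨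
    -- The postcondition is now the translation of a dLμ-formula, as ∇ requires.
    ⟨ act evolution ⟩ ⟨ G χ ⟩ ⊤ᶠ    ≈⟨ compose _ _ ⊤ᶠ ⟨
    ⟨ G (Axiom.lhs χ) ⟩ ⊤ᶠ
      ≈⟨ nabla-⇔ x d θ χ y z u t M (pos 0) c (translate-isFormula true φ′)
           uniq new∉lhs c∉lhs c∉rhs ⟩
    ⟨ G (Axiom.rhs χ) ⟩ ⊤ᶠ
      ≡⟨ cong (λ g → ⟨ g ⟩ ⊤ᶠ) (G-∃ᵐ* κ₀ c y _) ⟩
    ⟨ choose y (G (⟨ x ≔* y ⟩ χ ∧ᵐ reach)) ⟩ ⊤ᶠ
      ≈⟨ choose-cong y step ⟩
    ⟨ flowGame ⟩ φ′                     ≈⟨ dia-cong _ φ⇔φ′ ⟨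
    ⟨ flowGame ⟩ φ                      ∎
    where
    open Semantics κ₀ κ₀-injective c
    open Translation κ₀ κ₀-injective c
    χ = translate true φ′
    ∉lhs : ∀ {v} → v ∉ varsAct evolution → v ∉ vars φ′ → v ∉ varsM (Axiom.lhs χ)
    ∉lhs p q = ∉-++ (varsAct evolution) p (translate-∉ true φ′ q)
    new∉lhs : VecAll.All (_∉ varsM (Axiom.lhs χ)) new
    new∉lhs = toList⁻ (All.tabulate λ v∈ →
      ∉lhs (All.lookup (toList⁺ new∉a) v∈) (All.lookup new∉ v∈))
    c∉lhs = ∉lhs (∉-++ˡ (varsAct evolution) c∉l) c∉
    c∉rhs : c ∉ varsM (Axiom.rhs χ)
    c∉rhs = All⇒∉ (rhs-vars x d θ y z u t M (pos 0) (λ _ → ∉⇒All (translate-∉ true φ′ c∉)) (∉⇒All c∉r))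
    step : ⊢ ⟨ G (⟨ x ≔* y ⟩ χ ∧ᵐ reach) ⟩ ⊤ᶠ ⇔ ⟨ ⁇ flow ⨾ copy x y ⟩ φ′
    step = begin-equality
      ⟨ G (⟨ x ≔* y ⟩ χ ∧ᵐ reach) ⟩ ⊤ᶠ      ≈⟨ ∩-dia _ _ ⊤ᶠ ⟩
      ⟨ G (⟨ x ≔* y ⟩ χ) ⟩ ⊤ᶠ ∧ flow
        ≈⟨ ∧-cong (G-≔* κ₀ c x y χ (translate-sound true φ′ c∉ ⊤ᶠ)) ⇔-refl ⟩
      ⟨ copy x y ⟩ φ′ ∧ flow                ≈⟨ tauto 2 (a₀ ∧′ a₁ ⇔′ a₁ ∧′ a₀) ⟩
      flow ∧ ⟨ copy x y ⟩ φ′                ≈⟨ test flow _ ⟨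
      ⟨ ⁇ flow ⟩ ⟨ copy x y ⟩ φ′            ≈⟨ compose _ _ φ′ ⟨
      ⟨ ⁇ flow ⨾ copy x y ⟩ φ′              ∎

-- Validity in ℝ

-- Terms are evaluated pointwise on Cauchy sequences, so polynomial identities over the rationals
-- suffice.
valid-≈ : ∀ s r → (∀ ω n → ⟦ s ⟧ᵀ ω n ≡ ⟦ r ⟧ᵀ ω n) → ⊢ s ≈ᶠ r
valid-≈ s r eq = real {F = lit (pos (s ≐ r))} λ ω ε 0<ε → 0 , λ n _ →
  subst (λ p → ℚ.∣ p ∣ ℚ.≤ ε)
    (sym (trans (cong (ℚ._- ⟦ r ⟧ᵀ ω n) (eq ω n)) (ℚP.+-inverseʳ (⟦ r ⟧ᵀ ω n)))) (ℚP.<⇒≤ 0<ε)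

p≤p+q : ∀ {p q} → 0ℚ ℚ.≤ q → p ℚ.≤ p ℚ.+ q
p≤p+q {p} {q} 0≤q = subst (ℚ._≤ p ℚ.+ q) (ℚP.+-identityʳ p) (ℚP.+-monoʳ-≤ p 0≤q)

valid-≤ : ∀ s r → (∀ ω n → ⟦ s ⟧ᵀ ω n ℚ.≤ ⟦ r ⟧ᵀ ω n) → ⊢ s ≤ᶠ r
valid-≤ s r le = real {F = lit (pos (s ≼ r))} λ ω ε 0<ε → 0 , λ n _ →
  ℚP.≤-trans (le ω n) (p≤p+q (ℚP.<⇒≤ 0<ε))

entails : ∀ a b → (∀ ω → ⟦ a ⟧ᴬ ω → ⟦ b ⟧ᴬ ω) → ⊢ lit (pos a) ⇒ lit (pos b)
entails a b f = real {F = ~ lit (pos a) ∨ lit (pos b)} λ ω (p , q) → p λ h → q (f ω h)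

entails₂ : ∀ a b c → (∀ ω → ⟦ a ⟧ᴬ ω → ⟦ b ⟧ᴬ ω → ⟦ c ⟧ᴬ ω) →
           ⊢ lit (pos a) ⇒ lit (pos b) ⇒ lit (pos c)
entails₂ a b c f = real {F = ~ lit (pos a) ∨ ~ lit (pos b) ∨ lit (pos c)} λ ω (p , q) →
  p λ h → q λ (p′ , q′) → p′ λ h′ → q′ (f ω h h′)

-- With |k| at most 2, precision ε/2 in the premise gives ε in the conclusion.
scaled-≈ : ∀ k s r s′ r′ → ℚ.∣ k ∣ ℚ.≤ 1ℚ ℚ.+ 1ℚ →
  (∀ ω n → ⟦ s′ ⟧ᵀ ω n ℚ.- ⟦ r′ ⟧ᵀ ω n ≡ k ℚ.* (⟦ s ⟧ᵀ ω n ℚ.- ⟦ r ⟧ᵀ ω n)) → ⊢ s ≈ᶠ r ⇒ s′ ≈ᶠ r′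
scaled-≈ k s r s′ r′ k≤2 eq = entails (s ≐ r) (s′ ≐ r′) λ ω h ε 0<ε →
  let N , le = h (½ ℚ.* ε) (0<½* 0<ε) in N , λ n N≤n →
  let δ = ⟦ s ⟧ᵀ ω n ℚ.- ⟦ r ⟧ᵀ ω n in
  subst₂ ℚ._≤_ (sym (trans (cong ℚ.∣_∣ (eq ω n)) (ℚP.∣p*q∣≡∣p∣*∣q∣ k δ)))
    (solve 1 (λ ε → con (1ℚ ℚ.+ 1ℚ) :* (con ½ :* ε) :≡ ε) refl ε)
    (ℚP.≤-trans
      (ℚP.*-monoʳ-≤-nonNeg ℚ.∣ δ ∣ {{ℚ.nonNegative (ℚP.0≤∣p∣ δ)}} k≤2)
      (ℚP.*-monoˡ-≤-nonNeg (1ℚ ℚ.+ 1ℚ) (le n N≤n)))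

0≤p*p : ∀ p → 0ℚ ℚ.≤ p ℚ.* p
0≤p*p p = subst (0ℚ ℚ.≤_) eq (ℚP.nonNegative⁻¹ _ {{ℚP.nonNeg*nonNeg⇒nonNeg ∣p∣ {{nn}} ∣p∣ {{nn}}}})
  where
  ∣p∣ = ℚ.∣ p ∣
  nn = ℚ.nonNegative (ℚP.0≤∣p∣ p)
  eq : ∣p∣ ℚ.* ∣p∣ ≡ p ℚ.* p
  eq with ℚP.∣p∣≡p∨∣p∣≡-p p
  ... | inj₁ e rewrite e = refl
  ... | inj₂ e rewrite e = solve 1 (λ p → (:- p) :* (:- p) :≡ p :* p) refl p

-- The shape in which inequalities reach the ring solver: the difference of the sides is written as
-- a sum of quantities known to be nonnegative.
≤-gap : ∀ {p q} r → 0ℚ ℚ.≤ r → q ≡ p ℚ.+ r → p ℚ.≤ q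
≤-gap r 0≤r refl = p≤p+q 0≤r

gap : ∀ {p q} → p ℚ.≤ q → 0ℚ ℚ.≤ q ℚ.- p
gap {p} {q} p≤q = subst (ℚ._≤ q ℚ.- p) (ℚP.+-inverseʳ p) (ℚP.+-monoˡ-≤ (ℚ.- p) p≤q)

infixl 6 _⊞_

_⊞_ : ∀ {p q} → 0ℚ ℚ.≤ p → 0ℚ ℚ.≤ q → 0ℚ ℚ.≤ p ℚ.+ q
_⊞_ = ℚP.+-mono-≤

0≤½* : ∀ {p} → 0ℚ ℚ.≤ p → 0ℚ ℚ.≤ ½ ℚ.* p
0≤½* = ℚP.*-monoˡ-≤-nonNeg ½

p≤∣p∣ : ∀ p → p ℚ.≤ ℚ.∣ p ∣
p≤∣p∣ p with ℚP.≤-total 0ℚ p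
... | inj₁ 0≤p = ℚP.≤-reflexive (sym (ℚP.0≤p⇒∣p∣≡p 0≤p))
... | inj₂ p≤0 = ℚP.≤-trans p≤0 (ℚP.0≤∣p∣ p)

-- Near the limit d of y − v, either d ≥ −ε/2 or d < 0.
sign-cases : ∀ v y → ⊢ (const 0ℚ ≤ᶠ const 1ℚ ⊗ (var y ⊝ var v)) ∨
                       (const 0ℚ ≤ᶠ const (ℚ.- 1ℚ) ⊗ (var y ⊝ var v))
sign-cases v y = real {F = lit (pos (const 0ℚ ≼ const 1ℚ ⊗ (var y ⊝ var v))) ∨
                           lit (pos (const 0ℚ ≼ const (ℚ.- 1ℚ) ⊗ (var y ⊝ var v)))} valid
  where
  valid : Valid (lit (pos (const 0ℚ ≼ const 1ℚ ⊗ (var y ⊝ var v))) ∨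
                 lit (pos (const 0ℚ ≼ const (ℚ.- 1ℚ) ⊗ (var y ⊝ var v))))
  valid ω (¬P , ¬Q) = ¬P λ ε 0<ε →
    -- A quarter of ε for each of the two sequences, so that their difference moves by at most ε/2
    -- after stage `N`.
    let δ = ½ ℚ.* (½ ℚ.* ε)
        0<δ = 0<½* (0<½* 0<ε)
        N₁ , h₁ = ℝ.cauchy (ω y) δ 0<δ
        N₂ , h₂ = ℝ.cauchy (ω v) δ 0<δ
        N = N₁ ℕ.⊔ N₂
        N₁≤ = ℕP.m≤m⊔n N₁ N₂
        N₂≤ = ℕP.m≤n⊔m N₁ N₂
        close₁ = λ m n (N≤m : N ℕ.≤ m) (N≤n : N ℕ.≤ n) → gap (ℚP.≤-trans (p≤∣p∣ (a m ℚ.- a n))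
          (h₁ m n (ℕP.≤-trans N₁≤ N≤m) (ℕP.≤-trans N₁≤ N≤n)))
        close₂ = λ m n (N≤m : N ℕ.≤ m) (N≤n : N ℕ.≤ n) → gap (ℚP.≤-trans (p≤∣p∣ (b m ℚ.- b n))
          (h₂ m n (ℕP.≤-trans N₂≤ N≤m) (ℕP.≤-trans N₂≤ N≤n)))
    in case ℚP.≤-total 0ℚ ((a N ℚ.- b N) ℚ.+ ½ ℚ.* ε) of λ where
      (inj₁ 0≤d) → N , λ n N≤n →
        ≤-gap _ (0≤d ⊞ close₁ N n ℕP.≤-refl N≤n ⊞ close₂ n N N≤n ℕP.≤-refl)
          (solve 5 (λ aₙ bₙ aN bN ε →
            con 1ℚ :* (aₙ :+ :- bₙ) :+ ε :≡ con 0ℚ :+ ((((aN :- bN) :+ con ½ :* ε)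
              :+ (con ½ :* (con ½ :* ε) :- (aN :- aₙ))) :+ (con ½ :* (con ½ :* ε) :- (bₙ :- bN))))
            refl (a n) (b n) (a N) (b N) ε)
      -- At stage `N` the difference is at most -ε/2, hence it is never positive afterwards,
      -- whatever ε′ is asked for.
      (inj₂ d≤0) → contradiction (λ ε′ 0<ε′ → N , λ n N≤n →
        ≤-gap _ (gap d≤0 ⊞ close₁ n N N≤n ℕP.≤-refl ⊞ close₂ N n ℕP.≤-refl N≤n ⊞ ℚP.<⇒≤ 0<ε′)
          (solve 6 (λ aₙ bₙ aN bN ε ε′ →
            con (ℚ.- 1ℚ) :* (aₙ :+ :- bₙ) :+ ε′ :≡
            con 0ℚ :+ ((((con 0ℚ :- ((aN :- bN) :+ con ½ :* ε))
              :+ (con ½ :* (con ½ :* ε) :- (aₙ :- aN))) :+ (con ½ :* (con ½ :* ε) :- (bN :- bₙ))) :+ ε′))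
            refl (a n) (b n) (a N) (b N) ε ε′)) ¬Q
    where
    a = ℝ.approx (ω y)
    b = ℝ.approx (ω v)

≤-half : ∀ s → ⊢ const 0ℚ ≤ᶠ s ⇒ const 0ℚ ≤ᶠ const ½ ⊗ s
≤-half s = entails (const 0ℚ ≼ s) (const 0ℚ ≼ const ½ ⊗ s) λ ω h ε 0<ε →
  let N , le = h ε 0<ε in N , λ n N≤n →
  ≤-gap _ (0≤½* (le n N≤n) ⊞ 0≤½* (ℚP.<⇒≤ 0<ε))
    (solve 2 (λ s ε → con ½ :* s :+ ε :≡ con 0ℚ :+ (con ½ :* (s :+ ε) :+ con ½ :* ε))
      refl (⟦ s ⟧ᵀ ω n) ε)

midpoint : Term → Term → Term
midpoint s r = const ½ ⊗ (s ⊕ r)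

-- The form that ‖_‖² takes on a one-element tuple.
square : Term → Term
square s = s ⊗ s ⊕ const 0ℚ

-- (s + r)²/4 + (s − r)²/4 = s²/2 + r²/2
square-midpoint : ∀ s r p →
  ⊢ square s ≤ᶠ p ⇒ square r ≤ᶠ p ⇒ square (midpoint s r) ≤ᶠ p
square-midpoint s r p =
  entails₂ (square s ≼ p) (square r ≼ p) (square (midpoint s r) ≼ p) λ ω h h′ ε 0<ε →
  let N , le = h ε 0<ε ; N′ , le′ = h′ ε 0<ε in N ℕ.⊔ N′ , λ n N≤n →
  let a = ⟦ s ⟧ᵀ ω n ; b = ⟦ r ⟧ᵀ ω n in
  ≤-gap _ (0≤½* (gap (le n (ℕP.≤-trans (ℕP.m≤m⊔n N N′) N≤n)))
           ⊞ 0≤½* (gap (le′ n (ℕP.≤-trans (ℕP.m≤n⊔m N N′) N≤n)))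
           ⊞ 0≤p*p (½ ℚ.* (a ℚ.- b)))
    (solve 4 (λ a b p ε → p :+ ε :≡ ((con ½ :* (a :+ b)) :* (con ½ :* (a :+ b)) :+ con 0ℚ) :+
       ((con ½ :* ((p :+ ε) :- (a :* a :+ con 0ℚ)) :+ con ½ :* ((p :+ ε) :- (b :* b :+ con 0ℚ)))
        :+ (con ½ :* (a :- b)) :* (con ½ :* (a :- b))))
      refl a b (⟦ p ⟧ᵀ ω n) ε)

-- `C` is a term context given as a function; commuting with substitution is what makes it one.
square-cong : ∀ (C : Term → Term) → (∀ w θ → substT w θ (C (var w)) ≡ C θ) →
              ∀ s r p → ⊢ s ≈ᶠ r ⇒ square (C s) ≤ᶠ p ⇒ square (C r) ≤ᶠ p
square-cong C C-subst s r p = ≐-subst s r (at s) (at r)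
  where
  w = above (varsT p)
  at : ∀ θ → (square (C (var w)) ≤ᶠ p) [ θ / w ] (square (C θ) ≤ᶠ p)
  at θ = subst₂ (λ t q → (square (C (var w)) ≤ᶠ p) [ θ / w ] (square t ≤ᶠ q))
    (C-subst w θ) (substT-fresh θ p (above∉ (varsT p))) lit

-- The evolution x′ = q for q = ±1

-- With `rate`, what `norm≤` and `norm≤·` say about one-element tuples once their games are decoded.
norm : Term → Term → Fml
norm a m = const 0ℚ ≤ᶠ m ∧ square a ≤ᶠ m ⊗ m

rate : Term → Term → Term → Fml
rate a s w = square a ≤ᶠ s ⊗ s ⊗ square w ∧ (const 0ℚ ≤ᶠ s ∨ square w ≈ᶠ const 0ℚ)

module _ (κ : PVar → ℕ) (κ-injective : Injective _≡_ _≡_ κ) (c : Var) where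

  open Translate κ c
  open Semantics κ κ-injective c
  open Invariance κ κ-injective c using (agree-~)

  -- Coinduction for the encoded ν, obtained from `set-exit-least` for the complement. Of the
  -- intermediate condition `χ` only its value at the bound variable is revealed.
  coloop-greatest : ∀ X g ψ {φ} → Independent φ →
    (∀ χ → ⊢ ⟨ set X ⟩ χ ⇔ φ → ⊢ φ ⇒ ⟨ g ⟩ χ) → ⊢ φ ⇒ ⟨ coloop X g ⟩ ψ
  coloop-greatest X g ψ {φ} ind h =
    tauto 4 ((a₀ ⇒′ ¬′ a₁) ⇒′ (a₂ ⇔′ a₀) ⇒′ (a₃ ⇔′ ¬′ a₂) ⇒′ a₁ ⇒′ a₃)
    · set-exit-least X (g ᵈ) (~ ψ) (independent-~ ind)
        (tauto 3 ((a₂ ⇔′ ¬′ a₁) ⇒′ (a₀ ⇒′ a₁) ⇒′ a₂ ⇒′ ¬′ a₀)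
          · dual g _ · h (~ invariant X (~ ψ) (~ φ)) at)
    · loop-dia X (g ᵈ) (~ ψ) · coloop-dia X g ψ
    where
    at : ⊢ ⟨ set X ⟩ (~ invariant X (~ ψ) (~ φ)) ⇔ φ
    at = begin-equality
      ⟨ set X ⟩ (~ invariant X (~ ψ) (~ φ))  ≈⟨ assign-~ c _ _ ⟩
      ~ ⟨ set X ⟩ invariant X (~ ψ) (~ φ)    ≈⟨ ~-cong (set-same X ⇔-refl) ⟩
      ~ ⟨ set X ⟩ (~ φ)                      ≈⟨ ~-cong (set-independent X (independent-~ ind)) ⟩
      ~ ~ φ                                  ≈⟨ tauto 1 (¬′ ¬′ a₀ ⇔′ a₀) ⟩
      φ                                      ∎

  G-norm≤ : ∀ a m ψ → ⊢ ⟨ G (norm≤ (a ∷ []) m) ⟩ ψ ⇔ norm a m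
  G-norm≤ a m ψ = ⇔-trans (∩-dia _ _ ψ) (∧-cong (G-lit _ ψ) (G-lit _ ψ))

  G-norm≤· : ∀ a s w ψ → ⊢ ⟨ G (norm≤· (a ∷ []) s (w ∷ [])) ⟩ ψ ⇔ rate a s w
  G-norm≤· a s w ψ = ⇔-trans (∩-dia _ _ ψ)
    (∧-cong (G-lit _ ψ) (⇔-trans (choice _ _ ψ) (∨-cong (G-lit _ ψ) (G-lit _ ψ))))

norm-subst : ∀ {x θ a a′ m m′} → substT x θ a ≡ a′ → substT x θ m ≡ m′ →
             norm a m [ θ / x ] norm a′ m′
norm-subst refl refl = ∧-subst lit lit

module LinearFlow (q : ℚ) (q²≡1 : q ℚ.* q ≡ 1ℚ) (v y z u t M c : Var)
                  (distinct : ListUnique.Unique (v ∷ t ∷ M ∷ y ∷ z ∷ u ∷ c ∷ [])) where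

  open Evolution (v ∷ []) ([] ∷ []) (const q ∷ []) (y ∷ []) (z ∷ []) (u ∷ []) t M c
  open Translate κ₀ c
  open Semantics κ₀ κ₀-injective c

  ahead : Fml
  ahead = const 0ℚ ≤ᶠ const q ⊗ (var y ⊝ var v)

  -- Abstract in the start, end, duration and bound, so that the assignments in `ρ` merely change
  -- its arguments.
  inv : Term → Term → Term → Term → Fml
  inv a b s m = s ⊗ const q ≈ᶠ b ⊝ a ∧ const 0ℚ ≤ᶠ s ∧ norm a m ∧ norm b m

  inv-subst : ∀ {x θ a a′ b b′ s s′ m m′} → substT x θ a ≡ a′ → substT x θ b ≡ b′ →
              substT x θ s ≡ s′ → substT x θ m ≡ m′ → inv a b s m [ θ / x ] inv a′ b′ s′ m′
  inv-subst refl refl refl refl =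
    ∧-subst lit (∧-subst lit (∧-subst (norm-subst refl refl) (norm-subst refl refl)))

  I : Fml
  I = inv (var v) (var y) (var t) (var M)

  distance : Term
  distance = var y ⊝ var v

  error : Term
  error = const (1ℚ ℚ.+ 1ℚ) ⊗ (distance ⊝ var t ⊗ const q)

  -- The single entry of `hat` for the constant right-hand side `q`, exactly as it computes:
  -- derivative zero times `q`, summed.
  acceleration : Term
  acceleration = const 0ℚ ⊗ const q ⊕ const 0ℚ

  halves : Fml
  halves = ⟨ act (t := (const ½ ⊗ var t)) ⟩ (⟨ act (y := var u) ⟩ I ∧ ⟨ act (v := var u) ⟩ I)

  step : Fml
  step = (norm (var v) (var M) ∧ norm (var y) (var M))
    ∧ ⟨ act (z :=*) ⟩ (norm (var z) (var M) ∧ rate distance (var t) (const q))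
    ∧ ⟨ act (z :=*) ⟩ (norm (var z) (var M) ∧ rate error (var t ⊗ var t) acceleration)
    ∧ ⟨ act (u :=*) ⟩ halves

  ρ-dia : ∀ χ → ⊢ ⟨ set (pos 0) ⟩ χ ⇔ I → ⊢ ⟨ G (Axiom.ρ (lit trueᴸ)) ⟩ χ ⇔ step
  ρ-dia χ p = ⇔-trans (∩-dia _ _ χ) (∧-cong
    (⇔-trans (∩-dia _ _ χ) (∧-cong (G-norm≤ κ₀ κ₀-injective c _ _ χ) (G-norm≤ κ₀ κ₀-injective c _ _ χ)))
    (⇔-trans (∩-dia _ _ χ) (∧-cong (bounded distance (var t) (const q))
      (⇔-trans (∩-dia _ _ χ) (∧-cong (bounded error (var t ⊗ var t) acceleration)
        (⇔-trans (compose _ _ χ) (dia-cong _ (⇔-trans (compose _ _ χ) (dia-cong _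
          (⇔-trans (∩-dia _ _ χ) (∧-cong
            (⇔-trans (compose _ _ χ) (dia-cong _ p))
            (⇔-trans (compose _ _ χ) (dia-cong _ p)))))))))))))
    where
    bounded : ∀ a s w → ⊢ ⟨ G (∃ᵐ z (norm≤ (var z ∷ []) (var M) ∧ᵐ norm≤· (a ∷ []) s (w ∷ []))) ⟩ χ ⇔
                          ⟨ act (z :=*) ⟩ (norm (var z) (var M) ∧ rate a s w)
    bounded a s w = ⇔-trans (compose _ _ χ) (dia-cong _ (⇔-trans (∩-dia _ _ χ)
      (∧-cong (G-norm≤ κ₀ κ₀-injective c _ _ χ) (G-norm≤· κ₀ κ₀-injective c a s w χ))))

  private
    v≢ : All (v ≢_) (t ∷ M ∷ y ∷ z ∷ u ∷ c ∷ [])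
    v≢ = AllPairs.head distinct
    t≢ : All (t ≢_) (M ∷ y ∷ z ∷ u ∷ c ∷ [])
    t≢ = AllPairs.head (AllPairs.tail distinct)
    M≢ : All (M ≢_) (y ∷ z ∷ u ∷ c ∷ [])
    M≢ = AllPairs.head (AllPairs.tail (AllPairs.tail distinct))
    y≢ : All (y ≢_) (z ∷ u ∷ c ∷ [])
    y≢ = AllPairs.head (AllPairs.tail (AllPairs.tail (AllPairs.tail distinct)))
    v≢y = All.lookup v≢ (there (there (here refl)))
    v≢z = All.lookup v≢ (there (there (there (here refl))))
    v≢u = All.lookup v≢ (there (there (there (there (here refl)))))
    v≢t = All.lookup v≢ (here refl)
    v≢M = All.lookup v≢ (there (here refl))
    v≢c = All.lookup v≢ (there (there (there (there (there (here refl))))))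
    y≢z = All.lookup y≢ (here refl)
    y≢u = All.lookup y≢ (there (here refl))
    y≢t = ≢-sym (All.lookup t≢ (there (here refl)))
    y≢M = ≢-sym (All.lookup M≢ (here refl))
    y≢c = All.lookup y≢ (there (there (here refl)))
    z≢t = ≢-sym (All.lookup t≢ (there (there (here refl))))
    z≢M = ≢-sym (All.lookup M≢ (there (here refl)))
    u≢t = ≢-sym (All.lookup t≢ (there (there (there (here refl)))))
    u≢M = ≢-sym (All.lookup M≢ (there (there (here refl))))
    t≢M = All.lookup t≢ (here refl)
    t≢c = All.lookup t≢ (there (there (there (there (here refl)))))
    M≢c = All.lookup M≢ (there (there (there (here refl))))

  distance-rate : ⊢ var t ⊗ const q ≈ᶠ distance ⇒
                    square distance ≤ᶠ var t ⊗ var t ⊗ square (const q)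
  distance-rate = tauto 3 ((a₀ ⇒′ a₁ ⇒′ a₂) ⇒′ a₁ ⇒′ a₀ ⇒′ a₂)
    · square-cong id substT-same (var t ⊗ const q) distance (var t ⊗ var t ⊗ square (const q))
    · valid-≤ _ _ λ ω n → ℚP.≤-reflexive
        (solve 2 (λ t q → (t :* q) :* (t :* q) :+ con 0ℚ :≡ t :* t :* (q :* q :+ con 0ℚ)) refl
          (ℝ.approx (ω t) n) q)

  -- Under the invariant the second-order error is zero, and the right-hand side is a square. The
  -- claim is proved with 0 in place of the error and transported along the equality.
  error-rate : ⊢ var t ⊗ const q ≈ᶠ distance ⇒
                 square error ≤ᶠ (var t ⊗ var t) ⊗ (var t ⊗ var t) ⊗ square acceleration
  error-rate = tauto 4 ((a₀ ⇒′ a₁) ⇒′ (a₁ ⇒′ a₂ ⇒′ a₃) ⇒′ a₂ ⇒′ a₀ ⇒′ a₃)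
    · scaled-≈ 1ℚ (var t ⊗ const q) distance (const 0ℚ) (distance ⊝ var t ⊗ const q)
        (from-yes (1ℚ ℚP.≤? 1ℚ ℚ.+ 1ℚ)) (λ ω n →
          solve 2 (λ s d → con 0ℚ :- (d :+ :- s) :≡ con 1ℚ :* (s :- d)) refl
            (ℝ.approx (ω t) n ℚ.* q) (⟦ distance ⟧ᵀ ω n))
    · square-cong (const (1ℚ ℚ.+ 1ℚ) ⊗_) (λ w θ → cong (const (1ℚ ℚ.+ 1ℚ) ⊗_) (substT-same w θ))
        (const 0ℚ) (distance ⊝ var t ⊗ const q) _
    · valid-≤ _ _ λ ω n → let t = ℝ.approx (ω t) n ; h = ⟦ acceleration ⟧ᵀ ω n in
        subst (0ℚ ℚ.≤_)
          (solve 2 (λ t h → (t :* t :* h) :* (t :* t :* h) :≡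
                            (t :* t) :* (t :* t) :* (h :* h :+ con 0ℚ)) refl t h)
          (0≤p*p (t ℚ.* t ℚ.* h))

  mid : Term
  mid = midpoint (var v) (var y)

  half : Term
  half = const ½ ⊗ var t

  first-half : ⊢ var t ⊗ const q ≈ᶠ distance ⇒ half ⊗ const q ≈ᶠ mid ⊝ var v
  first-half = scaled-≈ ½ (var t ⊗ const q) distance (half ⊗ const q) (mid ⊝ var v)
    (from-yes (½ ℚP.≤? 1ℚ ℚ.+ 1ℚ)) λ ω n →
      solve 4 (λ t q v y → con ½ :* t :* q :- (con ½ :* (v :+ y) :+ :- v) :≡
                           con ½ :* (t :* q :- (y :+ :- v))) refl
        (ℝ.approx (ω t) n) q (ℝ.approx (ω v) n) (ℝ.approx (ω y) n)

  second-half : ⊢ var t ⊗ const q ≈ᶠ distance ⇒ half ⊗ const q ≈ᶠ var y ⊝ mid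
  second-half = scaled-≈ ½ (var t ⊗ const q) distance (half ⊗ const q) (var y ⊝ mid)
    (from-yes (½ ℚP.≤? 1ℚ ℚ.+ 1ℚ)) λ ω n →
      solve 4 (λ t q v y → con ½ :* t :* q :- (y :+ :- (con ½ :* (v :+ y))) :≡
                           con ½ :* (t :* q :- (y :+ :- v))) refl
        (ℝ.approx (ω t) n) q (ℝ.approx (ω v) n) (ℝ.approx (ω y) n)

  halves-⇔ : ⊢ halves ⇔ (inv (var v) (var u) half (var M) ∧ inv (var u) (var y) half (var M))
  halves-⇔ = ⇔-trans
    (dia-cong _ (∧-cong
      (assign-subst y (var u) (inv-subst (substT-other _ v≢y) (substT-same y _)
        (substT-other _ (≢-sym y≢t)) (substT-other _ (≢-sym y≢M))))
      (assign-subst v (var u) (inv-subst (substT-same v _) (substT-other _ (≢-sym v≢y))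
        (substT-other _ (≢-sym v≢t)) (substT-other _ (≢-sym v≢M))))))
    (assign-subst t half (∧-subst
      (inv-subst (substT-other _ v≢t) (substT-other _ u≢t) (substT-same t _) (substT-other _ (≢-sym t≢M)))
      (inv-subst (substT-other _ u≢t) (substT-other _ y≢t) (substT-same t _) (substT-other _ (≢-sym t≢M)))))

  -- At constant speed the midpoint is reached after half the time, and it stays within the bound
  -- because a ball is convex.
  split : ⊢ I ⇒ inv (var v) mid half (var M) ∧ inv mid (var y) half (var M)
  split = tauto 9 ((a₀ ⇒′ a₅) ⇒′ (a₀ ⇒′ a₆) ⇒′ (a₁ ⇒′ a₇) ⇒′ (a₃ ⇒′ a₄ ⇒′ a₈) ⇒′
      (a₀ ∧′ a₁ ∧′ (a₂ ∧′ a₃) ∧′ (a₂ ∧′ a₄)) ⇒′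
      (a₅ ∧′ a₇ ∧′ (a₂ ∧′ a₃) ∧′ (a₂ ∧′ a₈)) ∧′ (a₆ ∧′ a₇ ∧′ (a₂ ∧′ a₈) ∧′ (a₂ ∧′ a₄)))
    · first-half · second-half · ≤-half (var t) · square-midpoint (var v) (var y) (var M ⊗ var M)

  ∃-halves : ⊢ I ⇒ ⟨ act (u :=*) ⟩ halves
  ∃-halves = begin
    I
      ≲⟨ split ⟩
    inv (var v) mid half (var M) ∧ inv mid (var y) half (var M)
      ≲⟨ ∃-intro mid (∧-subst
           (inv-subst (substT-other _ v≢u) (substT-same u _) half-u (substT-other _ (≢-sym u≢M)))
           (inv-subst (substT-same u _) (substT-other _ y≢u) half-u (substT-other _ (≢-sym u≢M)))) ⟩
    ⟨ act (u :=*) ⟩ (inv (var v) (var u) half (var M) ∧ inv (var u) (var y) half (var M))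
      ≈⟨ dia-cong _ halves-⇔ ⟨
    ⟨ act (u :=*) ⟩ halves
      ∎
    where
    half-u : substT u mid half ≡ half
    half-u = cong (const ½ ⊗_) (substT-other _ (≢-sym u≢t))

  -- The point `z` at which ∇ evaluates the right-hand side may be any point of the ball, here `v`,
  -- since a constant right-hand side does not depend on it.
  ∃-bounded : ∀ a s w → z ∉ free (rate a s w) →
              ⊢ norm (var v) (var M) ∧ rate a s w ⇒
                ⟨ act (z :=*) ⟩ (norm (var z) (var M) ∧ rate a s w)
  ∃-bounded a s w z∉ = ∃-intro (var v)
    (∧-subst (norm-subst (substT-same z _) (substT-other _ (≢-sym z≢M))) (nonfree z∉))

  I-step : ⊢ I ⇒ step
  I-step = tauto 7 ((a₀ ∧′ a₁ ∧′ a₂ ∧′ a₃ ⇒′ a₄) ⇒′ (a₀ ∧′ a₁ ∧′ a₂ ∧′ a₃ ⇒′ a₅) ⇒′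
                    (a₀ ∧′ a₁ ∧′ a₂ ∧′ a₃ ⇒′ a₆) ⇒′
                    a₀ ∧′ a₁ ∧′ a₂ ∧′ a₃ ⇒′ (a₂ ∧′ a₃) ∧′ a₄ ∧′ a₅ ∧′ a₆)
    · (tauto 7 ((a₀ ⇒′ a₄) ⇒′ (a₂ ∧′ a₄ ∧′ (a₁ ∨′ a₅) ⇒′ a₆) ⇒′ a₀ ∧′ a₁ ∧′ a₂ ∧′ a₃ ⇒′ a₆)
        · distance-rate · ∃-bounded distance (var t) (const q) (All⇒∉
            (z≢y ∷ z≢v ∷ z≢y ∷ z≢v ∷ z≢t ∷ z≢t ∷ z≢t ∷ [])))
    · (tauto 8 ((a₀ ⇒′ a₄) ⇒′ a₇ ⇒′ (a₂ ∧′ a₄ ∧′ (a₇ ∨′ a₅) ⇒′ a₆) ⇒′ a₀ ∧′ a₁ ∧′ a₂ ∧′ a₃ ⇒′ a₆)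
        · error-rate · valid-≤ (const 0ℚ) (var t ⊗ var t) (λ ω n → 0≤p*p (ℝ.approx (ω t) n))
        · ∃-bounded error (var t ⊗ var t) acceleration (All⇒∉
            (z≢y ∷ z≢v ∷ z≢t ∷ z≢y ∷ z≢v ∷ z≢t ∷ z≢t ∷ z≢t ∷ z≢t ∷ z≢t ∷ z≢t ∷ z≢t ∷ [])))
    · ∃-halves
    where
    z≢y = ≢-sym y≢z
    z≢v = ≢-sym v≢z

  -- Witnesses for `t` and `M`. As q² = 1, the solution of t q = y - v is q (y - v). The bound 1 +
  -- v² + y² is positive and dominates |v| and |y|, yet is a polynomial.
  time bound : Term
  time  = const q ⊗ distance
  bound = const 1ℚ ⊕ var v ⊗ var v ⊕ var y ⊗ var y

  reached : Term → Term → Fml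
  reached s m = lit (neg (m ≼ const 0ℚ)) ∧ inv (var v) (var y) s m

  reached-subst : ∀ {x θ s s′ m m′} → v ≢ x → y ≢ x → substT x θ s ≡ s′ → substT x θ m ≡ m′ →
                  reached s m [ θ / x ] reached s′ m′
  reached-subst v≢x y≢x refl refl =
    ∧-subst lit (inv-subst (substT-other _ v≢x) (substT-other _ y≢x) refl refl)

  time-≈ : ⊢ time ⊗ const q ≈ᶠ distance
  time-≈ = valid-≈ _ _ λ ω n → let d = ⟦ distance ⟧ᵀ ω n in
    trans (solve 2 (λ q d → q :* d :* q :≡ q :* q :* d) refl q d)
      (trans (cong (ℚ._* d) q²≡1) (ℚP.*-identityˡ d))

  bound-> : ⊢ lit (neg (bound ≼ const 0ℚ))
  bound-> = real {F = lit (neg (bound ≼ const 0ℚ))} λ ω h →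
    -- `bound` is at least 1 in every approximation, so precision ½ refutes `bound ≼ 0`.
    let N , le = h ½ (from-yes (0ℚ ℚP.<? ½))
        a = ℝ.approx (ω v) N ; b = ℝ.approx (ω y) N
    in contradiction
      (ℚP.≤-trans
        (≤-gap {1ℚ} _ (0≤p*p a ⊞ 0≤p*p b)
          (solve 2 (λ a b → con 1ℚ :+ a :* a :+ b :* b :≡ con 1ℚ :+ (a :* a :+ b :* b)) refl a b))
        (le N ℕP.≤-refl))
      (from-no (1ℚ ℚP.≤? 0ℚ ℚ.+ ½))

  bound-≥ : ⊢ const 0ℚ ≤ᶠ bound
  bound-≥ = valid-≤ _ _ λ ω n →
    from-yes (0ℚ ℚP.≤? 1ℚ) ⊞ 0≤p*p (ℝ.approx (ω v) n) ⊞ 0≤p*p (ℝ.approx (ω y) n)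

  -- (1 + a² + b²)² = a² + 1 + a⁴ + b⁴ + a² + 2 b² + 2 a² b²
  square-≤ : ∀ a b → a ℚ.* a ℚ.+ 0ℚ ℚ.≤
             (1ℚ ℚ.+ a ℚ.* a ℚ.+ b ℚ.* b) ℚ.* (1ℚ ℚ.+ a ℚ.* a ℚ.+ b ℚ.* b)
  square-≤ a b = ≤-gap _
    (0≤p*p 1ℚ ⊞ 0≤p*p (a ℚ.* a) ⊞ 0≤p*p (b ℚ.* b) ⊞ 0≤p*p a ⊞ 0≤p*p b ⊞ 0≤p*p b
     ⊞ 0≤p*p (a ℚ.* b) ⊞ 0≤p*p (a ℚ.* b))
    (solve 2 (λ a b → (con 1ℚ :+ a :* a :+ b :* b) :* (con 1ℚ :+ a :* a :+ b :* b) :≡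
       (a :* a :+ con 0ℚ) :+ (con 1ℚ :* con 1ℚ :+ (a :* a) :* (a :* a) :+ (b :* b) :* (b :* b)
         :+ a :* a :+ b :* b :+ b :* b :+ (a :* b) :* (a :* b) :+ (a :* b) :* (a :* b)))
      refl a b)

  square-v : ⊢ square (var v) ≤ᶠ bound ⊗ bound
  square-v = valid-≤ _ _ λ ω n → square-≤ (ℝ.approx (ω v) n) (ℝ.approx (ω y) n)

  square-y : ⊢ square (var y) ≤ᶠ bound ⊗ bound
  square-y = valid-≤ _ _ λ ω n → let a = ℝ.approx (ω v) n ; b = ℝ.approx (ω y) n in
    subst (b ℚ.* b ℚ.+ 0ℚ ℚ.≤_)
      (solve 2 (λ a b → (con 1ℚ :+ b :* b :+ a :* a) :* (con 1ℚ :+ b :* b :+ a :* a) :≡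
                        (con 1ℚ :+ a :* a :+ b :* b) :* (con 1ℚ :+ a :* a :+ b :* b)) refl a b)
      (square-≤ b a)

  I-independent : Independent I
  I-independent = I , ⇔-refl , All⇒∉
    (c≢t ∷ c≢y ∷ c≢v ∷ c≢t ∷ c≢M ∷ c≢v ∷ c≢v ∷ c≢M ∷ c≢M ∷ c≢M ∷ c≢y ∷ c≢y ∷ c≢M ∷ c≢M ∷ [])
    where
    c≢v = ≢-sym v≢c
    c≢y = ≢-sym y≢c
    c≢t = ≢-sym t≢c
    c≢M = ≢-sym M≢c

  ahead-flow : ⊢ ahead ⇒ flow
  ahead-flow = begin
    ahead
      -- `ahead` and `const 0ℚ ≤ᶠ time` are the same formula, which therefore serves both as the
      -- guard on `t` and inside the invariant.
      ≲⟨ tauto 6 (a₁ ⇒′ a₂ ⇒′ a₃ ⇒′ a₄ ⇒′ a₅ ⇒′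
                  a₀ ⇒′ a₀ ∧′ a₁ ∧′ a₂ ∧′ a₀ ∧′ (a₃ ∧′ a₄) ∧′ (a₃ ∧′ a₅))
         · bound-> · time-≈ · bound-≥ · square-v · square-y ⟩
    const 0ℚ ≤ᶠ time ∧ reached time bound
      ≲⟨ ∃-intro time (∧-subst
           (subst (λ s → (const 0ℚ ≤ᶠ var t) [ time / t ] (const 0ℚ ≤ᶠ s)) (substT-same t _) lit)
           (reached-subst v≢t y≢t (substT-same t _) (substT-fresh time bound (All⇒∉
             (≢-sym v≢t ∷ ≢-sym v≢t ∷ ≢-sym y≢t ∷ ≢-sym y≢t ∷ []))))) ⟩
    ⟨ act (t :=*) ⟩ (const 0ℚ ≤ᶠ var t ∧ reached (var t) bound)
      ≲⟨ mono _ (tauto 3 ((a₁ ⇒′ a₂) ⇒′ a₀ ∧′ a₁ ⇒′ a₀ ∧′ a₂) ·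
           ∃-intro bound (reached-subst v≢M y≢M (substT-other _ t≢M) (substT-same M _))) ⟩
    ⟨ act (t :=*) ⟩ (const 0ℚ ≤ᶠ var t ∧ ⟨ act (M :=*) ⟩ reached (var t) (var M))
      ≲⟨ mono _ (tauto 3 ((a₁ ⇒′ a₂) ⇒′ a₀ ∧′ a₁ ⇒′ a₀ ∧′ a₂) ·
           mono _ (tauto 3 ((a₁ ⇒′ a₂) ⇒′ a₀ ∧′ a₁ ⇒′ a₀ ∧′ a₂) ·
             coloop-greatest κ₀ κ₀-injective c (pos 0) _ ⊤ᶠ I-independent λ χ p →
               ⇒-trans I-step (⇔-from (ρ-dia χ p)))) ⟩
    ⟨ act (t :=*) ⟩ (const 0ℚ ≤ᶠ var t ∧ ⟨ act (M :=*) ⟩ (lit (neg (var M ≼ const 0ℚ)) ∧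
        ⟨ G (ν (pos 0) (Axiom.ρ (lit trueᴸ))) ⟩ ⊤ᶠ))
      ≈⟨ ⇔-trans (compose _ _ ⊤ᶠ) (dia-cong _ (⇔-trans (∩-dia _ _ ⊤ᶠ) (∧-cong (G-lit _ ⊤ᶠ)
           (⇔-trans (compose _ _ ⊤ᶠ) (dia-cong _ (⇔-trans (∩-dia _ _ ⊤ᶠ)
             (∧-cong (G-lit _ ⊤ᶠ) ⇔-refl))))))) ⟨
    flow
      ∎

-- Replacement of actions by games

Below : ℕ → List Var → Set
Below N = All (ℕ._< N)

below-∉ : ∀ {N v xs} → N ℕ.≤ v → Below N xs → v ∉ xs
below-∉ N≤v b v∈ = ℕP.<-irrefl refl (ℕP.<-≤-trans (All.lookup b v∈) N≤v)

-- Program variables lie below `N`. The field `below` concerns free variables only: the game may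
-- bind others, and `⟨ game ⟩ φ` remains an admissible postcondition for a preceding game or an
-- enclosing loop.
record Replacement (Q : Act → Set) (N : ℕ) (γ : Game) : Set where
  field
    game  : Game
    acts∈ : All Q (actsG game)
    below : Below N (freeG game)
    sound : ∀ φ → Below N (free φ) → ⊢ ⟨ γ ⟩ φ ⇔ ⟨ game ⟩ φ

open Replacement

below-dia : ∀ {N} γ φ → Below N (freeG γ) → Below N (free φ) → Below N (free (⟨ γ ⟩ φ))
below-dia γ φ p q = ++⁺ p (filter⁺ (_∉? mustBoundG γ) q)

module _ {P Q : Act → Set} (N : ℕ)
         (r : ∀ a → P a → Below N (varsAct a) → Replacement Q N (act a)) where

  mutual
    replaceG : ∀ γ → All P (actsG γ) → Below N (varsG γ) → Replacement Q N γ
    replaceG (act a) (p ∷ []) b = r a p b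
    replaceG (⁇ φ) p b with φ′ , p′ , b′ , φ⇔φ′ ← replaceF φ p b = record
      { game  = ⁇ φ′
      ; acts∈ = p′
      ; below = b′
      ; sound = λ ψ _ → ⇔-trans (test φ ψ)
          (⇔-trans (∧-cong φ⇔φ′ ⇔-refl) (⇔-sym (test φ′ ψ)))
      }
    replaceG (γ ∪ δ) p b = record
      { game  = game g ∪ game h
      ; acts∈ = ++⁺ (acts∈ g) (acts∈ h)
      ; below = ++⁺ (below g) (below h)
      ; sound = λ φ bφ → ⇔-trans (choice γ δ φ)
          (⇔-trans (∨-cong (sound g φ bφ) (sound h φ bφ)) (⇔-sym (choice _ _ φ)))
      }
      where
      g = replaceG γ (++⁻ˡ (actsG γ) p) (++⁻ˡ (varsG γ) b)
      h = replaceG δ (++⁻ʳ (actsG γ) p) (++⁻ʳ (varsG γ) b)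
    replaceG (γ ⨾ δ) p b = record
      { game  = game g ⨾ game h
      ; acts∈ = ++⁺ (acts∈ g) (acts∈ h)
      ; below = ++⁺ (below g) (filter⁺ (_∉? mustBoundG (game g)) (below h))
      ; sound = λ φ bφ → ⇔-trans (compose γ δ φ)
          (⇔-trans (dia-cong γ (sound h φ bφ))
          (⇔-trans (sound g _ (below-dia (game h) φ (below h) bφ)) (⇔-sym (compose _ _ φ))))
      }
      where
      g = replaceG γ (++⁻ˡ (actsG γ) p) (++⁻ˡ (varsG γ) b)
      h = replaceG δ (++⁻ʳ (actsG γ) p) (++⁻ʳ (varsG γ) b)
    replaceG (γ *) p b = record
      { game  = game g *
      ; acts∈ = acts∈ g
      ; below = below g
      ; sound = λ φ bφ → ⇔-intro
          -- In each direction `sound g` is applied to the opposite loop as postcondition, whose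
          -- free variables must therefore stay below `N`.
          (fixpoint γ (tauto 4 ((a₀ ⇔′ a₁) ⇒′ (a₃ ⇔′ a₂ ∨′ a₁) ⇒′ a₂ ∨′ a₀ ⇒′ a₃)
            · sound g _ (below-dia (game g *) φ (below g) bφ) · unfold (game g) φ))
          (fixpoint (game g) (tauto 4 ((a₁ ⇔′ a₀) ⇒′ (a₃ ⇔′ a₂ ∨′ a₁) ⇒′ a₂ ∨′ a₀ ⇒′ a₃)
            · sound g _ (below-dia (γ *) φ (freeG-⊆ γ b) bφ) · unfold γ φ))
      }
      where g = replaceG γ p b
    replaceG (γ ᵈ) p b = record
      { game  = game g ᵈ
      ; acts∈ = acts∈ g
      ; below = below g
      ; sound = λ φ bφ → ⇔-trans (dual γ φ)
          (⇔-trans (~-cong (sound g (~ φ) bφ)) (⇔-sym (dual (game g) φ)))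
      }
      where g = replaceG γ p b

    replaceF : ∀ φ → All P (acts φ) → Below N (vars φ) →
               ∃[ φ′ ] All Q (acts φ′) × Below N (free φ′) × (⊢ φ ⇔ φ′)
    replaceF (lit l) p b = lit l , [] , b , ⇔-refl
    replaceF (~ φ) p b with φ′ , p′ , b′ , φ⇔φ′ ← replaceF φ p b = ~ φ′ , p′ , b′ , ~-cong φ⇔φ′
    replaceF (φ ∨ ψ) p b
      with φ′ , p′ , b′ , φ⇔φ′ ← replaceF φ (++⁻ˡ (acts φ) p) (++⁻ˡ (vars φ) b)
         | ψ′ , q′ , c′ , ψ⇔ψ′ ← replaceF ψ (++⁻ʳ (acts φ) p) (++⁻ʳ (vars φ) b) =
      (φ′ ∨ ψ′) , ++⁺ p′ q′ , ++⁺ b′ c′ , ∨-cong φ⇔φ′ ψ⇔ψ′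
    replaceF (⟨ γ ⟩ φ) p b
      with φ′ , p′ , b′ , φ⇔φ′ ← replaceF φ (++⁻ʳ (actsG γ) p) (++⁻ʳ (varsG γ) b) =
      ⟨ game g ⟩ φ′ , ++⁺ (acts∈ g) p′ , below-dia (game g) φ′ (below g) b′ ,
      ⇔-trans (dia-cong γ φ⇔φ′) (sound g φ′ b′)
      where g = replaceG γ (++⁻ˡ (actsG γ) p) (++⁻ˡ (varsG γ) b)

Replaceable : (P Q : Act → Set) → Set
Replaceable P Q = ∀ N a → P a → Below N (varsAct a) → Replacement Q N (act a)

Reducible : (P Q : Act → Set) → Set
Reducible P Q = ∀ φ → All P (acts φ) → ∃[ φ′ ] All Q (acts φ′) × (⊢ φ′ ⇔ φ)

replace : ∀ {P Q} → Replaceable P Q → Reducible P Q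
replace r φ p with φ′ , q , _ , φ⇔φ′ ← replaceF (above (vars φ)) (r (above (vars φ))) φ p
                                         (above-bounds (vars φ)) =
  φ′ , q , ⇔-sym φ⇔φ′

infixr 5 _⟫_

_⟫_ : ∀ {P Q R} → Reducible P Q → Reducible Q R → Reducible P R
(f ⟫ g) φ p with φ′ , p′ , e ← f φ p with φ″ , p″ , e′ ← g φ′ p′ = φ″ , p″ , ⇔-trans e′ e

keep : ∀ {Q N} a → Q a → Below N (varsAct a) → Replacement Q N (act a)
keep a q b = record
  { game = act a ; acts∈ = q ∷ [] ; below = freeAct-⊆ a b ; sound = λ φ _ → ⇔-refl }

-- A game may use auxiliary variables ≥ N: assigning them nondeterministically
-- beforehand makes their initial values irrelevant.
module _ {Q : Act → Set} (Q-:=* : ∀ x → Q (x :=*)) (N : ℕ) (γ g : Game)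
         (γ-below : Below N (freeG γ)) (acts-g : All Q (actsG g))
         (g-sound : ∀ φ → Below N (free φ) → ⊢ ⟨ γ ⟩ φ ⇔ ⟨ g ⟩ φ) where

  private
    forget : List Var → Game
    forget = List.foldr (λ v h → act (v :=*) ⨾ h) g

    forget-acts : ∀ vs → All Q (actsG (forget vs))
    forget-acts []       = acts-g
    forget-acts (v ∷ vs) = Q-:=* v ∷ forget-acts vs

    forget-free : ∀ {w} vs → w ∈ freeG (forget vs) → w ∈ freeG g × w ∉ vs
    forget-free []       w∈ = w∈ , λ ()
    forget-free (v ∷ vs) w∈ with w∈′ , w∉v ← ∈-filter⁻ (_∉? v ∷ []) {xs = freeG (forget vs)} w∈
                            with w∈g , w∉vs ← forget-free vs w∈′ =
      w∈g , λ { (here refl) → w∉v (here refl) ; (there p) → w∉vs p }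

    forget-sound : ∀ vs → All (N ℕ.≤_) vs → ∀ φ → Below N (free φ) → ⊢ ⟨ γ ⟩ φ ⇔ ⟨ forget vs ⟩ φ
    forget-sound []       []          φ b = g-sound φ b
    forget-sound (v ∷ vs) (N≤v ∷ N≤vs) φ b = begin-equality
      ⟨ γ ⟩ φ                             ≈⟨ ∃-vacuous v (below-∉ N≤v (below-dia γ φ γ-below b)) ⟨
      ⟨ act (v :=*) ⟩ ⟨ γ ⟩ φ             ≈⟨ dia-cong _ (forget-sound vs N≤vs φ b) ⟩
      ⟨ act (v :=*) ⟩ ⟨ forget vs ⟩ φ     ≈⟨ compose _ _ φ ⟨
      ⟨ act (v :=*) ⨾ forget vs ⟩ φ       ∎

    auxiliary : List Var
    auxiliary = filter (N ℕP.≤?_) (freeG g)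

  forgetting : Replacement Q N γ
  forgetting = record
    { game  = forget auxiliary
    ; acts∈ = forget-acts auxiliary
    ; below = All.tabulate λ w∈ → let w∈g , w∉ = forget-free auxiliary w∈ in
        ℕP.≰⇒> λ N≤w → w∉ (∈-filter⁺ (N ℕP.≤?_) w∈g N≤w)
    ; sound = forget-sound auxiliary (all-filter (N ℕP.≤?_) (freeG g))
    }

-- Evolution domains

data Plain : Act → Set where
  _:=*   : ∀ x → Plain (x :=*)
  _:=_   : ∀ x θ → Plain (x := θ)
  evolve : ∀ {n} (x : Vec Var (suc n)) .(d : Unique x) θ → Plain (evolve x d θ trueᶠᵒ)

⌜⌝-plain : ∀ F → All Plain (acts ⌜ F ⌝)
⌜⌝-plain (lit p)   = []
⌜⌝-plain (~ F)     = ⌜⌝-plain F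
⌜⌝-plain (F ∨ G)   = ++⁺ (⌜⌝-plain F) (⌜⌝-plain G)
⌜⌝-plain (all x F) = (x :=*) ∷ ⌜⌝-plain F
⌜⌝-plain (ex x F)  = (x :=*) ∷ ⌜⌝-plain F

-- The domain condition of the axiom becomes a test behind the clocked evolution, so that the
-- postcondition stands alone. The clock is `N` itself.
remove-domains : Replaceable (λ _ → ⊤) Plain
remove-domains N (x :=*)          _ b = keep _ (x :=*) b
remove-domains N (x := θ)         _ b = keep _ (x := θ) b
remove-domains N (evolve x d θ ψ) _ b = forgetting _:=* N (act a) g (freeAct-⊆ a b)
  ((N := const 0ℚ) ∷ evolve _ (t∉x ∷ d) _ ∷ evolve _ (t∉x ∷ d) _ ∷ ⌜⌝-plain ψ) sound′
  where
  a = evolve x d θ ψ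
  t∉x : VecAll.All (N ≢_) x
  t∉x = toList⁻ (∉⇒All (below-∉ ℕP.≤-refl (++⁻ˡ (toList x) b)))
  past : Fml
  past = [ act (evolve (N ∷ x) (t∉x ∷ d) (⊖ const 1ℚ ∷ Vec.map ⊖_ θ) trueᶠᵒ) ]
           (const 0ℚ ≤ᶠ var N ⇒ ⌜ ψ ⌝)
  clocked : Game
  clocked = act (evolve (N ∷ x) (t∉x ∷ d) (const 1ℚ ∷ θ) trueᶠᵒ)
  g : Game
  g = act (N := const 0ℚ) ⨾ clocked ⨾ ⁇ past
  sound′ : ∀ φ → Below N (free φ) → ⊢ ⟨ act a ⟩ φ ⇔ ⟨ g ⟩ φ
  sound′ φ bφ with φ′ , φ⇔φ′ , _ , N∉ ∷ [] ← avoid φ (N ∷ []) (below-∉ ℕP.≤-refl bφ ∷ []) =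
    begin-equality
      ⟨ act a ⟩ φ                                             ≈⟨ dia-cong _ φ⇔φ′ ⟩
      ⟨ act a ⟩ φ′
        ≈⟨ domain x d θ ψ φ′ N (∉-++ (varsAct a) (below-∉ ℕP.≤-refl b) N∉) t∉x ⟩
      ⟨ act (N := const 0ℚ) ⟩ ⟨ clocked ⟩ (φ′ ∧ past)
        ≈⟨ dia-cong _ (dia-cong _ (⇔-trans (tauto 2 (a₀ ∧′ a₁ ⇔′ a₁ ∧′ a₀)) (⇔-sym (test past φ′)))) ⟩
      ⟨ act (N := const 0ℚ) ⟩ ⟨ clocked ⟩ ⟨ ⁇ past ⟩ φ′       ≈⟨ dia-cong _ (compose _ _ φ′) ⟨
      ⟨ act (N := const 0ℚ) ⟩ ⟨ clocked ⨾ ⁇ past ⟩ φ′         ≈⟨ compose _ _ φ′ ⟨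
      ⟨ g ⟩ φ′                                                ≈⟨ dia-cong _ φ⇔φ′ ⟨
      ⟨ g ⟩ φ                                                 ∎

-- Deterministic assignments

data Assignment : Act → Set where
  _:=_ : ∀ x θ → Assignment (x := θ)

-- The value passes through `N` because `θ` may mention `x`, whose old value is lost once `x` has
-- been chosen anew.
remove-assignments : ∀ {P Q} → (∀ x → Q (x :=*)) → (∀ a → P a → Q a ⊎ Assignment a) → Replaceable P Q
remove-assignments Q-:=* split N a p b with split a p
... | inj₁ q        = keep a q b
... | inj₂ (x := θ) = forgetting Q-:=* N (act (x := θ)) g (freeAct-⊆ (x := θ) b)
    (Q-:=* N ∷ Q-:=* x ∷ []) sound′
  where
  g : Game
  g = act (N :=*) ⨾ ⁇ (var N ≈ᶠ θ) ⨾ act (x :=*) ⨾ ⁇ (var x ≈ᶠ var N)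
  N∉a : N ∉ x ∷ varsT θ
  N∉a = below-∉ ℕP.≤-refl b
  sound′ : ∀ φ → Below N (free φ) → ⊢ ⟨ act (x := θ) ⟩ φ ⇔ ⟨ g ⟩ φ
  sound′ φ bφ with φ′ , φ⇔φ′ , _ , N∉ ∷ [] ← avoid φ (N ∷ []) (below-∉ ℕP.≤-refl bφ ∷ []) =
    begin-equality
      ⟨ act (x := θ) ⟩ φ                                      ≈⟨ dia-cong _ φ⇔φ′ ⟩
      ⟨ act (x := θ) ⟩ φ′                                     ≈⟨ assign x θ N N∉ (N∉a ∘ there) ⟩
      ⟨ act (N :=*) ⟩ (var N ≈ᶠ θ ∧ exchange x N φ′)
        ≈⟨ dia-cong _ (∧-cong ⇔-refl (⇔-intro
             (tauto 3 ((a₀ ∧′ a₁ ⇒′ a₂) ⇒′ a₀ ⇒′ a₁ ⇒′ a₂) · ∃-intro (var N) (∧-subst at (rename N∉))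
               · ≐-refl (var N))
             (∃-elim x (∉-free (exchange x N φ′) (∉-exchange x N φ′ N∉))
               (tauto 3 ((a₀ ⇒′ a₁ ⇒′ a₂) ⇒′ a₀ ∧′ a₁ ⇒′ a₂)
                 · ≐-subst (var x) (var N) self (rename N∉))))) ⟩
      ⟨ act (N :=*) ⟩ (var N ≈ᶠ θ ∧ ⟨ act (x :=*) ⟩ (var x ≈ᶠ var N ∧ φ′))
        ≈⟨ dia-cong _ (∧-cong ⇔-refl (⇔-trans (compose _ _ φ′) (dia-cong _ (test _ φ′)))) ⟨
      ⟨ act (N :=*) ⟩ (var N ≈ᶠ θ ∧ ⟨ act (x :=*) ⨾ ⁇ (var x ≈ᶠ var N) ⟩ φ′)
        ≈⟨ ⇔-trans (compose _ _ φ′) (dia-cong _ (⇔-trans (compose _ _ φ′) (test _ _))) ⟨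
      ⟨ g ⟩ φ′                                                ≈⟨ dia-cong _ φ⇔φ′ ⟨
      ⟨ g ⟩ φ                                                 ∎
    where
    at : (var x ≈ᶠ var N) [ var N / x ] (var N ≈ᶠ var N)
    at = subst₂ (λ s r → (var x ≈ᶠ var N) [ var N / x ] (s ≈ᶠ r)) (substT-same x (var N))
      (substT-other (var N) (N∉a ∘ here)) lit

-- Continuous evolutions in the discrete fragment

data Assigning : Act → Set where
  _:=* : ∀ x → Assigning (x :=*)
  _:=_ : ∀ x θ → Assigning (x := θ)

OnlyAssigning : Mu → Set
OnlyAssigning (lit p)    = ⊤
OnlyAssigning (pvar X)   = ⊤
OnlyAssigning (φ ∨ᵐ ψ)   = OnlyAssigning φ × OnlyAssigning ψ
OnlyAssigning (φ ∧ᵐ ψ)   = OnlyAssigning φ × OnlyAssigning ψ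
OnlyAssigning (⟨ a ⟩ᵐ φ) = Assigning a × OnlyAssigning φ
OnlyAssigning ([ a ]ᵐ φ) = Assigning a × OnlyAssigning φ
OnlyAssigning (μ X φ)    = OnlyAssigning φ
OnlyAssigning (ν X φ)    = OnlyAssigning φ

∃ᵐ*-assigning : ∀ {n} (y : Vec Var n) {φ} → OnlyAssigning φ → OnlyAssigning (∃ᵐ* y φ)
∃ᵐ*-assigning []      p = p
∃ᵐ*-assigning (v ∷ y) p = (v :=*) , ∃ᵐ*-assigning y p

≔*-assigning : ∀ {n} (x y : Vec Var n) {φ} → OnlyAssigning φ → OnlyAssigning (⟨ x ≔* y ⟩ φ)
≔*-assigning []      []      p = p
≔*-assigning (v ∷ x) (w ∷ y) p = (v := var w) , ≔*-assigning x y p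

module _ (κ : PVar → ℕ) (c : Var) where

  open Translate κ c

  G-assigning : ∀ φ → OnlyAssigning φ → All Assigning (actsG (G φ))
  G-assigning (lit p)    _       = []
  G-assigning (pvar X)   _       = (c := numeral X) ∷ []
  G-assigning (φ ∨ᵐ ψ)   (p , q) = ++⁺ (G-assigning φ p) (G-assigning ψ q)
  G-assigning (φ ∧ᵐ ψ)   (p , q) = ++⁺ (G-assigning φ p) (G-assigning ψ q)
  G-assigning (⟨ a ⟩ᵐ φ) (p , q) = p ∷ G-assigning φ q
  G-assigning ([ a ]ᵐ φ) (p , q) = p ∷ G-assigning φ q
  G-assigning (μ X φ)    p       = (c := numeral X) ∷ ++⁺ (G-assigning φ p) []
  G-assigning (ν X φ)    p       = (c := numeral X) ∷ ++⁺ (G-assigning φ p) []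

choose-acts : ∀ {n} (y : Vec Var n) g → All Assigning (actsG g) → All Assigning (actsG (choose y g))
choose-acts []      g p = p
choose-acts (v ∷ y) g p = (v :=*) ∷ choose-acts y g p

copy-acts : ∀ {n} (x y : Vec Var n) → All Assigning (actsG (copy x y))
copy-acts []      []      = []
copy-acts (v ∷ x) (w ∷ y) = (v := var w) ∷ copy-acts x y

module _ {n} (x : Vec Var (suc n)) .(d : Unique x) (θ : Vec Term (suc n))
         (y z u : Vec Var (suc n)) (t M c : Var) where

  open Evolution x d θ y z u t M c

  reach-assigning : OnlyAssigning reach
  reach-assigning = (t :=*) , _ , (M :=*) , _ , _ ,
    ∃ᵐ*-assigning z _ , ∃ᵐ*-assigning z _ ,
    ∃ᵐ*-assigning u ((t := (const ½ ⊗ var t)) , ≔*-assigning y u _ , ≔*-assigning x u _)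

  replace-evolution : ∀ N → Below N (varsAct evolution) → Unique new →
    VecAll.All (N ℕ.≤_) new → N ℕ.≤ c →
    c ∉ varsM (Axiom.lhs (lit trueᴸ)) → c ∉ varsM (Axiom.rhs (lit trueᴸ)) →
    Replacement Assigning N (act evolution)
  replace-evolution N b uniq new≥ c≥ c∉l c∉r = forgetting _:=* N (act evolution) flowGame
    (freeAct-⊆ evolution b)
    (choose-acts y _ (++⁺ (++⁺ (G-assigning κ₀ c reach reach-assigning) []) (copy-acts x y)))
    λ φ bφ → flowGame-sound uniq (VecAll.map (λ N≤v → below-∉ N≤v b) new≥) c∉l c∉r φ
      (below-∉ c≥ bφ ∷ toList⁺ (VecAll.map (λ N≤v → below-∉ N≤v bφ) new≥))

remove-evolutions : Replaceable Plain Assigning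
remove-evolutions N (x :=*)   _ b = keep _ (x :=*) b
remove-evolutions N (x := θ)  _ b = keep _ (x := θ) b
remove-evolutions N (evolve {n} x d θ _) (evolve _ _ _) b =
  replace-evolution x d θ y z u N (suc N) c N b
    (subst Unique (sym new≡) (consecutive-unique N _))
    (subst (VecAll.All (N ℕ.≤_)) (sym new≡) (consecutive-≥ _ ℕP.≤-refl))
    (ℕP.<⇒≤ (All.head (above-bounds known)))
    (∉-++ˡ lhs-vars (∉-++ʳ (N ∷ []) (above∉ known)))
    (∉-++ʳ lhs-vars (∉-++ʳ (N ∷ []) (above∉ known)))
  where
  k = suc n
  y z u : Vec Var (suc n)
  y = consecutive (2 ℕ.+ N) k
  z = consecutive (2 ℕ.+ N ℕ.+ k) k
  u = consecutive (2 ℕ.+ N ℕ.+ k ℕ.+ k) k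
  new≡ : N ∷ suc N ∷ y Vec.++ z Vec.++ u ≡ consecutive N (2 ℕ.+ (k ℕ.+ (k ℕ.+ k)))
  new≡ = cong (λ v → N ∷ suc N ∷ v)
    (trans (cong (y Vec.++_) (consecutive-++ _ k k)) (consecutive-++ _ k (k ℕ.+ k)))
  open ∇ x d θ (lit trueᴸ) y z u N (suc N) (pos 0)
  lhs-vars = varsM lhs
  -- `N` is listed so that `c` also lies above the program variables.
  known = N ∷ lhs-vars ++ varsM rhs
  c = above known

-- Nondeterministic assignments in the continuous fragment

-- Choosing the new value in `y` first keeps the old `x` available, so that the direction of motion
-- can be read off.
∃-assign : ∀ x y φ → y ≢ x → y ∉ free φ →
           ⊢ ⟨ act (x :=*) ⟩ φ ⇒ ⟨ act (y :=*) ⟩ ⟨ act (x := var y) ⟩ φ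
∃-assign x y φ y≢x y∉φ with φ′ , φ⇔φ′ , eq , y∉φ′ ∷ [] ← avoid φ (y ∷ []) (y∉φ ∷ []) = begin
  ⟨ act (x :=*) ⟩ φ                           ≈⟨ dia-cong _ φ⇔φ′ ⟩
  ⟨ act (x :=*) ⟩ φ′
    -- Once the quantifier is eliminated, `x` holds the chosen value, and `y` is picked equal to it.
    ≲⟨ ∃-elim x x∉ (⇒-trans (∃-pick y (var x) φ′ (∉-[] y≢x) (∉-free φ′ y∉φ′))
         (mono _ (tauto 5 ((a₀ ⇒′ a₁) ⇒′ (a₁ ⇒′ a₂ ⇒′ a₃) ⇒′ (a₄ ⇔′ a₃) ⇒′ a₀ ∧′ a₂ ⇒′ a₄)
           · ≐-sym (var y) (var x) · ≐-subst (var x) (var y) self (rename y∉φ′)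
           · assign-subst x (var y) (rename y∉φ′)))) ⟩
  ⟨ act (y :=*) ⟩ ⟨ act (x := var y) ⟩ φ′     ≈⟨ dia-cong _ (dia-cong _ φ⇔φ′) ⟨
  ⟨ act (y :=*) ⟩ ⟨ act (x := var y) ⟩ φ      ∎
  where
  x∉ : x ∉ free (⟨ act (y :=*) ⟩ ⟨ act (x := var y) ⟩ φ′)
  x∉ = ∉-∖ (free (⟨ act (x := var y) ⟩ φ′)) (y ∷ [])
    (∉-++ (y ∷ []) (∉-[] (≢-sym y≢x)) (∉-∖-removed (free φ′) _ (here refl)))

constant-speed : Var → ℚ → Act
constant-speed x q = evolve (x ∷ []) ([] ∷ []) (const q ∷ []) trueᶠᵒ

module _ (N x : Var) (x<N : x ℕ.< N) (q : ℚ) (q²≡1 : q ℚ.* q ≡ 1ℚ) where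

  private
    t M y z u : Var
    t = N
    M = 1 ℕ.+ N
    y = 2 ℕ.+ N
    z = 3 ℕ.+ N
    u = 4 ℕ.+ N

    module Fixed (c : Var) (u<c : u ℕ.< c) where

      open Evolution (x ∷ []) ([] ∷ []) (const q ∷ []) (y ∷ []) (z ∷ []) (u ∷ []) t M c
      open LinearFlow q q²≡1 x y z u t M c (AllPairs.map ℕP.<⇒≢ (Linked⇒AllPairs ℕP.<-trans
        (x<N ∷ ℕP.≤-refl ∷ ℕP.≤-refl ∷ ℕP.≤-refl ∷ ℕP.≤-refl ∷ u<c ∷ [-])))

      copy-assign : ∀ φ → ⊢ ⟨ ⁇ flow ⨾ copy (x ∷ []) (y ∷ []) ⟩ φ ⇔
                            (flow ∧ ⟨ act (x := var y) ⟩ φ)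
      copy-assign φ = ⇔-trans (compose _ _ φ) (⇔-trans (test flow _) (∧-cong ⇔-refl
        (⇔-trans (compose _ _ φ) (dia-cong _ (⇔-trans (test ⊤ᶠ φ)
          (tauto 2 (a₀ ⇒′ (a₀ ∧′ a₁ ⇔′ a₁)) · ⊤-intro))))))

      module _ (c∉l : c ∉ varsM (Axiom.lhs (lit trueᴸ))) (c∉r : c ∉ varsM (Axiom.rhs (lit trueᴸ)))
               (φ : Fml) (bφ : Below N (free φ)) where

        speed-dia : ⊢ ⟨ act (constant-speed x q) ⟩ φ ⇔
                      ⟨ act (y :=*) ⟩ (flow ∧ ⟨ act (x := var y) ⟩ φ)
        speed-dia = ⇔-trans
          (flowGame-sound (consecutive-unique N 5)
            (VecAll.map (λ N≤v → below-∉ N≤v (x<N ∷ [])) (consecutive-≥ 5 ℕP.≤-refl)) c∉l c∉r φ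
            (below-∉ (ℕP.≤-trans (ℕP.m≤n+m N 4) (ℕP.<⇒≤ u<c)) bφ ∷
             toList⁺ (VecAll.map (λ N≤v → below-∉ N≤v bφ) (consecutive-≥ {N} {N} 5 ℕP.≤-refl))))
          (⇔-trans (compose _ _ φ) (dia-cong _ (copy-assign φ)))

        speed-∃ : ⊢ ⟨ act (constant-speed x q) ⟩ φ ⇒ ⟨ act (x :=*) ⟩ φ
        speed-∃ = ⇒-trans (⇔-to speed-dia) (∃-elim y
          (∉-∖ (free φ) (x ∷ []) (below-∉ (ℕP.m≤n+m N 2) bφ))
          (⇒-trans (tauto 2 (a₀ ∧′ a₁ ⇒′ a₁)) (assign-∃ x (var y) φ)))

        ahead-speed : ⊢ const 0ℚ ≤ᶠ const q ⊗ (var y ⊝ var x) ⇒ ⟨ act (x := var y) ⟩ φ ⇒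
                        ⟨ act (constant-speed x q) ⟩ φ
        ahead-speed = tauto 5
          ((a₀ ⇒′ a₁) ⇒′ (a₁ ∧′ a₂ ⇒′ a₃) ⇒′ (a₄ ⇔′ a₃) ⇒′ a₀ ⇒′ a₂ ⇒′ a₄)
          · ahead-flow · ∃-self y (flow ∧ ⟨ act (x := var y) ⟩ φ) · speed-dia

  constant-speed-sound : ∀ φ → Below N (free φ) →
    (⊢ ⟨ act (constant-speed x q) ⟩ φ ⇒ ⟨ act (x :=*) ⟩ φ) ×
    (⊢ const 0ℚ ≤ᶠ const q ⊗ (var y ⊝ var x) ⇒ ⟨ act (x := var y) ⟩ φ ⇒
       ⟨ act (constant-speed x q) ⟩ φ)
  constant-speed-sound φ bφ =
    Fixed.speed-∃ (above known) u<c c∉l c∉r φ bφ , Fixed.ahead-speed (above known) u<c c∉l c∉r φ bφ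
    where
    open ∇ (x ∷ []) ([] ∷ []) (const q ∷ []) (lit trueᴸ) (y ∷ []) (z ∷ []) (u ∷ []) t M (pos 0)
    known = u ∷ varsM lhs ++ varsM rhs
    c∉l = ∉-++ˡ (varsM lhs) (∉-++ʳ (u ∷ []) (above∉ known))
    c∉r = ∉-++ʳ (varsM lhs) (∉-++ʳ (u ∷ []) (above∉ known))
    u<c = All.head (above-bounds known)

data NonAssignment : Act → Set where
  _:=*   : ∀ x → NonAssignment (x :=*)
  evolve : ∀ {n} (x : Vec Var (suc n)) .(d : Unique x) θ ψ → NonAssignment (evolve x d θ ψ)

remove-choices : Replaceable NonAssignment IsContinuous
remove-choices N (x :=*) _ (x<N ∷ _) = record
  { game  = act (constant-speed x 1ℚ) ∪ act (constant-speed x (ℚ.- 1ℚ))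
  ; acts∈ = evolve ∷ evolve ∷ []
  ; below = x<N ∷ x<N ∷ []
  ; sound = sound′
  }
  where
  -- The endpoint variable that `constant-speed-sound` reserves.
  y = 2 ℕ.+ N
  sound′ : ∀ φ → Below N (free φ) → ⊢ ⟨ act (x :=*) ⟩ φ ⇔
             ⟨ act (constant-speed x 1ℚ) ∪ act (constant-speed x (ℚ.- 1ℚ)) ⟩ φ
  sound′ φ bφ = ⇔-trans
    (⇔-intro
      (⇒-trans (∃-assign x y φ (λ y≡x → below-∉ N≤y (x<N ∷ []) (here y≡x)) (below-∉ N≤y bφ))
        (∃-elim y (∉-++ (free (⟨ act (constant-speed x 1ℚ) ⟩ φ)) y∉ y∉)
          -- Whichever side of `x` the endpoint lies on, one of the two speeds leads there.
          (tauto 5 ((a₀ ∨′ a₁) ⇒′ (a₀ ⇒′ a₂ ⇒′ a₃) ⇒′ (a₁ ⇒′ a₂ ⇒′ a₄) ⇒′ a₂ ⇒′ a₃ ∨′ a₄)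
            · sign-cases x y · proj₂ up · proj₂ down)))
      (tauto 3 ((a₁ ⇒′ a₀) ⇒′ (a₂ ⇒′ a₀) ⇒′ a₁ ∨′ a₂ ⇒′ a₀) · proj₁ up · proj₁ down))
    (⇔-sym (choice _ _ φ))
    where
    up = constant-speed-sound N x x<N 1ℚ refl φ bφ
    down = constant-speed-sound N x x<N (ℚ.- 1ℚ) refl φ bφ
    N≤y = ℕP.m≤n+m N 2
    y∉ = below-∉ N≤y (below-dia (act (constant-speed x 1ℚ)) φ (x<N ∷ []) bφ)
remove-choices N (evolve x d θ ψ) _ b = keep (evolve x d θ ψ) evolve b

not-assignment : ∀ a → NonAssignment a ⊎ Assignment a
not-assignment (x :=*)          = inj₁ (x :=*)
not-assignment (x := θ)         = inj₂ (x := θ)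
not-assignment (evolve x d θ ψ) = inj₁ (evolve x d θ ψ)

discrete-or-assignment : ∀ a → Assigning a → IsDiscrete a ⊎ Assignment a
discrete-or-assignment _ (x :=*)  = inj₁ (x :=*)
discrete-or-assignment _ (x := θ) = inj₂ (x := θ)

theorem6p10 : (φ : Fml) →
    (∃[ ρ₁ ] Continuous ρ₁ × (⊢ ρ₁ ⇔ φ)) × (∃[ ρ₂ ] Discrete ρ₂ × (⊢ ρ₂ ⇔ φ))
theorem6p10 φ =
  -- Assignments go before nondeterministic choices because their removal creates new choices.
  (replace (remove-assignments _:=* λ a _ → not-assignment a) ⟫ replace remove-choices) φ any ,
  -- Assignments go last: the clock, the numerals for `c` and the halving of `t` all introduce them.
  (replace remove-domains ⟫ replace remove-evolutions ⟫
    replace (remove-assignments _:=* discrete-or-assignment)) φ any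
  where
  any : All (λ _ → ⊤) (acts φ)
  any = All.tabulate λ _ → tt
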